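{- Consider the functors \[ (-)^\downarrow \colon \mathrm{HAffUn} \to [\mathrm{HAff} \mid \mathrm{Un}], \qquad (-)\text{ - }\mathrm{Mod}\colon \mathrm{HAffUn} \to (\mathrm{ccVar})^{\mathrm{op}}, \qquad (-)\text{ - }\mathrm{Mod}\colon [\mathrm{HAff}\mid\mathrm{Un}] \to (\mathrm{ccVar})^{\mathrm{op}} \] given by $\mathbb{T} \mapsto \mathbb{T}^\downarrow$, $\mathbb{T}\mapsto \mathbb{T}\text{ - }\mathrm{Mod}$ and $[\mathbb{H}\mid M]\mapsto [\mathbb{H}\mid M]\text{ - }\mathrm{Mod}$. All three are equivalences of categories, and the composite of $(-)^\downarrow$ with $(-)\text{ - }\mathrm{Mod}\colon [\mathrm{HAff}\mid\mathrm{Un}] \to (\mathrm{ccVar})^{\mathrm{op}}$ is naturally isomorphic to $(-)\text{ - }\mathrm{Mod}\colon \mathrm{HAffUn}\to(\mathrm{ccVar})^{\mathrm{op}}$. Moreover, this triangle restricts to a triangle of equivalences, commuting to within natural isomorphism, between the full subcategories $\mathrm{HAffUn}^\omega$, $[\mathrm{HAff}^\omega\mid\mathrm{Un}]$ and $(\mathrm{ccVar}^\omega)^{\mathrm{op}}$.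
   Context: Notation: for sets $I,J$, $J^I$ is the set of functions $I \to J$; $u_i$ is the value of $u\in J^I$ at $i$; $\lambda i.\, t_i$ is the function $i \mapsto t_i$; $n$ is identified with $\{1,\dots,n\}$. Algebraic theories. An algebraic theory $\mathbb{T}$ comprises: for each set $I$, a set $T(I)$; for each $i\in I$, an element $\pi_i \in T(I)$; and for all sets $I,J$, a substitution function $T(I)\times T(J)^I \to T(J)$, $(t,u)\mapsto t(u)$; subject to $t(\lambda i.\,\pi_i)=t$, $\pi_i(u)=u_i$ and $(t(u))(v) = t(\lambda i.\, u_i(v))$. A homomorphism $\varphi\colon\mathbb{S}\to\mathbb{T}$ consists of functions $\varphi_I\colon S(I)\to T(I)$ preserving projections and substitution. $\mathbb{T}$ is non-degenerate if $\pi_1\ne\pi_2\in T(2)$, and finitary if each $t\in T(I)$ can be written as $t(x)=u(x_{i_1},\dots,x_{i_n})$ for some $n \in \mathbb{N}$, $i_1,\dots,i_n\in I$ and $u\in T(n)$. Equations in variables $x,y,x_i,x_{ij}$ are universally quantified over all sets $K$ and all elements of $T(K)$. Models and varieties. A $\mathbb{T}$-model is a (possibly empty) set $X$ with functions $T(I)\times X^I\to X$, $(t,x)\mapsto [\![t]\!](x)$, such that $[\![\pi_i]\!](x)=x_i$ and $[\![t(u)]\!](x)=[\![t]\!](\lambda i.\,[\![u_i]\!](x))$; homomorphisms preserve the functions $[\![t]\!]$. $\mathbb{T}\text{ - }\mathrm{Mod}$ is the category of $\mathbb{T}$-models, seen as concrete (via the underlying-set functor). A homomorphism $\varphi\colon\mathbb{S}\to\mathbb{T}$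 induces the functor $\varphi^*\colon\mathbb{T}\text{ - }\mathrm{Mod}\to\mathbb{S}\text{ - }\mathrm{Mod}$ over $\mathrm{Set}$ with $[\![t]\!]_{\varphi^*X}=[\![\varphi(t)]\!]_X$. A variety is the concrete category of (possibly empty) models of a possibly infinitary single-sorted equational theory, possibly with a proper class of function symbols, for which free models on all sets exist; it is finitary if presentable by operations of finite arity, and non-degenerate if some model has at least two elements. $\mathrm{Var}$ is the category of varieties and concrete functors (functors commuting strictly with the underlying-set functors). $\mathrm{ccVar}$ (resp. $\mathrm{ccVar}^\omega$) is the full subcategory of $\mathrm{Var}$ on the non-degenerate cartesian closed (resp. cartesian closed finitary) varieties. Hyperaffine--unary theories. $t \in T(I)$ is affine if $t(\lambda i.\, x) = x$, and hyperaffine if also $t(\lambda i.\, t(\lambda j.\, x_{ij})) = t(\lambda i.\, x_{ii})$. $\mathbb{T}$ is hyperaffine if every operation is so. $\mathbb{T}$ is hyperaffine--unary if each $t\in T(I)$ has a unique decomposition $t = h(\lambda i.\, m(x_i))$ with $h\in T(I)$ hyperaffine and $m\in T(1)$. $\mathrm{HAffUn}$ (resp. $\mathrm{HAffUn}^\omega$) is the category of non-degenerate (resp. non-degenerate finitary) hyperaffine--unary theories and all theory homomorphisms. Matched pairs of theories. A matched pair of theories $[\mathbb{H}\mid M]$ is a hyperaffine theory $\mathbb{H}$ and a monoid $M$ with operations, for each set $I$, $M\times H(I)\to H(I)$, $(m,h)\mapsto m^*h$ and $H(I)\times M^I\to M$, $(h,n)\mapsto h\rhd n$, satisfying: $m^*\pi_i=\pi_i$;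 $m^*(h(k))=(m^*h)(\lambda i.\,m^*k_i)$; $1^*h=h$; $m^*(n^*h)=(mn)^*h$; $\pi_i\rhd m=m_i$; $h(k)\rhd m=h\rhd(\lambda i.\,k_i\rhd m)$; $(h\rhd m)n=h\rhd(\lambda i.\,m_in)$; $n(h\rhd m)=(n^*h)\rhd(\lambda i.\,nm_i)$; $(k\rhd m)^*h=k(\lambda j.\,m_j^*h)$. It is finitary or non-degenerate when $\mathbb{H}$ is so. A homomorphism $[\varphi\mid f]\colon[\mathbb{H}\mid M]\to[\mathbb{H}'\mid M']$ is a theory homomorphism $\varphi\colon\mathbb{H}\to\mathbb{H}'$ and a monoid homomorphism $f\colon M\to M'$ with $\varphi(m^*h)=f(m)^*(\varphi(h))$ and $f(h\rhd n)=\varphi(h)\rhd(\lambda i.\,f(n_i))$. $[\mathrm{HAff}\mid\mathrm{Un}]$ (resp. $[\mathrm{HAff}^\omega\mid\mathrm{Un}]$) is the category of non-degenerate (resp. non-degenerate finitary) matched pairs of theories. The functor $(-)^\downarrow$. For $\mathbb{T}$ hyperaffine--unary, $\mathbb{T}^\downarrow=[\mathbb{H}\mid M]$, where $\mathbb{H}$ is the subtheory of hyperaffine operations, $M=T(1)$ is the monoid under substitution $mn=m(n)$, $m^*h\in H(I)$ is the unique hyperaffine operation with $m(h(\lambda i.\,x_i))=(m^*h)(\lambda i.\,m(x_i))$, and $h\rhd n\in M$ is the unary operation $h(\lambda i.\,n_i(x))$. On morphisms, $\varphi\mapsto[\varphi|_{\mathbb{H}}\mid\varphi|_M]$. Models of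 matched pairs. An $[\mathbb{H}\mid M]$-model is a set $X$ with an $\mathbb{H}$-model structure $[\![-]\!]$ and a left $M$-action $\cdot$ such that $(h\rhd m)\cdot x=[\![h]\!](\lambda i.\,m_i\cdot x)$ for $x \in X$, $m \in M^I$, and $n\cdot[\![h]\!](x)=[\![n^*h]\!](\lambda i.\,n\cdot x_i)$ for $x\in X^I$, $n\in M$. Homomorphisms preserve both structures. $[\mathbb{H}\mid M]\text{ - }\mathrm{Mod}$ is the resulting variety; a homomorphism $[\varphi\mid f]$ induces a concrete functor $[\mathbb{H}'\mid M']\text{ - }\mathrm{Mod}\to[\mathbb{H}\mid M]\text{ - }\mathrm{Mod}$ acting by $\varphi^*$ and $f^*$ on the two structures. -}

module Defs where

-- Conventions.  The sets I, J, K that serve as arities and as sets of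
-- variables are types in `Set`, and J^I is the function type I → J.  The sets
-- that carry algebraic structure (the T(I), monoids, models) are setoids, since
-- there are no quotient types; "Set", as the target of underlying-set functors,
-- is thus the category of setoids and their maps, and the equality of
-- parallel morphisms is always part of the data of a category.
-- The natural number n, as a set, is Fin n.

open import Algebra.Bundles using (Monoid)
open import Algebra.Morphism.Structures using (IsMonoidHomomorphism)
open import Data.Fin.Base using (Fin; zero; suc)
open import Data.Nat.Base using (ℕ)
open import Data.Product.Base using (Σ; Σ-syntax; _×_; _,_; proj₁; proj₂)
open import Function.Bundles using (Func; _⟨$⟩_; _↔_)
import Function.Construct.Composition as Composition
import Function.Construct.Identity as Identity
open import Level using (Level; 0ℓ; _⊔_) renaming (suc to lsuc)
open import Relation.Binary.Bundles using (Setoid)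
open import Relation.Binary.Structures using (IsEquivalence)
import Relation.Binary.Construct.On as On
import Relation.Binary.Reasoning.Setoid as SetoidReasoning
open import Relation.Nullary.Negation.Core using (¬_)

private
  variable
    o ℓ e o′ ℓ′ e′ o″ ℓ″ e″ p q : Level

record Category (o ℓ e : Level) : Set (lsuc (o ⊔ ℓ ⊔ e)) where
  infix  4 _≈_ _⇒_
  infixr 9 _⊚_
  field
    Obj       : Set o
    _⇒_       : Obj → Obj → Set ℓ
    _≈_       : ∀ {A B} → A ⇒ B → A ⇒ B → Set e
    id        : ∀ {A} → A ⇒ A
    _⊚_       : ∀ {A B C} → B ⇒ C → A ⇒ B → A ⇒ C
    equiv     : ∀ {A B} → IsEquivalence (_≈_ {A} {B})
    assoc     : ∀ {A B C D} {f : A ⇒ B} {g : B ⇒ C} {h : C ⇒ D} →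
                (h ⊚ g) ⊚ f ≈ h ⊚ (g ⊚ f)
    identityˡ : ∀ {A B} {f : A ⇒ B} → id ⊚ f ≈ f
    identityʳ : ∀ {A B} {f : A ⇒ B} → f ⊚ id ≈ f
    ⊚-resp-≈  : ∀ {A B C} {f f′ : B ⇒ C} {g g′ : A ⇒ B} →
                f ≈ f′ → g ≈ g′ → f ⊚ g ≈ f′ ⊚ g′

  module Equiv {A B} = IsEquivalence (equiv {A} {B})

op : Category o ℓ e → Category o ℓ e
op C = record
  { Obj       = Obj
  ; _⇒_       = λ A B → B ⇒ A
  ; _≈_       = _≈_
  ; id        = id
  ; _⊚_       = λ f g → g ⊚ f
  ; equiv     = equiv
  ; assoc     = Equiv.sym assoc
  ; identityˡ = identityʳ
  ; identityʳ = identityˡ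
  ; ⊚-resp-≈  = λ p q → ⊚-resp-≈ q p
  } where open Category C

FullSubcategory : (C : Category o ℓ e) → (Category.Obj C → Set p) →
                  Category (o ⊔ p) ℓ e
FullSubcategory C P = record
  { Obj       = Σ Obj P
  ; _⇒_       = λ A B → proj₁ A ⇒ proj₁ B
  ; _≈_       = _≈_
  ; id        = id
  ; _⊚_       = _⊚_
  ; equiv     = equiv
  ; assoc     = assoc
  ; identityˡ = identityˡ
  ; identityʳ = identityʳ
  ; ⊚-resp-≈  = ⊚-resp-≈
  } where open Category C

record Functor (C : Category o ℓ e) (D : Category o′ ℓ′ e′)
               : Set (o ⊔ ℓ ⊔ e ⊔ o′ ⊔ ℓ′ ⊔ e′) where
  private
    module C = Category C
    module D = Category D
  field
    F₀       : C.Obj → D.Obj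
    F₁       : ∀ {A B} → A C.⇒ B → F₀ A D.⇒ F₀ B
    F-resp-≈ : ∀ {A B} {f g : A C.⇒ B} → f C.≈ g → F₁ f D.≈ F₁ g
    identity : ∀ {A} → F₁ (C.id {A}) D.≈ D.id
    homomorphism : ∀ {X Y Z} {f : X C.⇒ Y} {g : Y C.⇒ Z} →
                   F₁ (g C.⊚ f) D.≈ F₁ g D.⊚ F₁ f

idF : (C : Category o ℓ e) → Functor C C
idF C = record
  { F₀ = λ A → A ; F₁ = λ f → f ; F-resp-≈ = λ p → p
  ; identity = Equiv.refl ; homomorphism = Equiv.refl
  } where open Category C

infixr 9 _∘F_

_∘F_ : {C : Category o ℓ e} {D : Category o′ ℓ′ e′} {E : Category o″ ℓ″ e″} →
       Functor D E → Functor C D → Functor C E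
_∘F_ {E = E} G F = record
  { F₀           = λ A → G.F₀ (F.F₀ A)
  ; F₁           = λ f → G.F₁ (F.F₁ f)
  ; F-resp-≈     = λ p → G.F-resp-≈ (F.F-resp-≈ p)
  ; identity     = E.Equiv.trans (G.F-resp-≈ F.identity) G.identity
  ; homomorphism = E.Equiv.trans (G.F-resp-≈ F.homomorphism) G.homomorphism
  }
  where
  module F = Functor F
  module G = Functor G
  module E = Category E

restrict : {C : Category o ℓ e} {D : Category o′ ℓ′ e′} (F : Functor C D)
           {P : Category.Obj C → Set p} {Q : Category.Obj D → Set q} →
           (∀ A → P A → Q (Functor.F₀ F A)) →
           Functor (FullSubcategory C P) (FullSubcategory D Q)
restrict F pres = record
  { F₀           = λ A → F₀ (proj₁ A) , pres (proj₁ A) (proj₂ A)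
  ; F₁           = F₁
  ; F-resp-≈     = F-resp-≈
  ; identity     = identity
  ; homomorphism = homomorphism
  } where open Functor F

record Isomorphism (C : Category o ℓ e) (A B : Category.Obj C) : Set (ℓ ⊔ e) where
  open Category C
  field
    to   : A ⇒ B
    from : B ⇒ A
    isoˡ : from ⊚ to ≈ id
    isoʳ : to ⊚ from ≈ id

record NaturalIsomorphism {C : Category o ℓ e} {D : Category o′ ℓ′ e′}
                          (F G : Functor C D) : Set (o ⊔ ℓ ⊔ ℓ′ ⊔ e′) where
  private
    module C = Category C
    module F = Functor F
    module G = Functor G
  open Category D
  field
    component : ∀ A → Isomorphism D (F.F₀ A) (G.F₀ A)
    natural   : ∀ {A B} (f : A C.⇒ B) →
                Isomorphism.to (component B) ⊚ F.F₁ f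
                  ≈ G.F₁ f ⊚ Isomorphism.to (component A)

record IsEquivalenceOfCategories {C : Category o ℓ e} {D : Category o′ ℓ′ e′}
         (F : Functor C D) : Set (o ⊔ ℓ ⊔ e ⊔ o′ ⊔ ℓ′ ⊔ e′) where
  field
    inverse : Functor D C
    unit    : NaturalIsomorphism (idF C) (inverse ∘F F)
    counit  : NaturalIsomorphism (F ∘F inverse) (idF D)

record CartesianClosed (C : Category o ℓ e) : Set (o ⊔ ℓ ⊔ e) where
  open Category C
  field
    ⊤        : Obj
    !        : ∀ {A} → A ⇒ ⊤
    !-unique : ∀ {A} (f : A ⇒ ⊤) → f ≈ !

    _⊗_      : Obj → Obj → Obj
    π₁       : ∀ {A B} → A ⊗ B ⇒ A
    π₂       : ∀ {A B} → A ⊗ B ⇒ B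
    ⟨_,_⟩    : ∀ {A B X} → X ⇒ A → X ⇒ B → X ⇒ A ⊗ B
    project₁ : ∀ {A B X} {f : X ⇒ A} {g : X ⇒ B} → π₁ ⊚ ⟨ f , g ⟩ ≈ f
    project₂ : ∀ {A B X} {f : X ⇒ A} {g : X ⇒ B} → π₂ ⊚ ⟨ f , g ⟩ ≈ g
    ⟨⟩-unique : ∀ {A B X} {f : X ⇒ A} {g : X ⇒ B} {k : X ⇒ A ⊗ B} →
                π₁ ⊚ k ≈ f → π₂ ⊚ k ≈ g → k ≈ ⟨ f , g ⟩

    _^_      : Obj → Obj → Obj
    eval     : ∀ {A B} → (B ^ A) ⊗ A ⇒ B
    curry    : ∀ {A B X} → X ⊗ A ⇒ B → X ⇒ B ^ A
    β        : ∀ {A B X} {f : X ⊗ A ⇒ B} →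
               eval ⊚ ⟨ curry f ⊚ π₁ , π₂ ⟩ ≈ f
    curry-unique : ∀ {A B X} {f : X ⊗ A ⇒ B} {k : X ⇒ B ^ A} →
                   eval ⊚ ⟨ k ⊚ π₁ , π₂ ⟩ ≈ f → k ≈ curry f

idₛ : {X : Setoid 0ℓ 0ℓ} → Func X X
idₛ {X} = Identity.function X

infixr 9 _∘ₛ_

_∘ₛ_ : {X Y Z : Setoid 0ℓ 0ℓ} → Func Y Z → Func X Y → Func X Z
g ∘ₛ f = Composition.function f g

infix 4 _≗ₛ_

_≗ₛ_ : {X Y : Setoid 0ℓ 0ℓ} → Func X Y → Func X Y → Set
_≗ₛ_ {X} {Y} f g = ∀ x → Setoid._≈_ Y (f ⟨$⟩ x) (g ⟨$⟩ x)

-- A category with a faithful functor to the category of setoids, presented by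
-- its fibres: the objects over X are the structures on X, and the morphisms
-- are those maps that are homomorphisms.

record ConcreteCategory : Set₂ where
  field
    Str        : Setoid 0ℓ 0ℓ → Set₁
    IsHom      : ∀ {X Y} → Str X → Str Y → Func X Y → Set₁
    IsHom-resp : ∀ {X Y} {a : Str X} {b : Str Y} {f g : Func X Y} →
                 f ≗ₛ g → IsHom a b f → IsHom a b g
    id-hom     : ∀ {X} {a : Str X} → IsHom a a idₛ
    ∘-hom      : ∀ {X Y Z} {a : Str X} {b : Str Y} {c : Str Z}
                 {g : Func Y Z} {f : Func X Y} →
                 IsHom b c g → IsHom a b f → IsHom a c (g ∘ₛ f)

  -- Equality of objects lying over the same set.  Varieties are amnestic, so
  -- there it says that the two structures have equal operations.
  _≈ₛₜᵣ_ : ∀ {X} → Str X → Str X → Set₁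
  a ≈ₛₜᵣ b = IsHom a b idₛ × IsHom b a idₛ

  ≈ₛₜᵣ-isEquivalence : ∀ {X} → IsEquivalence (_≈ₛₜᵣ_ {X})
  ≈ₛₜᵣ-isEquivalence {X} = record
    { refl  = id-hom , id-hom
    ; sym   = λ (p , q) → q , p
    ; trans = λ (p , q) (p′ , q′) → comp p p′ , comp q′ q
    }
    where
    comp : ∀ {a b c : Str X} → IsHom a b idₛ → IsHom b c idₛ → IsHom a c idₛ
    comp p q = IsHom-resp (λ _ → Setoid.refl X) (∘-hom q p)

  category : Category (lsuc 0ℓ) (lsuc 0ℓ) 0ℓ
  category = record
    { Obj       = Σ (Setoid 0ℓ 0ℓ) Str
    ; _⇒_       = λ (X , a) (Y , b) → Σ (Func X Y) (IsHom a b)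
    ; _≈_       = λ f g → proj₁ f ≗ₛ proj₁ g
    ; id        = idₛ , id-hom
    ; _⊚_       = λ (g , q) (f , p) → (g ∘ₛ f) , ∘-hom q p
    ; equiv     = λ {_} {(Y , _)} → record
        { refl  = λ _ → Setoid.refl Y
        ; sym   = λ p x → Setoid.sym Y (p x)
        ; trans = λ p q x → Setoid.trans Y (p x) (q x)
        }
    ; assoc     = λ {_} {_} {_} {(Z , _)} _ → Setoid.refl Z
    ; identityˡ = λ {_} {(Y , _)} _ → Setoid.refl Y
    ; identityʳ = λ {_} {(Y , _)} _ → Setoid.refl Y
    ; ⊚-resp-≈  = λ {_} {_} {(Z , _)} {(f , _)} {_} {_} {(g′ , _)} p q x →
        Setoid.trans Z (Func.cong f (q x)) (p (g′ ⟨$⟩ x))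
    }

-- A functor that commutes strictly with the underlying-set functors: it leaves
-- underlying sets and underlying maps unchanged.

record ConcreteFunctor (C D : ConcreteCategory) : Set₁ where
  private
    module C = ConcreteCategory C
    module D = ConcreteCategory D
  field
    str : ∀ {X} → C.Str X → D.Str X
    hom : ∀ {X Y} {a : C.Str X} {b : C.Str Y} {f : Func X Y} →
          C.IsHom a b f → D.IsHom (str a) (str b) f

Conc : Category (lsuc (lsuc 0ℓ)) (lsuc 0ℓ) (lsuc 0ℓ)
Conc = record
  { Obj       = ConcreteCategory
  ; _⇒_       = ConcreteFunctor
  ; _≈_       = λ {_} {D} F G → ∀ {X} a →
                  ConcreteCategory._≈ₛₜᵣ_ D {X} (str F a) (str G a)
  ; id        = record { str = λ a → a ; hom = λ p → p }
  ; _⊚_       = λ G F → record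
                  { str = λ a → str G (str F a) ; hom = λ p → hom G (hom F p) }
  ; equiv     = λ {_} {D} → record
      { refl  = λ _ → E.refl D
      ; sym   = λ p a → E.sym D (p a)
      ; trans = λ p q a → E.trans D (p a) (q a)
      }
  ; assoc     = λ {_} {_} {_} {D} _ → E.refl D
  ; identityˡ = λ {_} {D} _ → E.refl D
  ; identityʳ = λ {_} {D} _ → E.refl D
  ; ⊚-resp-≈  = λ {_} {_} {D} {F} {_} {_} {G′} p q a →
      E.trans D (hom F (proj₁ (q a)) , hom F (proj₂ (q a))) (p (str G′ a))
  }
  where
  open ConcreteFunctor
  module E (D : ConcreteCategory) {X} =
    IsEquivalence (ConcreteCategory.≈ₛₜᵣ-isEquivalence D {X})

-- A type in Set₁ plays the role of a possibly proper class.

record Signature : Set₂ where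
  field
    Symbol : Set₁
    Arity  : Symbol → Set

module _ (Ω : Signature) where
  open Signature Ω

  data Term (V : Set) : Set₁ where
    var   : V → Term V
    apply : (σ : Symbol) → (Arity σ → Term V) → Term V

  record Algebra (X : Setoid 0ℓ 0ℓ) : Set₁ where
    open Setoid X
    field
      interp      : (σ : Symbol) → (Arity σ → Carrier) → Carrier
      interp-cong : ∀ σ {x y} → (∀ i → x i ≈ y i) → interp σ x ≈ interp σ y

    evaluate : ∀ {V} → Term V → (V → Carrier) → Carrier
    evaluate (var v)     ρ = ρ v
    evaluate (apply σ t) ρ = interp σ (λ i → evaluate (t i) ρ)

record EquationalTheory : Set₂ where
  field
    signature : Signature
    Equation  : Set₁
    Variables : Equation → Set
    lhs rhs   : (E : Equation) → Term signature (Variables E)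
  open Signature signature public

module _ (𝓔 : EquationalTheory) where
  open EquationalTheory 𝓔

  record EqModel (X : Setoid 0ℓ 0ℓ) : Set₁ where
    open Setoid X
    field
      algebra : Algebra signature X
    open Algebra algebra public
    field
      satisfies : ∀ E (ρ : Variables E → Carrier) →
                  evaluate (lhs E) ρ ≈ evaluate (rhs E) ρ

  IsEqModelHom : ∀ {X Y} → EqModel X → EqModel Y → Func X Y → Set₁
  IsEqModelHom {X} {Y} a b f = ∀ σ (x : Arity σ → Setoid.Carrier X) →
    f ⟨$⟩ EqModel.interp a σ x ≈ EqModel.interp b σ (λ i → f ⟨$⟩ x i)
    where open Setoid Y

  EqModels : ConcreteCategory
  EqModels = record
    { Str        = EqModel
    ; IsHom      = IsEqModelHom
    ; IsHom-resp = λ {_} {Y} {a} {b} {f} {g} p h σ x →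
        let open Setoid Y in
        trans (sym (p _)) (trans (h σ x) (EqModel.interp-cong b σ (λ i → p (x i))))
    ; id-hom     = λ {X} _ _ → Setoid.refl X
    ; ∘-hom      = λ {_} {_} {Z} {_} {_} {_} {g} {f} q p σ x →
        Setoid.trans Z (Func.cong g (p σ x)) (q σ (λ i → f ⟨$⟩ x i))
    }

  FinitaryPresentation : Set₁
  FinitaryPresentation = ∀ σ → Σ[ n ∈ ℕ ] (Arity σ ↔ Fin n)

record FreeObject (C : ConcreteCategory) (I : Set) : Set₁ where
  open ConcreteCategory C
  field
    free   : Setoid 0ℓ 0ℓ
    str    : Str free
    η      : I → Setoid.Carrier free
    extend : ∀ {Y} (b : Str Y) (x : I → Setoid.Carrier Y) →
             Σ[ f ∈ Func free Y ]
               IsHom str b f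
             × (∀ i → Setoid._≈_ Y (f ⟨$⟩ η i) (x i))
             × (∀ (g : Func free Y) → IsHom str b g →
                  (∀ i → Setoid._≈_ Y (g ⟨$⟩ η i) (x i)) → g ≗ₛ f)

record IsVariety (C : ConcreteCategory) : Set₂ where
  field
    theory       : EquationalTheory
    free         : ∀ I → FreeObject (EqModels theory) I
    presentation : Isomorphism Conc C (EqModels theory)

IsFinitaryVariety : ConcreteCategory → Set₂
IsFinitaryVariety C = Σ[ 𝓔 ∈ EquationalTheory ]
  FinitaryPresentation 𝓔 × Isomorphism Conc C (EqModels 𝓔)

IsNonDegenerateVariety : ConcreteCategory → Set₁
IsNonDegenerateVariety C = Σ[ X ∈ Setoid 0ℓ 0ℓ ] ConcreteCategory.Str C X ×
  (let open Setoid X in Σ[ x ∈ Carrier ] Σ[ y ∈ Carrier ] ¬ (x ≈ y))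

record IsCCVariety (C : ConcreteCategory) : Set₂ where
  field
    isVariety       : IsVariety C
    nonDegenerate   : IsNonDegenerateVariety C
    cartesianClosed : CartesianClosed (ConcreteCategory.category C)

Var : Category (lsuc (lsuc 0ℓ)) (lsuc 0ℓ) (lsuc 0ℓ)
Var = FullSubcategory Conc IsVariety

-- A full subcategory of Conc, hence of its full subcategory Var.
ccVar : Category (lsuc (lsuc 0ℓ)) (lsuc 0ℓ) (lsuc 0ℓ)
ccVar = FullSubcategory Conc IsCCVariety

ccVarω : Category (lsuc (lsuc 0ℓ)) (lsuc 0ℓ) (lsuc 0ℓ)
ccVarω = FullSubcategory ccVar (λ C → IsFinitaryVariety (proj₁ C))

record Theory : Set₁ where
  field
    ops : Set → Setoid 0ℓ 0ℓ

  Op : Set → Set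
  Op I = Setoid.Carrier (ops I)

  open module OpSetoid {I : Set} = Setoid (ops I) public
    using (_≈_; refl; sym; trans)

  infixl 9 _[_]
  infixl 8 _·_

  field
    π        : ∀ {I} → I → Op I
    _[_]     : ∀ {I J} → Op I → (I → Op J) → Op J
    []-cong  : ∀ {I J} {t t′ : Op I} {u u′ : I → Op J} →
               t ≈ t′ → (∀ i → u i ≈ u′ i) → t [ u ] ≈ t′ [ u′ ]
    []-π     : ∀ {I} (t : Op I) → t [ π ] ≈ t
    π-[]     : ∀ {I J} (i : I) (u : I → Op J) → π i [ u ] ≈ u i
    []-assoc : ∀ {I J K} (t : Op I) (u : I → Op J) (v : J → Op K) →
               (t [ u ]) [ v ] ≈ t [ (λ i → u i [ v ]) ]

  []-congʳ : ∀ {I J} (t : Op I) {u u′ : I → Op J} →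
             (∀ i → u i ≈ u′ i) → t [ u ] ≈ t [ u′ ]
  []-congʳ t = []-cong refl

  []-congˡ : ∀ {I J} {t t′ : Op I} {u : I → Op J} → t ≈ t′ → t [ u ] ≈ t′ [ u ]
  []-congˡ p = []-cong p (λ _ → refl)

  _·_ : ∀ {I} → Op (Fin 1) → Op I → Op I
  m · t = m [ (λ _ → t) ]

  -- An equation quantified over all sets K and all elements of T(K) holds as
  -- soon as it holds for the projections π of the free T(I), resp. T(I × I).
  -- This generic instance is used below, because it keeps the
  -- hyperaffine operations of arity I within a small set; the quantified forms
  -- are affine-eq and hyperaffine-eq.

  IsAffine : ∀ {I} → Op I → Set
  IsAffine t = t [ (λ _ → π {Fin 1} zero) ] ≈ π zero

  IsHyperaffine : ∀ {I} → Op I → Set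
  IsHyperaffine {I} t = IsAffine t ×
    t [ (λ i → t [ (λ j → π {I × I} (i , j)) ]) ] ≈ t [ (λ i → π (i , i)) ]

  affine-eq : ∀ {I K} {t : Op I} → IsAffine t → (x : Op K) → t [ (λ _ → x) ] ≈ x
  affine-eq {I} {K} {t} aff x = begin
    t [ (λ _ → x) ]                           ≈⟨ []-congʳ t (λ _ → π-[] zero _) ⟨
    t [ (λ _ → π {Fin 1} zero · x) ]          ≈⟨ []-assoc t _ _ ⟨
    t [ (λ _ → π {Fin 1} zero) ] · x          ≈⟨ []-congˡ aff ⟩
    π zero · x                                ≈⟨ π-[] zero _ ⟩
    x                                         ∎
    where open SetoidReasoning (ops K)

  hyperaffine-eq : ∀ {I K} {t : Op I} → IsHyperaffine t → (x : I → I → Op K) →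
                   t [ (λ i → t [ x i ]) ] ≈ t [ (λ i → x i i) ]
  hyperaffine-eq {I} {K} {t} (_ , hyp) x = begin
    t [ (λ i → t [ x i ]) ]
      ≈⟨ []-congʳ t (λ i → []-congʳ t (λ j → π-[] (i , j) x′)) ⟨
    t [ (λ i → t [ (λ j → π (i , j) [ x′ ]) ]) ]
      ≈⟨ []-congʳ t (λ i → []-assoc t _ x′) ⟨
    t [ (λ i → t [ (λ j → π (i , j)) ] [ x′ ]) ]
      ≈⟨ []-assoc t _ x′ ⟨
    t [ (λ i → t [ (λ j → π (i , j)) ]) ] [ x′ ]
      ≈⟨ []-congˡ hyp ⟩
    t [ (λ i → π (i , i)) ] [ x′ ]
      ≈⟨ []-assoc t _ x′ ⟩
    t [ (λ i → π (i , i) [ x′ ]) ]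
      ≈⟨ []-congʳ t (λ i → π-[] (i , i) x′) ⟩
    t [ (λ i → x i i) ] ∎
    where
    open SetoidReasoning (ops K)
    x′ : I × I → Op K
    x′ (i , j) = x i j

  NonDegenerate : Set
  NonDegenerate = ¬ (π {Fin 2} zero ≈ π (suc zero))

  IsFinitary : Set₁
  IsFinitary = ∀ {I} (t : Op I) →
    Σ[ n ∈ ℕ ] Σ[ i ∈ (Fin n → I) ] Σ[ u ∈ Op (Fin n) ] t ≈ u [ (λ k → π (i k)) ]

  IsHyperaffineTheory : Set₁
  IsHyperaffineTheory = ∀ {I} (t : Op I) → IsHyperaffine t

  record Decomposition {I : Set} (t : Op I) : Set where
    field
      h           : Op I
      hyperaffine : IsHyperaffine h
      m           : Op (Fin 1)
      equation    : t ≈ h [ (λ i → m · π i) ]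

  IsHyperaffineUnary : Set₁
  IsHyperaffineUnary = ∀ {I} (t : Op I) →
    Σ[ d ∈ Decomposition t ] (∀ (d′ : Decomposition t) →
      (Decomposition.h d′ ≈ Decomposition.h d) × (Decomposition.m d′ ≈ Decomposition.m d))

record TheoryHom (𝕊 𝕋 : Theory) : Set₁ where
  private
    module S = Theory 𝕊
    module T = Theory 𝕋
  field
    map      : ∀ {I} → S.Op I → T.Op I
    map-cong : ∀ {I} {s s′ : S.Op I} → s S.≈ s′ → map s T.≈ map s′
    map-π    : ∀ {I} (i : I) → map (S.π i) T.≈ T.π i
    map-[]   : ∀ {I J} (s : S.Op I) (u : I → S.Op J) →
               map (s S.[ u ]) T.≈ map s T.[ (λ i → map (u i)) ]

Theories : Category (lsuc 0ℓ) (lsuc 0ℓ) (lsuc 0ℓ)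
Theories = record
  { Obj       = Theory
  ; _⇒_       = TheoryHom
  ; _≈_       = λ {_} {𝕋} φ ψ → ∀ {I} s → Theory._≈_ 𝕋 {I} (map φ s) (map ψ s)
  ; id        = λ {𝕋} → let open Theory 𝕋 in record
      { map = λ s → s ; map-cong = λ p → p
      ; map-π = λ _ → refl ; map-[] = λ _ _ → refl }
  ; _⊚_       = λ {_} {_} {𝕌} ψ φ → let open Theory 𝕌 in record
      { map      = λ s → map ψ (map φ s)
      ; map-cong = λ p → map-cong ψ (map-cong φ p)
      ; map-π    = λ i → trans (map-cong ψ (map-π φ i)) (map-π ψ i)
      ; map-[]   = λ s u → trans (map-cong ψ (map-[] φ s u)) (map-[] ψ _ _) }
  ; equiv     = λ {_} {𝕋} → let open Theory 𝕋 in record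
      { refl = λ _ → refl ; sym = λ p s → sym (p s)
      ; trans = λ p q s → trans (p s) (q s) }
  ; assoc     = λ {_} {_} {_} {𝕋} _ → Theory.refl 𝕋
  ; identityˡ = λ {_} {𝕋} _ → Theory.refl 𝕋
  ; identityʳ = λ {_} {𝕋} _ → Theory.refl 𝕋
  ; ⊚-resp-≈  = λ {_} {_} {𝕋} {ψ} {_} {_} {φ′} p q s →
      Theory.trans 𝕋 (map-cong ψ (q s)) (p (map φ′ s))
  }
  where open TheoryHom

record IsHAffUn (𝕋 : Theory) : Set₁ where
  field
    hyperaffineUnary : Theory.IsHyperaffineUnary 𝕋
    nonDegenerate    : Theory.NonDegenerate 𝕋

HAffUn : Category (lsuc 0ℓ) (lsuc 0ℓ) (lsuc 0ℓ)
HAffUn = FullSubcategory Theories IsHAffUn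

HAffUnω : Category (lsuc 0ℓ) (lsuc 0ℓ) (lsuc 0ℓ)
HAffUnω = FullSubcategory HAffUn (λ T → Theory.IsFinitary (proj₁ T))

module _ (𝕋 : Theory) where
  open Theory 𝕋 using (Op; π; _[_]) renaming (_≈_ to _≈ₒ_)

  record Model (X : Setoid 0ℓ 0ℓ) : Set₁ where
    open Setoid X
    field
      ⟦_⟧    : ∀ {I} → Op I → (I → Carrier) → Carrier
      ⟦⟧-cong : ∀ {I} {t t′ : Op I} {x x′ : I → Carrier} →
                t ≈ₒ t′ → (∀ i → x i ≈ x′ i) → ⟦ t ⟧ x ≈ ⟦ t′ ⟧ x′
      ⟦π⟧     : ∀ {I} (i : I) (x : I → Carrier) → ⟦ π i ⟧ x ≈ x i
      ⟦[]⟧    : ∀ {I J} (t : Op I) (u : I → Op J) (x : J → Carrier) →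
                ⟦ t [ u ] ⟧ x ≈ ⟦ t ⟧ (λ i → ⟦ u i ⟧ x)

  IsModelHom : ∀ {X Y} → Model X → Model Y → Func X Y → Set₁
  IsModelHom {X} {Y} a b f = ∀ {I} (t : Op I) (x : I → Setoid.Carrier X) →
    f ⟨$⟩ Model.⟦_⟧ a t x ≈ Model.⟦_⟧ b t (λ i → f ⟨$⟩ x i)
    where open Setoid Y

  _-Mod : ConcreteCategory
  _-Mod = record
    { Str        = Model
    ; IsHom      = IsModelHom
    ; IsHom-resp = λ {_} {Y} {a} {b} {f} {g} p h t x →
        let open Setoid Y in
        trans (sym (p _))
          (trans (h t x) (Model.⟦⟧-cong b (Theory.refl 𝕋) (λ i → p (x i))))
    ; id-hom     = λ {X} _ _ → Setoid.refl X
    ; ∘-hom      = λ {_} {_} {Z} {_} {_} {_} {g} {f} q p t x →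
        Setoid.trans Z (Func.cong g (p t x)) (q t (λ i → f ⟨$⟩ x i))
    }

module _ {𝕊 𝕋 : Theory} (φ : TheoryHom 𝕊 𝕋) where
  open TheoryHom φ

  reindex : ∀ {X} → Model 𝕋 X → Model 𝕊 X
  reindex {X} a = record
    { ⟦_⟧     = λ s → ⟦ map s ⟧
    ; ⟦⟧-cong = λ p → ⟦⟧-cong (map-cong p)
    ; ⟦π⟧     = λ i x → trans (⟦⟧-cong (map-π i) (λ _ → refl)) (⟦π⟧ i x)
    ; ⟦[]⟧    = λ s u x → trans (⟦⟧-cong (map-[] s u) (λ _ → refl)) (⟦[]⟧ _ _ x)
    }
    where
    open Setoid X
    open Model a

  _* : ConcreteFunctor (𝕋 -Mod) (𝕊 -Mod)
  _* = record { str = reindex ; hom = λ p s x → p (map s) x }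

Mod : Functor Theories (op Conc)
Mod = record
  { F₀           = _-Mod
  ; F₁           = _*
  ; F-resp-≈     = λ p {X} a →
      (λ s x → Model.⟦⟧-cong a (p s) (λ _ → Setoid.refl X))
    , (λ {I} s x → Setoid.sym X (Model.⟦⟧-cong a (p s) (λ _ → Setoid.refl X)))
  ; identity     = λ {_} {X} a → (λ _ _ → Setoid.refl X) , (λ _ _ → Setoid.refl X)
  ; homomorphism = λ {_} {_} {_} {_} {_} {X} a →
      (λ _ _ → Setoid.refl X) , (λ _ _ → Setoid.refl X)
  }

record MatchedPair : Set₁ where
  infixr 8 _^*_
  infixr 7 _▷_
  field
    H             : Theory
    M             : Monoid 0ℓ 0ℓ
    H-hyperaffine : Theory.IsHyperaffineTheory H
  open Theory H public using (Op; π; _[_]) renaming (_≈_ to _≈ₕ_)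
  open Monoid M public using (_∙_; ε) renaming (Carrier to ∣M∣; _≈_ to _≈ₘ_)
  field
    _^*_    : ∀ {I} → ∣M∣ → Op I → Op I
    _▷_     : ∀ {I} → Op I → (I → ∣M∣) → ∣M∣
    ^*-cong : ∀ {I} {m m′} {h h′ : Op I} → m ≈ₘ m′ → h ≈ₕ h′ → m ^* h ≈ₕ m′ ^* h′
    ▷-cong  : ∀ {I} {h h′ : Op I} {n n′} → h ≈ₕ h′ → (∀ i → n i ≈ₘ n′ i) →
              h ▷ n ≈ₘ h′ ▷ n′

    ^*-π    : ∀ {I} m (i : I) → m ^* π i ≈ₕ π i
    ^*-[]   : ∀ {I J} m (h : Op I) (k : I → Op J) →
              m ^* (h [ k ]) ≈ₕ (m ^* h) [ (λ i → m ^* k i) ]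
    ^*-ε    : ∀ {I} (h : Op I) → ε ^* h ≈ₕ h
    ^*-∙    : ∀ {I} m n (h : Op I) → m ^* (n ^* h) ≈ₕ (m ∙ n) ^* h
    π-▷     : ∀ {I} (i : I) m → π i ▷ m ≈ₘ m i
    []-▷    : ∀ {I J} (h : Op I) (k : I → Op J) m →
              (h [ k ]) ▷ m ≈ₘ h ▷ (λ i → k i ▷ m)
    ▷-∙ʳ    : ∀ {I} (h : Op I) m n → (h ▷ m) ∙ n ≈ₘ h ▷ (λ i → m i ∙ n)
    ▷-∙ˡ    : ∀ {I} n (h : Op I) m → n ∙ (h ▷ m) ≈ₘ (n ^* h) ▷ (λ i → n ∙ m i)
    ▷-^*    : ∀ {I J} (k : Op J) m (h : Op I) →
              (k ▷ m) ^* h ≈ₕ k [ (λ j → m j ^* h) ]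

record MatchedPairHom (P Q : MatchedPair) : Set₁ where
  private
    module P = MatchedPair P
    module Q = MatchedPair Q
  field
    φ        : TheoryHom P.H Q.H
    f        : P.∣M∣ → Q.∣M∣
    f-isHom  : IsMonoidHomomorphism (Monoid.rawMonoid P.M) (Monoid.rawMonoid Q.M) f
  open TheoryHom φ public
  open IsMonoidHomomorphism f-isHom public using (ε-homo) renaming (⟦⟧-cong to f-cong; homo to ∙-homo)
  field
    map-^*   : ∀ {I} m (h : P.Op I) → map (m P.^* h) Q.≈ₕ f m Q.^* map h
    f-▷      : ∀ {I} (h : P.Op I) n → f (h P.▷ n) Q.≈ₘ map h Q.▷ (λ i → f (n i))

MatchedPairs : Category (lsuc 0ℓ) (lsuc 0ℓ) (lsuc 0ℓ)
MatchedPairs = record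
  { Obj       = MatchedPair
  ; _⇒_       = MatchedPairHom
  ; _≈_       = λ {_} {Q} F G →
      (Category._≈_ Theories (φ F) (φ G)) × (∀ m → MatchedPair._≈ₘ_ Q (f F m) (f G m))
  ; id        = λ {P} → record
      { φ       = Category.id Theories
      ; f       = λ m → m
      ; f-isHom = MonoidId.isMonoidHomomorphism (rawMonoid (M P)) (refl (M P))
      ; map-^*  = λ _ _ → Theory.refl (H P)
      ; f-▷     = λ _ _ → refl (M P)
      }
  ; _⊚_       = λ {_} {_} {R} G F → record
      { φ       = Category._⊚_ Theories (φ G) (φ F)
      ; f       = λ m → f G (f F m)
      ; f-isHom = MonoidComp.isMonoidHomomorphism (trans (M R)) (f-isHom F) (f-isHom G)
      ; map-^*  = λ m h → Theory.trans (H R) (map-cong G (map-^* F m h)) (map-^* G _ _)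
      ; f-▷     = λ h n → trans (M R) (f-cong G (f-▷ F h n)) (f-▷ G _ _)
      }
  ; equiv     = λ {_} {Q} → record
      { refl  = (λ _ → Theory.refl (H Q)) , (λ _ → refl (M Q))
      ; sym   = λ (p , q) → (λ s → Theory.sym (H Q) (p s)) , (λ m → sym (M Q) (q m))
      ; trans = λ (p , q) (p′ , q′) →
          (λ s → Theory.trans (H Q) (p s) (p′ s)) , (λ m → trans (M Q) (q m) (q′ m))
      }
  ; assoc     = λ {_} {_} {_} {Q} → (λ _ → Theory.refl (H Q)) , (λ _ → refl (M Q))
  ; identityˡ = λ {_} {Q} → (λ _ → Theory.refl (H Q)) , (λ _ → refl (M Q))
  ; identityʳ = λ {_} {Q} → (λ _ → Theory.refl (H Q)) , (λ _ → refl (M Q))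
  ; ⊚-resp-≈  = λ {_} {_} {Q} {G} {_} {_} {F′} (p , q) (p′ , q′) →
      (λ s → Theory.trans (H Q) (map-cong G (p′ s)) (p (map F′ s)))
    , (λ m → trans (M Q) (f-cong G (q′ m)) (q (f F′ m)))
  }
  where
  open MatchedPair using (H; M)
  open MatchedPairHom
  open Monoid using (rawMonoid; refl; sym; trans)
  import Algebra.Morphism.Construct.Identity as MonoidId
  import Algebra.Morphism.Construct.Composition as MonoidComp

IsNonDegeneratePair : MatchedPair → Set
IsNonDegeneratePair P = Theory.NonDegenerate (MatchedPair.H P)

IsFinitaryPair : MatchedPair → Set₁
IsFinitaryPair P = Theory.IsFinitary (MatchedPair.H P)

[HAff∣Un] : Category (lsuc 0ℓ) (lsuc 0ℓ) (lsuc 0ℓ)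
[HAff∣Un] = FullSubcategory MatchedPairs IsNonDegeneratePair

[HAffω∣Un] : Category (lsuc 0ℓ) (lsuc 0ℓ) (lsuc 0ℓ)
[HAffω∣Un] = FullSubcategory [HAff∣Un] (λ P → IsFinitaryPair (proj₁ P))

module _ (P : MatchedPair) where
  open MatchedPair P

  record PairModel (X : Setoid 0ℓ 0ℓ) : Set₁ where
    infixr 8 _•_
    open Setoid X
    field
      model   : Model H X
    open Model model public
    field
      _•_     : ∣M∣ → Carrier → Carrier
      •-cong  : ∀ {m m′ x x′} → m ≈ₘ m′ → x ≈ x′ → m • x ≈ m′ • x′
      ε-•     : ∀ x → ε • x ≈ x
      ∙-•     : ∀ m n x → (m ∙ n) • x ≈ m • (n • x)
      ▷-•     : ∀ {I} (h : Op I) m x → (h ▷ m) • x ≈ ⟦ h ⟧ (λ i → m i • x)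
      •-⟦⟧    : ∀ {I} n (h : Op I) x → n • ⟦ h ⟧ x ≈ ⟦ n ^* h ⟧ (λ i → n • x i)

  IsPairModelHom : ∀ {X Y} → PairModel X → PairModel Y → Func X Y → Set₁
  IsPairModelHom {X} {Y} a b f =
      IsModelHom H (PairModel.model a) (PairModel.model b) f
    × (∀ m x → f ⟨$⟩ PairModel._•_ a m x ≈ PairModel._•_ b m (f ⟨$⟩ x))
    where open Setoid Y

  _-PairMod : ConcreteCategory
  _-PairMod = record
    { Str        = PairModel
    ; IsHom      = IsPairModelHom
    ; IsHom-resp = λ {_} {Y} {a} {b} {f} {g} p (h , k) →
        let open Setoid Y in
        ConcreteCategory.IsHom-resp (H -Mod)
          {a = PairModel.model a} {PairModel.model b} {f} {g} p h
      , λ m x → trans (sym (p _)) (trans (k m x) (PairModel.•-cong b (Monoid.refl M) (p x)))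
    ; id-hom     = λ {X} → (λ _ _ → Setoid.refl X) , (λ _ _ → Setoid.refl X)
    ; ∘-hom      = λ {_} {_} {Z} {a} {b} {c} {g} {f} (q , q′) (p , p′) →
        ConcreteCategory.∘-hom (H -Mod)
          {a = PairModel.model a} {PairModel.model b} {PairModel.model c} {g} {f} q p
      , λ m x → Setoid.trans Z (Func.cong g (p′ m x)) (q′ m (f ⟨$⟩ x))
    }

module _ {P Q : MatchedPair} (F : MatchedPairHom P Q) where
  private
    module P = MatchedPair P
    module Q = MatchedPair Q
  open MatchedPairHom F

  reindexPair : ∀ {X} → PairModel Q X → PairModel P X
  reindexPair {X} a = record
    { model  = reindex φ model
    ; _•_    = λ m → f m •_
    ; •-cong = λ p → •-cong (f-cong p)
    ; ε-•    = λ x → trans (•-cong ε-homo refl) (ε-• x)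
    ; ∙-•    = λ m n x → trans (•-cong (∙-homo m n) refl) (∙-• _ _ x)
    ; ▷-•    = λ h m x → trans (•-cong (f-▷ h m) refl) (▷-• _ _ x)
    ; •-⟦⟧   = λ n h x → trans (•-⟦⟧ _ _ x)
        (sym (⟦⟧-cong (map-^* n h) (λ _ → refl)))
    }
    where
    open Setoid X
    open PairModel a

  _⁎ : ConcreteFunctor (Q -PairMod) (P -PairMod)
  _⁎ = record
    { str = reindexPair
    ; hom = λ (p , q) → (λ s x → p (map s) x) , (λ m x → q (f m) x)
    }

PairMod : Functor MatchedPairs (op Conc)
PairMod = record
  { F₀           = _-PairMod
  ; F₁           = _⁎
  ; F-resp-≈     = λ (p , q) {X} a →
      let open Setoid X
          open PairModel a
      in
      ( (λ s x → ⟦⟧-cong (p s) (λ _ → refl)) , (λ m x → •-cong (q m) refl) )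
    , ( (λ s x → sym (⟦⟧-cong (p s) (λ _ → refl))) , (λ m x → sym (•-cong (q m) refl)) )
  ; identity     = λ {_} {X} _ → let open Setoid X in
      ((λ _ _ → refl) , (λ _ _ → refl)) , ((λ _ _ → refl) , (λ _ _ → refl))
  ; homomorphism = λ {_} {_} {_} {_} {_} {X} _ → let open Setoid X in
      ((λ _ _ → refl) , (λ _ _ → refl)) , ((λ _ _ → refl) , (λ _ _ → refl))
  }

module Down (𝕋 : Theory) (hau : Theory.IsHyperaffineUnary 𝕋) where
  open Theory 𝕋
  open Decomposition

  hyperaffine-resp : ∀ {I} {t u : Op I} → t ≈ u → IsHyperaffine t → IsHyperaffine u
  hyperaffine-resp p (aff , hyp) =
      trans ([]-congˡ (sym p)) aff
    , trans ([]-cong (sym p) (λ i → []-congˡ (sym p))) (trans hyp ([]-congˡ p))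

  ·-identityʳ : ∀ (m : Op (Fin 1)) → m · π zero ≈ m
  ·-identityʳ m = trans ([]-congʳ m (λ { zero → refl })) ([]-π m)

  ·-[] : ∀ {I J} (m : Op (Fin 1)) (t : Op I) (x : I → Op J) →
         (m · t) [ x ] ≈ m · (t [ x ])
  ·-[] m t x = []-assoc m _ x

  unary-part : ∀ {I} {h : Op I} → IsHyperaffine h → (m : Op (Fin 1)) →
               h [ (λ i → m · π i) ] [ (λ _ → π zero) ] ≈ m
  unary-part {_} {h} (aff , _) m = begin
    h [ (λ i → m · π i) ] [ (λ _ → π zero) ]
      ≈⟨ []-assoc h _ _ ⟩
    h [ (λ i → (m · π i) [ (λ _ → π zero) ]) ]
      ≈⟨ []-congʳ h (λ i → trans (·-[] m (π i) _) ([]-congʳ m (λ _ → π-[] i _))) ⟩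
    h [ (λ i → m · π zero) ]
      ≈⟨ affine-eq aff (m · π zero) ⟩
    m · π zero
      ≈⟨ ·-identityʳ m ⟩
    m ∎
    where open SetoidReasoning (ops (Fin 1))

  hyperaffine-part : ∀ {I} {h h′ : Op I} {m m′ : Op (Fin 1)} →
    IsHyperaffine h → IsHyperaffine h′ →
    h [ (λ i → m · π i) ] ≈ h′ [ (λ i → m′ · π i) ] → h ≈ h′
  hyperaffine-part {_} {h} {h′} {m} {m′} hyp hyp′ p =
    trans (proj₁ (unique (record { h = h ; hyperaffine = hyp ; m = m ; equation = refl })))
      (sym (proj₁ (unique (record { h = h′ ; hyperaffine = hyp′ ; m = m′ ; equation = p }))))
    where unique = proj₂ (hau (h [ (λ i → m · π i) ]))

  affine⇒hyperaffine : ∀ {I} {t : Op I} → IsAffine t → IsHyperaffine t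
  affine⇒hyperaffine {I} {t} aff = hyperaffine-resp (sym t≈h) (hyperaffine d)
    where
    d : Decomposition t
    d = proj₁ (hau t)
    m≈1 : m d ≈ π zero
    m≈1 = trans (sym (unary-part (hyperaffine d) (m d)))
            (trans ([]-congˡ (sym (equation d))) aff)
    t≈h : t ≈ h d
    t≈h = begin
      t                            ≈⟨ equation d ⟩
      h d [ (λ i → m d · π i) ]    ≈⟨ []-congʳ (h d) (λ i → []-congˡ m≈1) ⟩
      h d [ (λ i → π zero · π i) ] ≈⟨ []-congʳ (h d) (λ i → π-[] zero _) ⟩
      h d [ π ]                    ≈⟨ []-π (h d) ⟩
      h d                          ∎
      where open SetoidReasoning (ops I)

  π-hyperaffine : ∀ {I} (i : I) → IsHyperaffine (π i)
  π-hyperaffine i = affine⇒hyperaffine (π-[] i _)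

  []-hyperaffine : ∀ {I J} {t : Op I} {u : I → Op J} →
                   IsHyperaffine t → (∀ i → IsHyperaffine (u i)) → IsHyperaffine (t [ u ])
  []-hyperaffine {_} {_} {t} {u} (aff , _) hyp = affine⇒hyperaffine
    (trans ([]-assoc t u _) (trans ([]-congʳ t (λ i → proj₁ (hyp i))) aff))

  commute : ∀ {I J K} {t : Op I} {u : Op J} → IsHyperaffine t → IsHyperaffine u →
            (x : I → J → Op K) →
            t [ (λ i → u [ (λ j → x i j) ]) ] ≈ u [ (λ j → t [ (λ i → x i j) ]) ]
  commute {I} {J} {K} {t} {u} hypₜ hypᵤ x = begin
    t [ (λ i → u [ (λ j → x i j) ]) ]
      ≈⟨ w-[] (λ (i , j) → x i j) ⟨
    w [ (λ (i , j) → x i j) ]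
      ≈⟨ hyperaffine-eq w-hyperaffine (λ (i , j) (i′ , j′) → x i′ j) ⟨
    w [ (λ (i , j) → w [ (λ (i′ , j′) → x i′ j) ]) ]
      ≈⟨ w-[] (λ (i , j) → w [ (λ (i′ , j′) → x i′ j) ]) ⟩
    t [ (λ i → u [ (λ j → w [ (λ (i′ , j′) → x i′ j) ]) ]) ]
      ≈⟨ affine-eq (proj₁ hypₜ) _ ⟩
    u [ (λ j → w [ (λ (i′ , j′) → x i′ j) ]) ]
      ≈⟨ []-congʳ u (λ j → w-[] (λ (i′ , j′) → x i′ j)) ⟩
    u [ (λ j → t [ (λ i′ → u [ (λ j′ → x i′ j) ]) ]) ]
      ≈⟨ []-congʳ u (λ j → []-congʳ t (λ i′ → affine-eq (proj₁ hypᵤ) (x i′ j))) ⟩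
    u [ (λ j → t [ (λ i′ → x i′ j) ]) ] ∎
    where
    open SetoidReasoning (ops K)
    w : Op (I × J)
    w = t [ (λ i → u [ (λ j → π (i , j)) ]) ]
    w-hyperaffine : IsHyperaffine w
    w-hyperaffine = []-hyperaffine hypₜ
      (λ i → []-hyperaffine hypᵤ (λ j → π-hyperaffine (i , j)))
    w-[] : ∀ {L} (y : I × J → Op L) → w [ y ] ≈ t [ (λ i → u [ (λ j → y (i , j)) ]) ]
    w-[] y = trans ([]-assoc t _ y) ([]-congʳ t (λ i →
      trans ([]-assoc u _ y) ([]-congʳ u (λ j → π-[] (i , j) y))))

  hyperaffineSubtheory : Theory
  hyperaffineSubtheory = record
    { ops      = λ I → On.setoid {B = Σ (Op I) IsHyperaffine} (ops I) proj₁
    ; π        = λ i → π i , π-hyperaffine i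
    ; _[_]     = λ (t , hyp) u →
        t [ (λ i → proj₁ (u i)) ] , []-hyperaffine hyp (λ i → proj₂ (u i))
    ; []-cong  = []-cong
    ; []-π     = λ t → []-π (proj₁ t)
    ; π-[]     = λ i u → π-[] i _
    ; []-assoc = λ t u v → []-assoc (proj₁ t) _ _
    }

  unaryMonoid : Monoid 0ℓ 0ℓ
  unaryMonoid = record
    { Carrier  = Op (Fin 1)
    ; _≈_      = _≈_
    ; _∙_      = _·_
    ; ε        = π zero
    ; isMonoid = record
      { isSemigroup = record
        { isMagma = record
          { isEquivalence = Setoid.isEquivalence (ops (Fin 1))
          ; ∙-cong        = λ p q → []-cong p (λ _ → q) }
        ; assoc = λ m n k → ·-[] m n _ }
      ; identity = (λ m → π-[] zero _) , ·-identityʳ } }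

  _⋆_ : ∀ {I} → Op (Fin 1) → Op I → Op I
  m₀ ⋆ h₀ = h (proj₁ (hau (m₀ · h₀)))

  ⋆-hyperaffine : ∀ {I} m (h : Op I) → IsHyperaffine (m ⋆ h)
  ⋆-hyperaffine m₀ h₀ = hyperaffine (proj₁ (hau (m₀ · h₀)))

  ⋆-spec : ∀ {I} m {h : Op I} → IsHyperaffine h →
           m · h ≈ (m ⋆ h) [ (λ i → m · π i) ]
  ⋆-spec m₀ {h₀} (aff , _) =
    trans (equation d) ([]-congʳ (h d) (λ i → []-congˡ m≈m₀))
    where
    d : Decomposition (m₀ · h₀)
    d = proj₁ (hau (m₀ · h₀))
    m≈m₀ : m d ≈ m₀
    m≈m₀ = begin
      m d                          ≈⟨ unary-part (hyperaffine d) (m d) ⟨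
      h d [ (λ i → m d · π i) ] [ (λ _ → π zero) ]
                                   ≈⟨ []-congˡ (equation d) ⟨
      (m₀ · h₀) [ (λ _ → π zero) ] ≈⟨ ·-[] m₀ h₀ _ ⟩
      m₀ · (h₀ [ (λ _ → π zero) ]) ≈⟨ []-congʳ m₀ (λ _ → aff) ⟩
      m₀ · π zero                  ≈⟨ ·-identityʳ m₀ ⟩
      m₀                           ∎
      where open SetoidReasoning (ops (Fin 1))

  ⋆-eq : ∀ {I J} m {h : Op I} → IsHyperaffine h → (x : I → Op J) →
         m · (h [ x ]) ≈ (m ⋆ h) [ (λ i → m · x i) ]
  ⋆-eq {_} {J} m {h} hyp x = begin
    m · (h [ x ])                           ≈⟨ ·-[] m h x ⟨
    (m · h) [ x ]                           ≈⟨ []-congˡ (⋆-spec m hyp) ⟩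
    (m ⋆ h) [ (λ i → m · π i) ] [ x ]       ≈⟨ []-assoc (m ⋆ h) _ x ⟩
    (m ⋆ h) [ (λ i → (m · π i) [ x ]) ]
      ≈⟨ []-congʳ (m ⋆ h) (λ i → trans (·-[] m (π i) x) ([]-congʳ m (λ _ → π-[] i x))) ⟩
    (m ⋆ h) [ (λ i → m · x i) ]             ∎
    where open SetoidReasoning (ops J)

  ⋆-unique : ∀ {I} {m} {h k : Op I} → IsHyperaffine h → IsHyperaffine k →
             m · h ≈ k [ (λ i → m · π i) ] → m ⋆ h ≈ k
  ⋆-unique {m = m} {h} hyp hyp′ p =
    hyperaffine-part (⋆-hyperaffine m h) hyp′ (trans (sym (⋆-spec m hyp)) p)

  matchedPair : MatchedPair
  matchedPair = record
    { H             = hyperaffineSubtheory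
    ; M             = unaryMonoid
    ; H-hyperaffine = λ (_ , hyp) → hyp
    ; _^*_          = λ m (h , _) → (m ⋆ h) , ⋆-hyperaffine m h
    ; _▷_           = λ (h , _) n → h [ n ]
    ; ^*-cong       = λ {_} {m} {m′} {(h , hyp)} {(h′ , hyp′)} p q →
        ⋆-unique hyp (⋆-hyperaffine m′ h′)
          (trans ([]-cong p (λ _ → q))
            (trans (⋆-spec m′ hyp′) ([]-congʳ _ (λ i → []-congˡ (sym p)))))
    ; ▷-cong        = []-cong
    ; ^*-π          = λ m i → ⋆-unique (π-hyperaffine i) (π-hyperaffine i)
        (sym (π-[] i _))
    ; ^*-[]         = λ m (h , hyp) k → ⋆-unique
        ([]-hyperaffine hyp (λ i → proj₂ (k i)))
        ([]-hyperaffine (⋆-hyperaffine m h) (λ i → ⋆-hyperaffine m (proj₁ (k i))))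
        (trans (⋆-eq m hyp _)
          (trans ([]-congʳ (m ⋆ h) (λ i → ⋆-spec m (proj₂ (k i))))
            (sym ([]-assoc (m ⋆ h) _ _))))
    ; ^*-ε          = λ (h , hyp) → ⋆-unique hyp hyp
        (trans (π-[] zero _)
          (trans (sym ([]-π h)) ([]-congʳ h (λ i → sym (π-[] zero _)))))
    ; ^*-∙          = λ m n (h , hyp) → sym (⋆-unique hyp (⋆-hyperaffine m (n ⋆ h))
        (trans (·-[] m n _)
          (trans ([]-congʳ m (λ _ → ⋆-spec n hyp))
            (trans (⋆-eq m (⋆-hyperaffine n h) _)
              ([]-congʳ (m ⋆ (n ⋆ h)) (λ i → sym (·-[] m n _)))))))
    ; π-▷           = λ i m → π-[] i m
    ; []-▷          = λ h k m → []-assoc (proj₁ h) _ m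
    ; ▷-∙ʳ          = λ h m n → []-assoc (proj₁ h) m _
    ; ▷-∙ˡ          = λ n (h , hyp) m → ⋆-eq n hyp m
    ; ▷-^*          = λ (k , hypₖ) m (h , hypₕ) → ⋆-unique hypₕ
        ([]-hyperaffine hypₖ (λ j → ⋆-hyperaffine (m j) h))
        (▷-⋆ hypₖ m hypₕ)
    }
    where
    ▷-⋆ : ∀ {I J} {k : Op J} → IsHyperaffine k → (m : J → Op (Fin 1)) →
          {h : Op I} → IsHyperaffine h →
          (k [ m ]) · h ≈ k [ (λ j → m j ⋆ h) ] [ (λ i → (k [ m ]) · π i) ]
    ▷-⋆ {I} {_} {k} hypₖ m {h} hypₕ = begin
      (k [ m ]) · h
        ≈⟨ []-assoc k m _ ⟩
      k [ (λ j → m j · h) ]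
        ≈⟨ []-congʳ k (λ j → ⋆-spec (m j) hypₕ) ⟩
      k [ (λ j → (m j ⋆ h) [ (λ i → m j · π i) ]) ]
        ≈⟨ hyperaffine-eq hypₖ (λ j j′ → (m j ⋆ h) [ (λ i → m j′ · π i) ]) ⟨
      k [ (λ j → k [ (λ j′ → (m j ⋆ h) [ (λ i → m j′ · π i) ]) ]) ]
        ≈⟨ []-congʳ k (λ j → commute hypₖ (⋆-hyperaffine (m j) h) (λ j′ i → m j′ · π i)) ⟩
      k [ (λ j → (m j ⋆ h) [ (λ i → k [ (λ j′ → m j′ · π i) ]) ]) ]
        ≈⟨ []-congʳ k (λ j → []-congʳ (m j ⋆ h) (λ i → []-assoc k m _)) ⟨
      k [ (λ j → (m j ⋆ h) [ (λ i → (k [ m ]) · π i) ]) ]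
        ≈⟨ []-assoc k _ _ ⟨
      k [ (λ j → m j ⋆ h) ] [ (λ i → (k [ m ]) · π i) ] ∎
      where open SetoidReasoning (ops I)

module _ {𝕊 𝕋 : Theory} (φ : TheoryHom 𝕊 𝕋) where
  private
    module S = Theory 𝕊
    module T = Theory 𝕋
  open TheoryHom φ

  map-hyperaffine : ∀ {I} {s : S.Op I} → S.IsHyperaffine s → T.IsHyperaffine (map s)
  map-hyperaffine {I} {s} (aff , hyp) =
      trans (sym (trans (map-[] s _) ([]-congʳ (map s) (λ _ → map-π zero))))
        (trans (map-cong aff) (map-π zero))
    , trans (sym (trans (map-[] s _) ([]-congʳ (map s) (λ i →
          trans (map-[] s _) ([]-congʳ (map s) (λ j → map-π (i , j)))))))
        (trans (map-cong hyp)
          (trans (map-[] s _) ([]-congʳ (map s) (λ i → map-π (i , i)))))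
    where open T

  downHom : (hauₛ : S.IsHyperaffineUnary) (hauₜ : T.IsHyperaffineUnary) →
            MatchedPairHom (Down.matchedPair 𝕊 hauₛ) (Down.matchedPair 𝕋 hauₜ)
  downHom hauₛ hauₜ = record
    { φ       = record
      { map      = λ (s , hyp) → map s , map-hyperaffine hyp
      ; map-cong = map-cong
      ; map-π    = map-π
      ; map-[]   = λ s u → map-[] (proj₁ s) _
      }
    ; f       = map
    ; f-isHom = record
      { isMagmaHomomorphism = record
        { isRelHomomorphism = record { cong = map-cong }
        ; homo = λ m n → map-[] m _ }
      ; ε-homo = map-π zero }
    ; map-^*  = λ m (h , hyp) → T.sym (DT.⋆-unique
        (map-hyperaffine hyp) (map-hyperaffine (DS.⋆-hyperaffine m h))
        (T.trans (T.sym (map-[] m _))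
          (T.trans (map-cong (DS.⋆-spec m hyp))
            (T.trans (map-[] _ _) (T.[]-congʳ _ (λ i →
              T.trans (map-[] m _) (T.[]-congʳ (map m) (λ _ → map-π i))))))))
    ; f-▷     = λ h n → map-[] (proj₁ h) n
    }
    where
    module DS = Down 𝕊 hauₛ
    module DT = Down 𝕋 hauₜ

↓ : Functor HAffUn [HAff∣Un]
↓ = record
  { F₀           = λ (𝕋 , p) →
      Down.matchedPair 𝕋 (hyperaffineUnary p) , nonDegenerate p
  ; F₁           = λ {(_ , p)} {(_ , q)} φ →
      downHom φ (hyperaffineUnary p) (hyperaffineUnary q)
  ; F-resp-≈     = λ p → (λ s → p (proj₁ s)) , p
  ; identity     = λ {(𝕋 , _)} → (λ _ → Theory.refl 𝕋) , (λ _ → Theory.refl 𝕋)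
  ; homomorphism = λ {_} {_} {(𝕋 , _)} → (λ _ → Theory.refl 𝕋) , (λ _ → Theory.refl 𝕋)
  }
  where open IsHAffUn

-- That the models of 𝕋, resp. P, form a cartesian closed variety is an argument
-- of the next two functors, which are Mod and PairMod with codomain cut down.

HAffUn-Mod : (∀ 𝕋 → IsHAffUn 𝕋 → IsCCVariety (𝕋 -Mod)) → Functor HAffUn (op ccVar)
HAffUn-Mod cc = restrict Mod cc

[HAff∣Un]-Mod : (∀ P → IsNonDegeneratePair P → IsCCVariety (P -PairMod)) →
                Functor [HAff∣Un] (op ccVar)
[HAff∣Un]-Mod cc = restrict PairMod cc

-- A hyperaffine–unary theory amounts to H(I) × M in each arity I, where (h , m)
-- stands for h(λ i. m(x_i)); substituting such pairs into each other is what the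
-- operations m^*h and h ▷ n of a matched pair describe, so ↓ is an equivalence.
-- The exponential Y^X of models of [H ∣ M] consists of the homomorphisms
-- M × X → Y, where (⟦h⟧f)(n , x) = ⟦n^*h⟧(λ i. f_i(n , x)) and
-- (m • f)(n , x) = f(nm , x); hence all these varieties are cartesian closed.
-- Conversely, if the models of 𝕋 are cartesian closed, then F(I) × F(1) is the
-- coproduct of I copies of F(1) × F(1), so there is a unique homomorphism
-- Φ : F(I) × F(1) → F(I) with Φ(m(x_i) , n) = n(x_i).  The hyperaffine part of
-- t is Φ(t , x), its unary part is t(λ i. x), and every law they satisfy holds
-- because two homomorphisms out of such a product agree on the m(x_i).

module Submission where

open import Defs
open import Algebra.Bundles using (Monoid)
open import Data.Fin.Base using (Fin; zero; suc; splitAt; _↑ˡ_; _↑ʳ_)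
open import Data.Fin.Properties using (splitAt-↑ˡ; splitAt-↑ʳ)
open import Data.Nat.Base using (ℕ; _+_)
open import Data.Product.Base using (Σ; Σ-syntax; _×_; _,_; proj₁; proj₂; uncurry)
open import Data.Product.Relation.Binary.Pointwise.NonDependent using (×-setoid)
open import Data.Sum.Base using ([_,_]′)
open import Data.Unit.Base using (⊤; tt)
open import Function.Bundles using (Func; _⟨$⟩_; Inverse)
open import Function.Construct.Identity using (↔-id)
open import Level using (Level; 0ℓ; _⊔_; Lift; lift; lower) renaming (suc to lsuc)
open import Relation.Binary.Bundles using (Setoid)
import Relation.Binary.Construct.On as On
open import Relation.Binary.PropositionalEquality.Core as ≡ using (_≡_)
import Relation.Binary.Reasoning.Setoid as SetoidReasoning

-- The exponential has a forced shape. An element of Y^X is a homomorphism F(1) → Y^X, that is, F(1)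
-- × X → Y. Affine unary operations are identities, so H(1) is a point and F(1) is M. One property
-- of hyperaffine operations carries most calculations. Any two of them commute, so in h(λ i. k_i(λ
-- j. h(...))) the inner h can be moved next to the outer one and merged with it. This closes Y^X
-- under the operations and makes the substitution of pairs associative. Conversely, the coproduct
-- claim holds because (-) × F(1) has a right adjoint, hence preserves the coproduct F(I) of I
-- copies of F(1). In the finitary case the obstacle is that a finitary presentation of a variety
-- need not be the presentation that supplies its free models. Finiteness is therefore read off from
-- the free models themselves: their finitely supported elements form a submodel containing the
-- generators. Only ↓ and the models of theories are treated directly; the third side of the
-- triangle follows by cancelling ↓.

private
  variable
    o ℓ e o′ ℓ′ e′ o″ ℓ″ e″ ℓp ℓq ℓr : Level

-- Equivalences of categories

module _ (C : Category o ℓ e) where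
  open Category C

  Hom : Obj → Obj → Setoid ℓ e
  Hom A B = record { isEquivalence = equiv {A} {B} }

  ≅-sym : ∀ {A B} → Isomorphism C A B → Isomorphism C B A
  ≅-sym i = record { to = from ; from = to ; isoˡ = isoʳ ; isoʳ = isoˡ }
    where open Isomorphism i

  ≅-trans : ∀ {A B D} → Isomorphism C A B → Isomorphism C B D → Isomorphism C A D
  ≅-trans i j = record
    { to   = J.to ⊚ I.to
    ; from = I.from ⊚ J.from
    ; isoˡ = cancel I.isoˡ J.isoˡ
    ; isoʳ = cancel J.isoʳ I.isoʳ
    }
    where
    module I = Isomorphism i
    module J = Isomorphism j
    cancel : ∀ {A B D} {f : A ⇒ B} {f′ : B ⇒ A} {g : B ⇒ D} {g′ : D ⇒ B} →
             f′ ⊚ f ≈ id → g′ ⊚ g ≈ id → (f′ ⊚ g′) ⊚ (g ⊚ f) ≈ id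
    cancel {A} {f = f} {f′} {g} {g′} p q = begin
      (f′ ⊚ g′) ⊚ (g ⊚ f) ≈⟨ assoc ⟩
      f′ ⊚ (g′ ⊚ (g ⊚ f)) ≈⟨ ⊚-resp-≈ Equiv.refl assoc ⟨
      f′ ⊚ ((g′ ⊚ g) ⊚ f) ≈⟨ ⊚-resp-≈ Equiv.refl (⊚-resp-≈ q Equiv.refl) ⟩
      f′ ⊚ (id ⊚ f)       ≈⟨ ⊚-resp-≈ Equiv.refl identityˡ ⟩
      f′ ⊚ f              ≈⟨ p ⟩
      id                  ∎
      where open SetoidReasoning (Hom A A)

  conjugate : ∀ {A A′ B B′} → Isomorphism C A A′ → Isomorphism C B B′ →
              A ⇒ B → A′ ⇒ B′
  conjugate i j f = Isomorphism.to j ⊚ (f ⊚ Isomorphism.from i)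

  module _ {A A′ B B′} (i : Isomorphism C A A′) (j : Isomorphism C B B′) where
    private
      module I = Isomorphism i
      module J = Isomorphism j

    conjugate-resp : ∀ {f g} → f ≈ g → conjugate i j f ≈ conjugate i j g
    conjugate-resp p = ⊚-resp-≈ Equiv.refl (⊚-resp-≈ p Equiv.refl)

    conjugate-commutes : ∀ f → conjugate i j f ⊚ I.to ≈ J.to ⊚ f
    conjugate-commutes f = begin
      (J.to ⊚ (f ⊚ I.from)) ⊚ I.to ≈⟨ assoc ⟩
      J.to ⊚ ((f ⊚ I.from) ⊚ I.to) ≈⟨ ⊚-resp-≈ Equiv.refl assoc ⟩
      J.to ⊚ (f ⊚ (I.from ⊚ I.to)) ≈⟨ ⊚-resp-≈ Equiv.refl (⊚-resp-≈ Equiv.refl I.isoˡ) ⟩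
      J.to ⊚ (f ⊚ id)              ≈⟨ ⊚-resp-≈ Equiv.refl identityʳ ⟩
      J.to ⊚ f                     ∎
      where open SetoidReasoning (Hom A B′)

    -- As `I.to` is invertible, the commuting square determines `g`. The functoriality of
    -- conjugation then reduces to pasting squares.
    conjugate-unique : ∀ {f g} → J.to ⊚ f ≈ g ⊚ I.to → conjugate i j f ≈ g
    conjugate-unique {f} {g} p = begin
      J.to ⊚ (f ⊚ I.from)   ≈⟨ assoc ⟨
      (J.to ⊚ f) ⊚ I.from   ≈⟨ ⊚-resp-≈ p Equiv.refl ⟩
      (g ⊚ I.to) ⊚ I.from   ≈⟨ assoc ⟩
      g ⊚ (I.to ⊚ I.from)   ≈⟨ ⊚-resp-≈ Equiv.refl I.isoʳ ⟩
      g ⊚ id                ≈⟨ identityʳ ⟩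
      g                     ∎
      where open SetoidReasoning (Hom A′ B′)

  conjugate-sym : ∀ {A A′ B B′} (i : Isomorphism C A A′) (j : Isomorphism C B B′) f →
                  conjugate i j (conjugate (≅-sym i) (≅-sym j) f) ≈ f
  conjugate-sym {B′ = B′} i j f = conjugate-unique i j (begin
    J.to ⊚ (J.from ⊚ (f ⊚ I.to)) ≈⟨ assoc ⟨
    (J.to ⊚ J.from) ⊚ (f ⊚ I.to) ≈⟨ ⊚-resp-≈ J.isoʳ Equiv.refl ⟩
    id ⊚ (f ⊚ I.to)              ≈⟨ identityˡ ⟩
    f ⊚ I.to                     ∎)
    where
    module I = Isomorphism i
    module J = Isomorphism j
    open SetoidReasoning (Hom _ B′)

  conjugate-id : ∀ {A A′} (i : Isomorphism C A A′) → conjugate i i id ≈ id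
  conjugate-id i = conjugate-unique i i (Equiv.trans identityʳ (Equiv.sym identityˡ))

  conjugate-⊚ : ∀ {A A′ B B′ D D′} (i : Isomorphism C A A′) (j : Isomorphism C B B′)
                (k : Isomorphism C D D′) (f : A ⇒ B) (g : B ⇒ D) →
                conjugate i k (g ⊚ f) ≈ conjugate j k g ⊚ conjugate i j f
  conjugate-⊚ {A} {D′ = D′} i j k f g = conjugate-unique i k (begin
    K.to ⊚ (g ⊚ f)                                ≈⟨ assoc ⟨
    (K.to ⊚ g) ⊚ f                                ≈⟨ ⊚-resp-≈ (conjugate-commutes j k g) Equiv.refl ⟨
    (conjugate j k g ⊚ J.to) ⊚ f                  ≈⟨ assoc ⟩
    conjugate j k g ⊚ (J.to ⊚ f)                  ≈⟨ ⊚-resp-≈ Equiv.refl (conjugate-commutes i j f) ⟨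
    conjugate j k g ⊚ (conjugate i j f ⊚ I.to)    ≈⟨ assoc ⟨
    (conjugate j k g ⊚ conjugate i j f) ⊚ I.to    ∎)
    where
    module I = Isomorphism i
    module J = Isomorphism j
    module K = Isomorphism k
    open SetoidReasoning (Hom A D′)

module _ {C : Category o ℓ e} {D : Category o′ ℓ′ e′} (F : Functor C D) where
  private
    module C = Category C
    module D = Category D
  open Functor F

  F-≅ : ∀ {A B} → Isomorphism C A B → Isomorphism D (F₀ A) (F₀ B)
  F-≅ i = record
    { to   = F₁ to
    ; from = F₁ from
    ; isoˡ = D.Equiv.trans (D.Equiv.sym homomorphism) (D.Equiv.trans (F-resp-≈ isoˡ) identity)
    ; isoʳ = D.Equiv.trans (D.Equiv.sym homomorphism) (D.Equiv.trans (F-resp-≈ isoʳ) identity)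
    }
    where open Isomorphism i

  F-conjugate : ∀ {A A′ B B′} (i : Isomorphism C A A′) (j : Isomorphism C B B′) f →
                F₁ (conjugate C i j f) D.≈ conjugate D (F-≅ i) (F-≅ j) (F₁ f)
  F-conjugate i j f = D.Equiv.trans homomorphism (D.⊚-resp-≈ D.Equiv.refl homomorphism)

  -- Preimages are chosen, as are the objects in `IsEssentiallySurjective`, so that an inverse
  -- functor can be computed from them.
  record IsFullyFaithful : Set (o ⊔ ℓ ⊔ e ⊔ ℓ′ ⊔ e′) where
    field
      preimage   : ∀ {A B} → F₀ A D.⇒ F₀ B → A C.⇒ B
      F-preimage : ∀ {A B} (g : F₀ A D.⇒ F₀ B) → F₁ (preimage g) D.≈ g
      faithful   : ∀ {A B} {f g : A C.⇒ B} → F₁ f D.≈ F₁ g → f C.≈ g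

  IsEssentiallySurjective : Set (o ⊔ o′ ⊔ ℓ′ ⊔ e′)
  IsEssentiallySurjective = ∀ B → Σ[ A ∈ C.Obj ] Isomorphism D (F₀ A) B

  -- Each law of the inverse is checked after applying `F`, where it becomes a law of conjugation by
  -- the counit isomorphisms; faithfulness brings it back.
  isEquivalence : IsFullyFaithful → IsEssentiallySurjective → IsEquivalenceOfCategories F
  isEquivalence ff eso = record
    { inverse = record
      { F₀           = λ B → proj₁ (eso B)
      ; F₁           = λ g → preimage (conj g)
      ; F-resp-≈     = λ {B} {B′} p → faithful (D.Equiv.trans (F-preimage _)
          (D.Equiv.trans (conjugate-resp D (ε⁻¹ B) (ε⁻¹ B′) p) (D.Equiv.sym (F-preimage _))))
      ; identity     = λ {B} → faithful (D.Equiv.trans (F-preimage _)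
          (D.Equiv.trans (conjugate-id D (ε⁻¹ B)) (D.Equiv.sym identity)))
      ; homomorphism = λ {X} {Y} {Z} → faithful (D.Equiv.trans (F-preimage _)
          (D.Equiv.trans (conjugate-⊚ D (ε⁻¹ X) (ε⁻¹ Y) (ε⁻¹ Z) _ _)
            (D.Equiv.trans (D.Equiv.sym (D.⊚-resp-≈ (F-preimage _) (F-preimage _)))
              (D.Equiv.sym homomorphism))))
      }
    ; unit    = record
      { component = λ A → reflect (ε⁻¹ (F₀ A))
      ; natural   = λ f → faithful (D.Equiv.trans homomorphism
          (D.Equiv.trans (D.⊚-resp-≈ (F-preimage _) D.Equiv.refl)
            (D.Equiv.sym (D.Equiv.trans homomorphism
              (D.Equiv.trans (D.⊚-resp-≈ (F-preimage _) (F-preimage _))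
                (conjugate-commutes D (ε⁻¹ _) (ε⁻¹ _) (F₁ f)))))))
      }
    ; counit  = record
      { component = ε
      ; natural   = λ {B} {B′} g → D.Equiv.sym (D.Equiv.trans
          (D.⊚-resp-≈ (D.Equiv.sym (conjugate-sym D (ε B) (ε B′) g)) D.Equiv.refl)
          (D.Equiv.trans (conjugate-commutes D (ε B) (ε B′) (conj g))
            (D.⊚-resp-≈ D.Equiv.refl (D.Equiv.sym (F-preimage _)))))
      }
    }
    where
    open IsFullyFaithful ff
    ε : ∀ B → Isomorphism D (F₀ (proj₁ (eso B))) B
    ε B = proj₂ (eso B)
    ε⁻¹ : ∀ B → Isomorphism D B (F₀ (proj₁ (eso B)))
    ε⁻¹ B = ≅-sym D (ε B)
    conj : ∀ {B B′} → B D.⇒ B′ → F₀ (proj₁ (eso B)) D.⇒ F₀ (proj₁ (eso B′))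
    conj = conjugate D (ε⁻¹ _) (ε⁻¹ _)
    reflect : ∀ {A B} → Isomorphism D (F₀ A) (F₀ B) → Isomorphism C A B
    reflect i = record
      { to   = preimage to
      ; from = preimage from
      ; isoˡ = faithful (D.Equiv.trans homomorphism
          (D.Equiv.trans (D.⊚-resp-≈ (F-preimage _) (F-preimage _))
            (D.Equiv.trans isoˡ (D.Equiv.sym identity))))
      ; isoʳ = faithful (D.Equiv.trans homomorphism
          (D.Equiv.trans (D.⊚-resp-≈ (F-preimage _) (F-preimage _))
            (D.Equiv.trans isoʳ (D.Equiv.sym identity))))
      }
      where open Isomorphism i

module _ {C : Category o ℓ e} {D : Category o′ ℓ′ e′} {E : Category o″ ℓ″ e″}
         {F : Functor C D} {G : Functor D E} {K : Functor C E}
         (N : NaturalIsomorphism (G ∘F F) K) where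
  private
    module C = Category C
    module D = Category D
    module E = Category E
    module F = Functor F
    module G = Functor G
    module K = Functor K
    open NaturalIsomorphism N

  cancel-essentiallySurjective : IsEssentiallySurjective K → IsEssentiallySurjective G
  cancel-essentiallySurjective eso B =
    F.F₀ (proj₁ (eso B)) , ≅-trans E (component _) (proj₂ (eso B))

  -- Every object of `D` is isomorphic to some `F.F₀ A`. Conjugation along these isomorphisms
  -- reduces the claim to objects in the image of `F`, where `G ∘F F`, being isomorphic to `K`, is
  -- fully faithful.
  cancel-fullyFaithful : IsFullyFaithful F → IsEssentiallySurjective F →
                         IsFullyFaithful K → IsFullyFaithful G
  cancel-fullyFaithful ffF eso ffK = record
    { preimage   = λ {A} {B} g →
        conjugate D (ε A) (ε B) (F.F₁ (preGF (conjugate E (Gε⁻¹ A) (Gε⁻¹ B) g)))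
    ; F-preimage = λ {A} {B} g → E.Equiv.trans (F-conjugate G (ε A) (ε B) _)
        (E.Equiv.trans (conjugate-resp E (Gε A) (Gε B) (GF-pre _)) (conjugate-sym E (Gε A) (Gε B) g))
    ; faithful   = λ {A} {B} {f} {g} p →
        D.Equiv.trans (D.Equiv.sym (conjugate-sym D (ε A) (ε B) f))
          (D.Equiv.trans (conjugate-resp D (ε A) (ε B) (core p)) (conjugate-sym D (ε A) (ε B) g))
    }
    where
    module FF = IsFullyFaithful ffF
    module KK = IsFullyFaithful ffK
    ε : ∀ B → Isomorphism D (F.F₀ (proj₁ (eso B))) B
    ε B = proj₂ (eso B)
    ε⁻¹ : ∀ B → Isomorphism D B (F.F₀ (proj₁ (eso B)))
    ε⁻¹ B = ≅-sym D (ε B)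
    Gε : ∀ B → Isomorphism E (G.F₀ (F.F₀ (proj₁ (eso B)))) (G.F₀ B)
    Gε B = F-≅ G (ε B)
    Gε⁻¹ : ∀ B → Isomorphism E (G.F₀ B) (G.F₀ (F.F₀ (proj₁ (eso B))))
    Gε⁻¹ B = F-≅ G (ε⁻¹ B)
    K≈GF : ∀ {A B} (f : A C.⇒ B) →
           conjugate E (component A) (component B) (G.F₁ (F.F₁ f)) E.≈ K.F₁ f
    K≈GF f = conjugate-unique E (component _) (component _) (natural f)
    preGF : ∀ {A B} → G.F₀ (F.F₀ A) E.⇒ G.F₀ (F.F₀ B) → A C.⇒ B
    preGF g = KK.preimage (conjugate E (component _) (component _) g)
    conj-injective : ∀ {A A′ B B′} (i : Isomorphism E A A′) (j : Isomorphism E B B′) {f g} →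
                     conjugate E i j f E.≈ conjugate E i j g → f E.≈ g
    conj-injective i j {f} {g} p =
      E.Equiv.trans (E.Equiv.sym (conjugate-sym E (≅-sym E i) (≅-sym E j) f))
        (E.Equiv.trans (conjugate-resp E (≅-sym E i) (≅-sym E j) p)
          (conjugate-sym E (≅-sym E i) (≅-sym E j) g))
    GF-pre : ∀ {A B} (g : G.F₀ (F.F₀ A) E.⇒ G.F₀ (F.F₀ B)) → G.F₁ (F.F₁ (preGF g)) E.≈ g
    GF-pre g = conj-injective (component _) (component _)
      (E.Equiv.trans (K≈GF _) (KK.F-preimage _))
    -- The conjugates of `f` and `g` run between images of `F`, so fullness of `F` makes them images
    -- of morphisms of `C`; faithfulness of `K` identifies these.
    core : ∀ {A B} {f g : A D.⇒ B} → G.F₁ f E.≈ G.F₁ g →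
           conjugate D (ε⁻¹ A) (ε⁻¹ B) f D.≈ conjugate D (ε⁻¹ A) (ε⁻¹ B) g
    core {A} {B} {f} {g} p =
      D.Equiv.trans (D.Equiv.sym (FF.F-preimage _))
        (D.Equiv.trans (F.F-resp-≈ (KK.faithful
          (E.Equiv.trans (E.Equiv.sym (K≈GF _))
            (E.Equiv.trans (conjugate-resp E (component _) (component _)
              (E.Equiv.trans (G.F-resp-≈ (FF.F-preimage _))
                (E.Equiv.trans (F-conjugate G (ε⁻¹ A) (ε⁻¹ B) f)
                  (E.Equiv.trans (conjugate-resp E (Gε⁻¹ A) (Gε⁻¹ B) p)
                    (E.Equiv.trans (E.Equiv.sym (F-conjugate G (ε⁻¹ A) (ε⁻¹ B) g))
                      (G.F-resp-≈ (D.Equiv.sym (FF.F-preimage _))))))))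
              (K≈GF _)))))
          (FF.F-preimage _))

≅-full : {C : Category o ℓ e} {P : Category.Obj C → Set ℓp} {A B : Category.Obj (FullSubcategory C P)} →
         Isomorphism C (proj₁ A) (proj₁ B) → Isomorphism (FullSubcategory C P) A B
≅-full i = record { to = to ; from = from ; isoˡ = isoˡ ; isoʳ = isoʳ }
  where open Isomorphism i

module _ {C : Category o ℓ e} {D : Category o′ ℓ′ e′} {F : Functor C D}
         {P : Category.Obj C → Set ℓp} {Q : Category.Obj D → Set ℓq}
         (pres : ∀ A → P A → Q (Functor.F₀ F A)) where

  restrict-fullyFaithful : IsFullyFaithful F → IsFullyFaithful (restrict F {P} {Q} pres)
  restrict-fullyFaithful ff = record
    { preimage = preimage ; F-preimage = F-preimage ; faithful = faithful }
    where open IsFullyFaithful ff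

  restrict-essentiallySurjective :
    (eso : IsEssentiallySurjective F) → (∀ B → Q B → P (proj₁ (eso B))) →
    IsEssentiallySurjective (restrict F {P} {Q} pres)
  restrict-essentiallySurjective eso reflects (B , q) =
    (proj₁ (eso B) , reflects B q) , ≅-full (proj₂ (eso B))

≅-op : {C : Category o ℓ e} {A B : Category.Obj C} → Isomorphism (op C) A B → Isomorphism C A B
≅-op i = record { to = from ; from = to ; isoˡ = isoˡ ; isoʳ = isoʳ }
  where open Isomorphism i

op-≅ : {C : Category o ℓ e} {A B : Category.Obj C} → Isomorphism C A B → Isomorphism (op C) A B
op-≅ i = record { to = from ; from = to ; isoˡ = isoˡ ; isoʳ = isoʳ }
  where open Isomorphism i

≅-underlying : {C : Category o ℓ e} {P : Category.Obj C → Set ℓp}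
               {A B : Category.Obj (FullSubcategory C P)} →
               Isomorphism (FullSubcategory C P) A B → Isomorphism C (proj₁ A) (proj₁ B)
≅-underlying i = record { to = to ; from = from ; isoˡ = isoˡ ; isoʳ = isoʳ }
  where open Isomorphism i

module _ {C : Category o ℓ e} {D : Category o′ ℓ′ e′} {E : Category o″ ℓ″ e″}
         {F : Functor C D} {G : Functor D E} {K : Functor C E}
         {P : Category.Obj C → Set ℓp} {Q : Category.Obj D → Set ℓq} {R : Category.Obj E → Set ℓr}
         (presF : ∀ A → P A → Q (Functor.F₀ F A)) (presG : ∀ A → Q A → R (Functor.F₀ G A))
         (presK : ∀ A → P A → R (Functor.F₀ K A)) where

  restrict-natural : NaturalIsomorphism (G ∘F F) K →
    NaturalIsomorphism (restrict G {Q} {R} presG ∘F restrict F {P} {Q} presF) (restrict K {P} {R} presK)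
  restrict-natural N = record
    { component = λ (A , _) → ≅-full (component A) ; natural = natural }
    where open NaturalIsomorphism N

-- Hyperaffine theories and matched pairs

module HyperaffineTheory (H : Theory) (hyperaffine : Theory.IsHyperaffineTheory H) where
  open Theory H

  -- With a single variable, the affine law itself says that `m` is the identity.
  unary-trivial : (m : Op (Fin 1)) → m ≈ π zero
  unary-trivial m = trans (sym (trans ([]-congʳ m (λ { zero → refl })) ([]-π m)))
                      (proj₁ (hyperaffine m))

  -- This gives `H` access to `Down.commute`, the commutation of hyperaffine operations.
  isHyperaffineUnary : IsHyperaffineUnary
  isHyperaffineUnary t = d , λ d′ → let open Decomposition in
      sym (trans (equation d′) (trans
        ([]-congʳ (h d′) (λ i → trans ([]-congˡ (unary-trivial (m d′))) (π-[] zero _)))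
        ([]-π (h d′))))
    , unary-trivial (m d′)
    where
    d : Decomposition t
    d = record
      { h = t ; hyperaffine = hyperaffine t ; m = π zero
      ; equation = sym (trans ([]-congʳ t (λ i → π-[] zero _)) ([]-π t)) }

  module InModel {X : Setoid 0ℓ 0ℓ} (a : Model H X) where
    open Model a
    private module X = Setoid X
    open X using (Carrier) renaming (_≈_ to _≈ₓ_)

    ⟦⟧-rename : ∀ {I J} (h : Op I) (v : I → J) (ρ : J → Carrier) →
                ⟦ h [ (λ i → π (v i)) ] ⟧ ρ ≈ₓ ⟦ h ⟧ (λ i → ρ (v i))
    ⟦⟧-rename h v ρ = X.trans (⟦[]⟧ h _ ρ) (⟦⟧-cong refl (λ i → ⟦π⟧ (v i) ρ))

    ⟦⟧-nested : ∀ {I J K} (h : Op I) (k : I → Op J) (v : I → J → K) (ρ : K → Carrier) →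
      ⟦ h [ (λ i → k i [ (λ j → π (v i j)) ]) ] ⟧ ρ ≈ₓ ⟦ h ⟧ (λ i → ⟦ k i ⟧ (λ j → ρ (v i j)))
    ⟦⟧-nested h k v ρ = X.trans (⟦[]⟧ h _ ρ) (⟦⟧-cong refl (λ i → ⟦⟧-rename (k i) (v i) ρ))

    ⟦⟧-const : ∀ {I} (h : Op I) x → ⟦ h ⟧ (λ _ → x) ≈ₓ x
    ⟦⟧-const h x = X.trans (X.sym (⟦⟧-rename h (λ _ → zero) (λ _ → x)))
      (X.trans (⟦⟧-cong (proj₁ (hyperaffine h)) (λ _ → X.refl)) (⟦π⟧ zero _))

    ⟦⟧-diagonal : ∀ {I} (h : Op I) (x : I → I → Carrier) →
                  ⟦ h ⟧ (λ i → ⟦ h ⟧ (x i)) ≈ₓ ⟦ h ⟧ (λ i → x i i)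
    ⟦⟧-diagonal h x = X.trans (X.sym (⟦⟧-nested h (λ _ → h) _,_ (uncurry x)))
      (X.trans (⟦⟧-cong (proj₂ (hyperaffine h)) (λ _ → X.refl)) (⟦⟧-rename h _ (uncurry x)))

    ⟦⟧-commute : ∀ {I J} (h : Op I) (k : Op J) (x : I → J → Carrier) →
      ⟦ h ⟧ (λ i → ⟦ k ⟧ (x i)) ≈ₓ ⟦ k ⟧ (λ j → ⟦ h ⟧ (λ i → x i j))
    ⟦⟧-commute h k x = X.trans (X.sym (⟦⟧-nested h (λ _ → k) _,_ (uncurry x)))
      (X.trans (⟦⟧-cong (Down.commute H isHyperaffineUnary (hyperaffine h) (hyperaffine k) _)
        (λ _ → X.refl)) (⟦⟧-nested k (λ _ → h) (λ j i → i , j) (uncurry x)))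

    -- Commuting the inner `h` past `k i` places it directly under the outer `h`, where the diagonal
    -- law merges the two: the inner copy reads the index chosen by the outer one.
    ⟦⟧-absorb : ∀ {I J} (h : Op I) (k : I → Op J) (x : I → J → I → Carrier) →
      ⟦ h ⟧ (λ i → ⟦ k i ⟧ (λ j → ⟦ h ⟧ (x i j))) ≈ₓ ⟦ h ⟧ (λ i → ⟦ k i ⟧ (λ j → x i j i))
    ⟦⟧-absorb h k x = X.trans (⟦⟧-cong refl (λ i → ⟦⟧-commute (k i) h (x i)))
      (⟦⟧-diagonal h _)

freeModel : (𝕋 : Theory) (I : Set) → Model 𝕋 (Theory.ops 𝕋 I)
freeModel 𝕋 I = record
  { ⟦_⟧ = _[_] ; ⟦⟧-cong = []-cong ; ⟦π⟧ = π-[] ; ⟦[]⟧ = []-assoc }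
  where open Theory 𝕋

Mod-product : (𝕋 : Theory) {X Y : Setoid 0ℓ 0ℓ} → Model 𝕋 X → Model 𝕋 Y →
              Model 𝕋 (×-setoid X Y)
Mod-product 𝕋 a b = record
  { ⟦_⟧     = λ t z → A.⟦ t ⟧ (λ i → proj₁ (z i)) , B.⟦ t ⟧ (λ i → proj₂ (z i))
  ; ⟦⟧-cong = λ p q → A.⟦⟧-cong p (λ i → proj₁ (q i)) , B.⟦⟧-cong p (λ i → proj₂ (q i))
  ; ⟦π⟧     = λ i z → A.⟦π⟧ i _ , B.⟦π⟧ i _
  ; ⟦[]⟧    = λ t u z → A.⟦[]⟧ t u _ , B.⟦[]⟧ t u _
  }
  where
  module A = Model a
  module B = Model b

module Pair (P : MatchedPair) where
  open MatchedPair P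
  open HyperaffineTheory H H-hyperaffine public

  -- This is the `H`-part of the free model on one generator. It makes the lemmas of `InModel`
  -- available for equations in the monoid.
  monoidModel : Model H (Monoid.setoid M)
  monoidModel = record
    { ⟦_⟧ = _▷_ ; ⟦⟧-cong = ▷-cong ; ⟦π⟧ = π-▷ ; ⟦[]⟧ = []-▷ }

-- Exponentials of models of a matched pair

module _ (P : MatchedPair) where
  open MatchedPair P
  open Pair P
  private
    module H = Theory H
    module M = Monoid M

  terminalModel : PairModel P (record { Carrier = ⊤ ; _≈_ = λ _ _ → ⊤ })
  terminalModel = record {}

  module _ {X Y : Setoid 0ℓ 0ℓ} (a : PairModel P X) (b : PairModel P Y) where
    private
      module X = Setoid X
      module Y = Setoid Y
      module A = PairModel a
      module B = PairModel b

    productModel : PairModel P (×-setoid X Y)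
    productModel = record
      { model  = Mod-product H A.model B.model
      ; _•_    = λ m (x , y) → (m A.• x) , (m B.• y)
      ; •-cong = λ p (q , r) → A.•-cong p q , B.•-cong p r
      ; ε-•    = λ (x , y) → A.ε-• x , B.ε-• y
      ; ∙-•    = λ m n (x , y) → A.∙-• m n x , B.∙-• m n y
      ; ▷-•    = λ h m (x , y) → A.▷-• h m x , B.▷-• h m y
      ; •-⟦⟧   = λ n h z → A.•-⟦⟧ n h _ , B.•-⟦⟧ n h _
      }

    -- An element of Y^X is a homomorphism M × X → Y.  Preservation of H is
    -- required only for the generic family of arguments, indexed by M × X itself,
    -- which keeps the exponential in Set.
    record Exponential : Set where
      field
        fun       : ∣M∣ → X.Carrier → Y.Carrier
        fun-cong  : ∀ {m m′ x x′} → m ≈ₘ m′ → x X.≈ x′ → fun m x Y.≈ fun m′ x′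
        generic-⟦⟧ : (h : Op (∣M∣ × X.Carrier)) →
          fun (h ▷ proj₁) (A.⟦ h ⟧ proj₂) Y.≈ B.⟦ h ⟧ (λ (m , x) → fun m x)
        fun-•     : ∀ n m x → fun (n ∙ m) (n A.• x) Y.≈ n B.• fun m x

      -- A family of pairs is a map `v` into M × X; renaming the variables of `h` along `v` reduces
      -- it to the generic family.
      fun-⟦⟧ : ∀ {I} (h : Op I) (m : I → ∣M∣) (x : I → X.Carrier) →
               fun (h ▷ m) (A.⟦ h ⟧ x) Y.≈ B.⟦ h ⟧ (λ i → fun (m i) (x i))
      fun-⟦⟧ h m x = Y.trans
        (fun-cong (M.sym (InModel.⟦⟧-rename monoidModel h v proj₁))
                  (X.sym (InModel.⟦⟧-rename A.model h v proj₂)))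
        (Y.trans (generic-⟦⟧ (h [ (λ i → π (v i)) ]))
          (InModel.⟦⟧-rename B.model h v _))
        where
        v = λ i → m i , x i

    open Exponential

    exponentialSetoid : Setoid 0ℓ 0ℓ
    exponentialSetoid = record
      { Carrier       = Exponential
      ; _≈_           = λ e e′ → ∀ m x → fun e m x Y.≈ fun e′ m x
      ; isEquivalence = record
        { refl  = λ _ _ → Y.refl
        ; sym   = λ p m x → Y.sym (p m x)
        ; trans = λ p q m x → Y.trans (p m x) (q m x)
        }
      }

    exponentialModel : PairModel P exponentialSetoid
    exponentialModel = record
      { model  = record
        { ⟦_⟧     = ⟦_⟧ₑ
        ; ⟦⟧-cong = λ p q m x → B.⟦⟧-cong (^*-cong M.refl p) (λ i → q i m x)
        ; ⟦π⟧     = λ i e m x → Y.trans (B.⟦⟧-cong (^*-π m i) (λ _ → Y.refl)) (B.⟦π⟧ i _)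
        ; ⟦[]⟧    = λ t u e m x → Y.trans (B.⟦⟧-cong (^*-[] m t u) (λ _ → Y.refl)) (B.⟦[]⟧ _ _ _)
        }
      ; _•_    = _•ₑ_
      ; •-cong = λ {_} {_} {e} p q m x → Y.trans (fun-cong e (M.∙-cong M.refl p) X.refl) (q _ x)
      ; ε-•    = λ e m x → fun-cong e (M.identityʳ m) X.refl
      ; ∙-•    = λ m n e k x → fun-cong e (M.sym (M.assoc k m n)) X.refl
      -- The affine law expands `x` to `n ^* h` applied to a constant family. Both arguments are
      -- then values of the same operation, which `e` preserves.
      ; ▷-•    = λ h m e n x → Y.trans
          (fun-cong e (▷-∙ˡ n h m) (X.sym (InModel.⟦⟧-const A.model (n ^* h) x)))
          (fun-⟦⟧ e (n ^* h) _ _)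
      ; •-⟦⟧   = λ n h e m x → B.⟦⟧-cong (H.sym (^*-∙ m n h)) (λ _ → Y.refl)
      }
      where
      -- The twist by `m ^* h` is forced: the value at (m , x) must be the value at (ε , x) of the
      -- translate by `m`, the law `•-⟦⟧` moves `m` past `h`, and at ε the operation is pointwise
      -- because evaluation there is to be a homomorphism.
      ⟦_⟧ₑ : ∀ {I} → Op I → (I → Exponential) → Exponential
      ⟦ h ⟧ₑ e = record
        { fun       = λ m x → B.⟦ m ^* h ⟧ (λ i → fun (e i) m x)
        ; fun-cong  = λ p q → B.⟦⟧-cong (^*-cong p H.refl) (λ i → fun-cong (e i) p q)
        ; generic-⟦⟧ = λ k → begin
            B.⟦ (k ▷ proj₁) ^* h ⟧ (λ i → fun (e i) (k ▷ proj₁) (A.⟦ k ⟧ proj₂))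
              ≈⟨ B.⟦⟧-cong (▷-^* k proj₁ h) (λ i → generic-⟦⟧ (e i) k) ⟩
            B.⟦ k [ (λ (m , _) → m ^* h) ] ⟧ (λ i → B.⟦ k ⟧ (λ (m , x) → fun (e i) m x))
              ≈⟨ B.⟦[]⟧ k _ _ ⟩
            B.⟦ k ⟧ (λ (m , _) → B.⟦ m ^* h ⟧ (λ i → B.⟦ k ⟧ (λ (m′ , x) → fun (e i) m′ x)))
              -- The law `▷-^*` has put a copy of `k` outside `m ^* h`, and preservation by each
              -- `e i` a copy inside. Merging them makes both read the same pair (m , x).
              ≈⟨ InModel.⟦⟧-absorb B.model k (λ (m , _) → m ^* h) (λ _ i (m , x) → fun (e i) m x) ⟩
            B.⟦ k ⟧ (λ (m , x) → B.⟦ m ^* h ⟧ (λ i → fun (e i) m x)) ∎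
        ; fun-•     = λ n m x → begin
            B.⟦ (n ∙ m) ^* h ⟧ (λ i → fun (e i) (n ∙ m) (n A.• x))
              ≈⟨ B.⟦⟧-cong (H.sym (^*-∙ n m h)) (λ i → fun-• (e i) n m x) ⟩
            B.⟦ n ^* (m ^* h) ⟧ (λ i → n B.• fun (e i) m x)
              ≈⟨ B.•-⟦⟧ n _ _ ⟨
            n B.• B.⟦ m ^* h ⟧ (λ i → fun (e i) m x) ∎
        }
        where open SetoidReasoning Y
      _•ₑ_ : ∣M∣ → Exponential → Exponential
      n •ₑ e = record
        { fun       = λ m x → fun e (m ∙ n) x
        ; fun-cong  = λ p → fun-cong e (M.∙-cong p M.refl)
        ; generic-⟦⟧ = λ h → Y.trans (fun-cong e (▷-∙ʳ h proj₁ n) X.refl) (fun-⟦⟧ e h _ _)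
        ; fun-•     = λ k m x → Y.trans (fun-cong e (M.assoc k m n) X.refl) (fun-• e k _ x)
        }

  PairMod-cartesianClosed : CartesianClosed (ConcreteCategory.category (P -PairMod))
  PairMod-cartesianClosed = record
    { ⊤            = _ , terminalModel
    ; !            = record { to = λ _ → tt ; cong = λ _ → tt } , (λ _ _ → tt) , (λ _ _ → tt)
    ; !-unique     = λ _ _ → tt
    ; _⊗_          = λ (_ , a) (_ , b) → _ , productModel a b
    ; π₁           = λ {(X , _)} → record { to = proj₁ ; cong = proj₁ }
        , (λ _ _ → Setoid.refl X) , (λ _ _ → Setoid.refl X)
    ; π₂           = λ {_} {(Y , _)} → record { to = proj₂ ; cong = proj₂ }
        , (λ _ _ → Setoid.refl Y) , (λ _ _ → Setoid.refl Y)
    ; ⟨_,_⟩        = λ (f , p , q) (g , p′ , q′) →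
        record { to = λ x → (f ⟨$⟩ x) , (g ⟨$⟩ x) ; cong = λ r → Func.cong f r , Func.cong g r }
        , (λ h x → p h x , p′ h x) , (λ m x → q m x , q′ m x)
    ; project₁     = λ {(X , _)} _ → Setoid.refl X
    ; project₂     = λ {_} {(Y , _)} _ → Setoid.refl Y
    ; ⟨⟩-unique    = λ p q x → p x , q x
    ; _^_          = λ (_ , b) (_ , a) → _ , exponentialModel a b
    ; eval         = λ {(X , a)} {(Y , b)} →
        let module A = PairModel a
            module B = PairModel b
            module Y = Setoid Y
        in record
          { to   = λ (e , x) → fun e ε x
          ; cong = λ {_} {(e′ , _)} (p , q) → Y.trans (p ε _) (fun-cong e′ M.refl q) }
        -- The element ε is `h ▷ (λ _ → ε)`, so each component of `z` preserves `h` at ε; the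
        -- diagonal law then removes the second copy of `h`.
        , (λ h z → Y.trans
            (B.⟦⟧-cong (^*-ε h) (λ i → Y.trans
              (fun-cong (proj₁ (z i)) (M.sym (InModel.⟦⟧-const monoidModel h ε)) (Setoid.refl X))
              (fun-⟦⟧ (proj₁ (z i)) h _ _)))
            (InModel.⟦⟧-diagonal B.model h _))
        , (λ m (e , x) → Y.trans
            (fun-cong e (M.trans (M.identityˡ m) (M.sym (M.identityʳ m))) (Setoid.refl X))
            (fun-• e m ε x))
    ; curry        = λ {(X , a)} {(Y , b)} {(Z , c)} (f , p , q) →
        let module A = PairModel a
            module C = PairModel c
            module X = Setoid X
            module Y = Setoid Y
            module Z = Setoid Z
        in record
          { to   = λ z → record
            -- The point `z` is regarded as the homomorphism m ↦ m • z from the free model on one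
            -- generator; setting m = ε gives `z` back.
            { fun       = λ m x → f ⟨$⟩ (m C.• z , x)
            ; fun-cong  = λ r s → Func.cong f (C.•-cong r Z.refl , s)
            ; generic-⟦⟧ = λ h → Y.trans (Func.cong f (C.▷-• h _ z , X.refl)) (p h _)
            ; fun-•     = λ n m x → Y.trans (Func.cong f (C.∙-• n m z , X.refl)) (q n _)
            }
          ; cong = λ r m x → Func.cong f (C.•-cong M.refl r , X.refl) }
        , (λ h z m x → Y.trans
            (Func.cong f (C.•-⟦⟧ m h z , X.sym (InModel.⟦⟧-const A.model (m ^* h) x)))
            (p (m ^* h) _))
        , (λ n z m x → Func.cong f (Z.sym (C.∙-• m n z) , X.refl))
    ; β            = λ {(X , _)} {_} {(_ , c)} {(f , _)} (z , x) →
        Func.cong f (PairModel.ε-• c z , Setoid.refl X)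
    -- The value of `k` at `z` in (m , x) is that of its translate m • k(z) = k(m • z) in (ε , x),
    -- so evaluation at ε determines `k`.
    ; curry-unique = λ {(X , _)} {(Y , _)} {_} {(f , _)} {(k , _ , q)} r z m x →
        let module Y = Setoid Y in
        Y.trans (fun-cong (k ⟨$⟩ z) (M.sym (M.identityˡ m)) (Setoid.refl X))
          (Y.trans (Y.sym (q m z ε x)) (r (_ , x)))
    }
    where open Exponential

-- Transport along isomorphisms of concrete categories

module ConcreteIsomorphism {C D : ConcreteCategory} (iso : Isomorphism Conc C D) where
  private
    module C = ConcreteCategory C
    module D = ConcreteCategory D
    module Cat = Category C.category
    module DCat = Category D.category
    module To = ConcreteFunctor (Isomorphism.to iso)
    module From = ConcreteFunctor (Isomorphism.from iso)
    open Isomorphism iso using (isoˡ; isoʳ)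

  -- A round trip returns a structure only up to `≈ₛₜᵣ`. Composing with the identity function, a
  -- homomorphism between the two structures, bridges the gap.
  hom-from : ∀ {X Y} {a : C.Str X} {b : D.Str Y} {f : Func X Y} →
             C.IsHom a (From.str b) f → D.IsHom (To.str a) b f
  hom-from {Y = Y} {b = b} p =
    D.IsHom-resp (λ _ → Setoid.refl Y) (D.∘-hom (proj₁ (isoʳ b)) (To.hom p))

  hom-to : ∀ {X Y} {a : C.Str X} {b : D.Str Y} {f : Func X Y} →
           D.IsHom (To.str a) b f → C.IsHom a (From.str b) f
  hom-to {Y = Y} {a = a} p =
    C.IsHom-resp (λ _ → Setoid.refl Y) (C.∘-hom (From.hom p) (proj₂ (isoˡ a)))

  hom-from′ : ∀ {X Y} {a : D.Str X} {b : C.Str Y} {f : Func X Y} →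
              C.IsHom (From.str a) b f → D.IsHom a (To.str b) f
  hom-from′ {Y = Y} {a = a} p =
    D.IsHom-resp (λ _ → Setoid.refl Y) (D.∘-hom (To.hom p) (proj₂ (isoʳ a)))

  freeObject : ∀ {I} → FreeObject C I → FreeObject D I
  freeObject F = record
    { free   = free
    ; str    = To.str str
    ; η      = η
    ; extend = λ b x →
        let (f , p , q , u) = extend (From.str b) x
        in f , hom-from p , q , λ g r → u g (hom-to r)
    }
    where open FreeObject F

  variety : IsVariety C → IsVariety D
  variety V = record
    { theory       = theory
    ; free         = free
    ; presentation = ≅-trans Conc (≅-sym Conc iso) presentation
    }
    where open IsVariety V

  finitaryVariety : IsFinitaryVariety C → IsFinitaryVariety D
  finitaryVariety (𝓔 , fin , i) = 𝓔 , fin , ≅-trans Conc (≅-sym Conc iso) i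

  nonDegenerateVariety : IsNonDegenerateVariety C → IsNonDegenerateVariety D
  nonDegenerateVariety (X , a , x) = X , To.str a , x

  cartesianClosed : CartesianClosed C.category → CartesianClosed D.category
  cartesianClosed cc = record
    { ⊤            = to CC.⊤
    ; !            = out CC.!
    ; !-unique     = λ f → CC.!-unique (inn f)
    ; _⊗_          = λ A B → to (from A CC.⊗ from B)
    ; π₁           = proj₁ CC.π₁ , hom-from (proj₂ CC.π₁)
    ; π₂           = proj₁ CC.π₂ , hom-from (proj₂ CC.π₂)
    ; ⟨_,_⟩        = λ f g → out CC.⟨ from₁ f , from₁ g ⟩
    ; project₁     = λ {_} {_} {_} {f} {g} → CC.project₁ {f = from₁ f} {from₁ g}
    ; project₂     = λ {_} {_} {_} {f} {g} → CC.project₂ {f = from₁ f} {from₁ g}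
    ; ⟨⟩-unique    = λ {_} {_} {_} {f} {g} {k} →
        CC.⟨⟩-unique {f = from₁ f} {from₁ g} {inn k}
    ; _^_          = λ B A → to (from B CC.^ from A)
    ; eval         = λ {A} {B} → proj₁ (eval′ {A} {B}) , hom-from (proj₂ (eval′ {A} {B}))
    ; curry        = λ f → out (CC.curry (inn′ f))
    ; β            = λ {A} {B} {X} {f} x →
        Setoid.trans (proj₁ B)
          (Func.cong (proj₁ (CC.eval {from A} {from B}))
            (pairing (out (CC.curry (inn′ f))) (CC.curry (inn′ f))
              (λ _ → Setoid.refl (proj₁ (from B CC.^ from A))) x))
          (CC.β {f = inn′ f} x)
    ; curry-unique = λ {A} {B} {X} {f} {k} p →
        CC.curry-unique {f = inn′ f} {inn k} (λ x → Setoid.trans (proj₁ B)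
          (Setoid.sym (proj₁ B) (Func.cong (proj₁ (CC.eval {from A} {from B}))
            (pairing k (inn k) (λ _ → Setoid.refl (proj₁ (from B CC.^ from A))) x)))
          (p x))
    }
    where
    module CC = CartesianClosed cc
    to : Cat.Obj → DCat.Obj
    to (X , a) = X , To.str a
    from : DCat.Obj → Cat.Obj
    from (X , a) = X , From.str a
    out : ∀ {A : DCat.Obj} {B : Cat.Obj} → from A Cat.⇒ B →
          A DCat.⇒ to B
    out (f , p) = f , hom-from′ p
    inn : ∀ {A : DCat.Obj} {B : Cat.Obj} →
          A DCat.⇒ to B → from A Cat.⇒ B
    inn {B = (Y , b)} (f , p) = f , C.IsHom-resp (λ _ → Setoid.refl Y)
      (C.∘-hom (proj₁ (isoˡ b)) (From.hom p))
    inn′ : ∀ {A : Cat.Obj} {B : DCat.Obj} →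
           to A DCat.⇒ B → A Cat.⇒ from B
    inn′ (f , p) = f , hom-to p
    from₁ : ∀ {A B} → A DCat.⇒ B → from A Cat.⇒ from B
    from₁ (f , p) = f , From.hom p
    unit⁻¹ : ∀ A → from (to A) Cat.⇒ A
    unit⁻¹ (X , a) = idₛ , proj₁ (isoˡ a)
    unit : ∀ A → A Cat.⇒ from (to A)
    unit (X , a) = idₛ , proj₂ (isoˡ a)
    -- Products in `D` are formed from the round trip of the exponential, so evaluation in `C` is
    -- precomposed with the comparison on that factor.
    eval′ : ∀ {A B : DCat.Obj} →
            (from (to (from B CC.^ from A)) CC.⊗ from A) Cat.⇒ from B
    eval′ = CC.eval Cat.⊚ CC.⟨ unit⁻¹ _ Cat.⊚ CC.π₁ , CC.π₂ ⟩
    -- Composing an exponential transpose k with eval′ means pairing twice,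
    -- and the two pairings collapse to one, up to the identity functions
    -- that compare an object with its image under the round trip.
    module _ {A X : DCat.Obj} {E : Cat.Obj} (k : X DCat.⇒ to E) where
      outer : (from (to E) CC.⊗ from A) Cat.⇒ (E CC.⊗ from A)
      outer = CC.⟨ unit⁻¹ E Cat.⊚ CC.π₁ , CC.π₂ ⟩
      left : from (to (from X CC.⊗ from A)) Cat.⇒ from (to E)
      left = from₁ {to (from X CC.⊗ from A)} (k DCat.⊚ (proj₁ CC.π₁ , hom-from (proj₂ CC.π₁)))
      right : from (to (from X CC.⊗ from A)) Cat.⇒ from A
      right = from₁ {B = A} (proj₁ CC.π₂ , hom-from (proj₂ CC.π₂))
      pairing : (k₀ : from X Cat.⇒ E) → proj₁ k₀ ≗ₛ proj₁ k → ∀ x →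
        Setoid._≈_ (proj₁ (E CC.⊗ from A))
          (proj₁ outer ⟨$⟩ (proj₁ CC.⟨ left , right ⟩ ⟨$⟩ x))
          (proj₁ CC.⟨ k₀ Cat.⊚ CC.π₁ , CC.π₂ ⟩ ⟨$⟩ x)
      pairing k₀ p = CC.⟨⟩-unique
        {f = k₀ Cat.⊚ CC.π₁} {CC.π₂}
        {k = (outer Cat.⊚ CC.⟨ left , right ⟩) Cat.⊚ unit _}
        (λ x → Setoid.trans (proj₁ E)
          (CC.project₁ {f = unit⁻¹ E Cat.⊚ CC.π₁} {CC.π₂} (proj₁ CC.⟨ left , right ⟩ ⟨$⟩ x))
          (Setoid.trans (proj₁ E) (CC.project₁ {f = left} {right} x)
            (Setoid.sym (proj₁ E) (p (proj₁ CC.π₁ ⟨$⟩ x)))))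
        (λ x → Setoid.trans (proj₁ A)
          (CC.project₂ {f = unit⁻¹ E Cat.⊚ CC.π₁} {CC.π₂} (proj₁ CC.⟨ left , right ⟩ ⟨$⟩ x))
          (CC.project₂ {f = left} {right} x))

  ccVariety : IsCCVariety C → IsCCVariety D
  ccVariety cc = record
    { isVariety       = variety isVariety
    ; nonDegenerate   = nonDegenerateVariety nonDegenerate
    ; cartesianClosed = cartesianClosed (IsCCVariety.cartesianClosed cc)
    }
    where open IsCCVariety cc using (isVariety; nonDegenerate)

-- Presentations of varieties

Mod-freeObject : (𝕋 : Theory) (I : Set) → FreeObject (𝕋 -Mod) I
Mod-freeObject 𝕋 I = record
  { free   = ops I
  ; str    = freeModel 𝕋 I
  ; η      = π
  ; extend = λ {Y} b x →
      let open Model b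
          module Y = Setoid Y
      in record { to = λ t → ⟦ t ⟧ x ; cong = λ p → ⟦⟧-cong p (λ _ → Y.refl) }
       , (λ t u → ⟦[]⟧ t u x)
       , (λ i → ⟦π⟧ i x)
       , (λ g p q t → Y.trans (Func.cong g (sym ([]-π t)))
           (Y.trans (p t π) (⟦⟧-cong refl q)))
  }
  where open Theory 𝕋

-- A concrete functor puts an 𝕊-structure on the set T(I) underlying the free model. Applying `s` to
-- the generators there yields the only possible image of `s`, and the same evaluation at generators
-- gives faithfulness.
Mod-fullyFaithful : IsFullyFaithful Mod
Mod-fullyFaithful = record
  { preimage   = λ {𝕊} {𝕋} G → let open Free 𝕊 𝕋 G in record
      { map      = map
      ; map-cong = λ {I} p → Model.⟦⟧-cong (model I) p (λ _ → Theory.refl 𝕋)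
      ; map-π    = λ {I} i → Model.⟦π⟧ (model I) i (Theory.π 𝕋)
      ; map-[]   = λ {I} {J} s u → Theory.trans 𝕋 (Model.⟦[]⟧ (model J) s u (Theory.π 𝕋))
          (Theory.sym 𝕋 (map-⟦⟧ (freeModel 𝕋 J) s (λ i → map (u i))))
      }
  ; F-preimage = λ {𝕊} {𝕋} G {X} a → let open Free 𝕊 𝕋 G in
      (λ s x → map-⟦⟧ a s x) , (λ s x → Setoid.sym X (map-⟦⟧ a s x))
  ; faithful   = λ {𝕊} {𝕋} {φ} {ψ} p {I} s →
      let module T = Theory 𝕋 in
      T.trans (T.sym (T.[]-π _)) (T.trans (proj₁ (p (freeModel 𝕋 I)) s T.π) (T.[]-π _))
  }
  where
  module Free (𝕊 𝕋 : Theory) (G : ConcreteFunctor (𝕋 -Mod) (𝕊 -Mod)) where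
    open ConcreteFunctor G
    private
      module S = Theory 𝕊
      module T = Theory 𝕋

    model : ∀ I → Model 𝕊 (T.ops I)
    model I = str (freeModel 𝕋 I)

    map : ∀ {I} → S.Op I → T.Op I
    map {I} s = Model.⟦_⟧ (model I) s T.π

    -- The family `x` is the image of the generators under a homomorphism out of T(I), and the
    -- functor keeps this same function a homomorphism of 𝕊-models.
    map-⟦⟧ : ∀ {I X} (a : Model 𝕋 X) (s : S.Op I) (x : I → Setoid.Carrier X) →
             Setoid._≈_ X (Model.⟦_⟧ a (map s) x) (Model.⟦_⟧ (str a) s x)
    map-⟦⟧ {I} {X} a s x = Setoid.trans X (hom {a = freeModel 𝕋 I} {a} {proj₁ ext} p s T.π)
        (Model.⟦⟧-cong (str a) S.refl η)
      where
      ext = FreeObject.extend (Mod-freeObject 𝕋 I) a x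
      p = proj₁ (proj₂ ext)
      η = proj₁ (proj₂ (proj₂ ext))

module _ {Ω : Signature} {X : Setoid 0ℓ 0ℓ} (A : Algebra Ω X) where
  open Setoid X
  open Algebra A

  evaluate-cong : ∀ {V} (t : Term Ω V) {ρ ρ′ : V → Carrier} →
                  (∀ v → ρ v ≈ ρ′ v) → evaluate t ρ ≈ evaluate t ρ′
  evaluate-cong (var v)     p = p v
  evaluate-cong (apply σ t) p = interp-cong σ (λ i → evaluate-cong (t i) p)

module _ {Ω : Signature} {X Y : Setoid 0ℓ 0ℓ} (A : Algebra Ω X) (B : Algebra Ω Y) where
  private
    module A = Algebra A
    module B = Algebra B
  open Setoid Y

  evaluate-hom : (f : Func X Y) →
    (∀ σ x → f ⟨$⟩ A.interp σ x ≈ B.interp σ (λ i → f ⟨$⟩ x i)) →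
    ∀ {V} (t : Term Ω V) ρ → f ⟨$⟩ A.evaluate t ρ ≈ B.evaluate t (λ v → f ⟨$⟩ ρ v)
  evaluate-hom f hom (var v)     ρ = refl
  evaluate-hom f hom (apply σ t) ρ =
    trans (hom σ _) (B.interp-cong σ (λ i → evaluate-hom f hom (t i) ρ))

-- With all sets as arities this presents any theory, and with the arities Fin n
-- a finitary theory by finitary operations.
module Presentation (𝕋 : Theory) (A : Set₁) (Ar : A → Set)
  (factor : ∀ {I} (t : Theory.Op 𝕋 I) →
    Σ[ a ∈ A ] Σ[ i ∈ (Ar a → I) ] Σ[ u ∈ Theory.Op 𝕋 (Ar a) ]
      Theory._≈_ 𝕋 t (Theory._[_] 𝕋 u (λ k → Theory.π 𝕋 (i k))))
  where
  open Theory 𝕋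

  signature : Signature
  signature = record { Symbol = Σ[ a ∈ A ] Op (Ar a) ; Arity = λ (a , _) → Ar a }

  algebra : ∀ {X} → Model 𝕋 X → Algebra signature X
  algebra a = record
    { interp      = λ (_ , u) → ⟦ u ⟧
    ; interp-cong = λ _ → ⟦⟧-cong refl }
    where open Model a

  evaluate : ∀ {V I} → Term signature V → (V → Op I) → Op I
  evaluate {I = I} = Algebra.evaluate (algebra (freeModel 𝕋 I))

  -- Every equation between terms that holds in the free model on its variables is an axiom. Each
  -- law of `fromEqModel` is then a single axiom once its two sides are written as terms.
  theory : EquationalTheory
  theory = record
    { signature = signature
    ; Equation  = Σ[ V ∈ Set ] Σ[ l ∈ Term signature V ] Σ[ r ∈ Term signature V ]
                    evaluate l π ≈ evaluate r π
    ; Variables = proj₁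
    ; lhs       = λ (_ , l , _) → l
    ; rhs       = λ (_ , _ , r , _) → r
    }

  evaluate-⟦⟧ : ∀ {X} (a : Model 𝕋 X) {V} (t : Term signature V) ρ →
                Setoid._≈_ X (Model.⟦_⟧ a (evaluate t π) ρ) (Algebra.evaluate (algebra a) t ρ)
  evaluate-⟦⟧ {X} a {V} t ρ = Setoid.trans X
    (evaluate-hom (algebra (freeModel 𝕋 V)) (algebra a) f (λ (_ , u) x → p u x) t π)
    (evaluate-cong (algebra a) t q)
    where
    ext = FreeObject.extend (Mod-freeObject 𝕋 V) a ρ
    f = proj₁ ext
    p = proj₁ (proj₂ ext)
    q = proj₁ (proj₂ (proj₂ ext))

  module _ {X : Setoid 0ℓ 0ℓ} (b : EqModel theory X) where
    open EqModel b using (interp; interp-cong; satisfies)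
    private module X = Setoid X

    factored : ∀ {I} → Op I → Term signature I
    factored t = let (a , i , u , _) = factor t in apply (a , u) (λ k → var (i k))

    evaluate-factored : ∀ {I} (t : Op I) → evaluate (factored t) π ≈ t
    evaluate-factored t = sym (proj₂ (proj₂ (proj₂ (factor t))))

    fromEqModel : Model 𝕋 X
    fromEqModel = record
      { ⟦_⟧     = λ t x → let (a , i , u , _) = factor t in interp (a , u) (λ k → x (i k))
      ; ⟦⟧-cong = λ {_} {t} {t′} {_} {x′} p q → X.trans
          (interp-cong _ (λ k → q _))
          (satisfies (_ , factored t , factored t′ ,
            trans (evaluate-factored t) (trans p (sym (evaluate-factored t′)))) x′)
      ; ⟦π⟧     = λ i x → satisfies (_ , factored (π i) , var i , evaluate-factored (π i)) x
      ; ⟦[]⟧    = λ t u x →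
          let (a , i , v , p) = factor t in
          satisfies (_ , factored (t [ u ]) , apply (a , v) (λ k → factored (u (i k))) ,
            trans (evaluate-factored (t [ u ])) (sym (trans
              ([]-congʳ v (λ k → evaluate-factored (u (i k))))
              (trans ([]-congʳ v (λ k → sym (π-[] (i k) u)))
                (trans (sym ([]-assoc v _ u)) ([]-congˡ (sym p))))))) x
      }

  presentation : Isomorphism Conc (𝕋 -Mod) (EqModels theory)
  presentation = record
    { to   = record
      { str = λ {X} a → record
        { algebra   = algebra a
        ; satisfies = λ (_ , l , r , p) ρ → Setoid.trans X
            (Setoid.sym X (evaluate-⟦⟧ a l ρ))
            (Setoid.trans X (Model.⟦⟧-cong a p (λ _ → Setoid.refl X)) (evaluate-⟦⟧ a r ρ))
        }
      ; hom = λ p (_ , u) → p u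
      }
    ; from = record
      { str = fromEqModel
      ; hom = λ p t x → p _ _
      }
    ; isoˡ = λ {X} a → (λ t x → Setoid.sym X (unfactor a t x)) , (λ t x → unfactor a t x)
    ; isoʳ = λ {X} b → (λ σ x → refactor b σ x) , (λ σ x → Setoid.sym X (refactor b σ x))
    }
    where
    unfactor : ∀ {X} (a : Model 𝕋 X) {I} (t : Op I) x →
      let (_ , i , u , _) = factor t in
      Setoid._≈_ X (Model.⟦_⟧ a t x) (Model.⟦_⟧ a u (λ k → x (i k)))
    unfactor {X} a t x =
      let (_ , i , u , p) = factor t
          open Model a
          module X = Setoid X
      in X.trans (⟦⟧-cong p (λ _ → X.refl))
           (X.trans (⟦[]⟧ u _ x) (⟦⟧-cong refl (λ k → ⟦π⟧ (i k) x)))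
    -- The chosen factorization of `u` may differ from `u` itself, but the two resulting terms agree
    -- in the free model, hence are equated by an axiom.
    refactor : ∀ {X} (b : EqModel theory X) σ x →
      Setoid._≈_ X (Model.⟦_⟧ (fromEqModel b) (proj₂ σ) x) (EqModel.interp b σ x)
    refactor b (a , u) x = EqModel.satisfies b
      (_ , factored b u , apply (a , u) var , trans (evaluate-factored b u) (sym ([]-π u))) x

Mod-variety : (𝕋 : Theory) → IsVariety (𝕋 -Mod)
Mod-variety 𝕋 = record
  { theory       = theory
  ; free         = λ I → ConcreteIsomorphism.freeObject presentation (Mod-freeObject 𝕋 I)
  ; presentation = presentation
  }
  where
  open Theory 𝕋
  factor : ∀ {I} (t : Op I) →
    Σ[ J ∈ Set ] Σ[ i ∈ (J → I) ] Σ[ u ∈ Op J ] t ≈ u [ (λ k → π (i k)) ]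
  factor {I} t = I , (λ i → i) , t , sym ([]-π t)
  open Presentation 𝕋 Set (λ I → I) factor

Mod-finitaryVariety : (𝕋 : Theory) → Theory.IsFinitary 𝕋 → IsFinitaryVariety (𝕋 -Mod)
Mod-finitaryVariety 𝕋 fin = theory , (λ (lift n , _) → n , ↔-id _) , presentation
  where
  open Theory 𝕋
  factor : ∀ {I} (t : Op I) → Σ[ n ∈ Lift (lsuc 0ℓ) ℕ ] Σ[ i ∈ (Fin (lower n) → I) ]
    Σ[ u ∈ Op (Fin (lower n)) ] t ≈ u [ (λ k → π (i k)) ]
  factor t = let (n , p) = fin t in lift n , p
  open Presentation 𝕋 (Lift (lsuc 0ℓ) ℕ) (λ n → Fin (lower n)) factor

-- Finitely many finite lists are concatenated, and each keeps its positions in the result. This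
-- provides a common finite support for the arguments of an operation of finite arity.
mergeFamilies : ∀ {I : Set} m (n : Fin m → ℕ) (i : ∀ k → Fin (n k) → I) →
  Σ[ N ∈ ℕ ] Σ[ j ∈ (Fin N → I) ]
    (∀ k → Σ[ r ∈ (Fin (n k) → Fin N) ] (∀ x → j (r x) ≡ i k x))
mergeFamilies ℕ.zero    n i = 0 , (λ ()) , (λ ())
mergeFamilies (ℕ.suc m) n i =
  let (N , j , r) = mergeFamilies m (λ k → n (suc k)) (λ k → i (suc k))
  in n zero + N , (λ x → [ i zero , j ]′ (splitAt (n zero) x)) ,
     λ { zero    → (_↑ˡ N) , (λ x → ≡.cong [ i zero , j ]′ (splitAt-↑ˡ (n zero) x N))
       ; (suc k) → (λ x → n zero ↑ʳ proj₁ (r k) x) ,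
           (λ x → ≡.trans (≡.cong [ i zero , j ]′ (splitAt-↑ʳ (n zero) N (proj₁ (r k) x)))
                    (proj₂ (r k) x)) }

-- The algebraic theory of the free objects of a concrete category

module TheoryOfFreeObjects {C : ConcreteCategory} (freeObject : ∀ I → FreeObject C I) where
  open ConcreteCategory C
  private module F I = FreeObject (freeObject I)

  module _ {I : Set} {Y : Setoid 0ℓ 0ℓ} (b : Str Y) (x : I → Setoid.Carrier Y) where
    ext : Func (F.free I) Y
    ext = proj₁ (F.extend I b x)

    ext-hom : IsHom (F.str I) b ext
    ext-hom = proj₁ (proj₂ (F.extend I b x))

    ext-η : ∀ i → Setoid._≈_ Y (ext ⟨$⟩ F.η I i) (x i)
    ext-η = proj₁ (proj₂ (proj₂ (F.extend I b x)))

    ext-unique : (g : Func (F.free I) Y) → IsHom (F.str I) b g →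
                 (∀ i → Setoid._≈_ Y (g ⟨$⟩ F.η I i) (x i)) → g ≗ₛ ext
    ext-unique = proj₂ (proj₂ (proj₂ (F.extend I b x)))

  ext-cong : ∀ {I Y} (b : Str Y) {x x′ : I → Setoid.Carrier Y} →
             (∀ i → Setoid._≈_ Y (x i) (x′ i)) → ext b x ≗ₛ ext b x′
  ext-cong {Y = Y} b {x} {x′} p =
    ext-unique b x′ (ext b x) (ext-hom b x) (λ i → Setoid.trans Y (ext-η b x i) (p i))

  ext-natural : ∀ {I Y Z} {b : Str Y} {c : Str Z} {f : Func Y Z} → IsHom b c f →
                (x : I → Setoid.Carrier Y) → f ∘ₛ ext b x ≗ₛ ext c (λ i → f ⟨$⟩ x i)
  ext-natural {b = b} {c} {f} p x =
    ext-unique c _ (f ∘ₛ ext b x) (∘-hom p (ext-hom b x)) (λ i → Func.cong f (ext-η b x i))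

  -- Substitution is Kleisli composition for the free objects, so its laws are instances of the
  -- uniqueness of homomorphic extensions.
  theory : Theory
  theory = record
    { ops      = F.free
    ; π        = λ {I} → F.η I
    ; _[_]     = λ {_} {J} t u → ext (F.str J) u ⟨$⟩ t
    ; []-cong  = λ {_} {J} p q → Setoid.trans (F.free J)
        (Func.cong (ext (F.str J) _) p) (ext-cong (F.str J) q _)
    ; []-π     = λ {I} t → Setoid.sym (F.free I)
        (ext-unique (F.str I) _ idₛ id-hom (λ _ → Setoid.refl (F.free I)) t)
    ; π-[]     = λ {_} {J} i u → ext-η (F.str J) u i
    ; []-assoc = λ {_} {J} {K} t u v → ext-natural (ext-hom (F.str K) v) u t
    }

  open Theory theory using (Op; π; _[_]; _≈_; refl; trans; sym; []-congʳ; []-assoc; π-[])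

  comparison : ConcreteFunctor C (theory -Mod)
  comparison = record
    { str = λ {X} b → record
      { ⟦_⟧     = λ t x → ext b x ⟨$⟩ t
      ; ⟦⟧-cong = λ p q → Setoid.trans X (Func.cong (ext b _) p) (ext-cong b q _)
      ; ⟦π⟧     = λ i x → ext-η b x i
      ; ⟦[]⟧    = λ t u x → ext-natural (ext-hom b x) u t
      }
    ; hom = λ p t x → ext-natural p x t
    }

  nonDegenerate : IsNonDegenerateVariety C → Theory.NonDegenerate theory
  nonDegenerate (X , a , x , y , x≉y) p = x≉y (Setoid.trans X
    (Setoid.sym X (ext-η a z zero)) (Setoid.trans X (Func.cong (ext a z) p) (ext-η a z (suc zero))))
    where
    z : Fin 2 → Setoid.Carrier X
    z zero    = x
    z (suc _) = y

  module _ {𝓔 : EquationalTheory} (fin : FinitaryPresentation 𝓔)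
           (iso : Isomorphism Conc C (EqModels 𝓔)) where
    open EquationalTheory 𝓔 using (Arity; signature; lhs; rhs)
    private
      module To = ConcreteFunctor (Isomorphism.to iso)
      module Eq {I} = EqModel (To.str (F.str I))

    record FinitarilySupported (I : Set) : Set where
      field
        operation : Op I
        size      : ℕ
        support   : Fin size → I
        restricted : Op (Fin size)
        factors   : operation ≈ restricted [ (λ k → π (support k)) ]

    open FinitarilySupported

    module _ {I : Set} where
      -- The restricted arguments are renamed into the merged list, and `σ` is applied there;
      -- renaming back to `I` is a homomorphism, so it commutes with `σ`.
      applySupported : ∀ σ → (Arity σ → FinitarilySupported I) → FinitarilySupported I
      applySupported σ s = record
        { operation  = Eq.interp σ (λ k → operation (s k))
        ; size       = N
        ; support    = j
        ; restricted = Eq.interp σ t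
        ; factors    = begin
            Eq.interp σ (λ k → operation (s k))
              ≈⟨ Eq.interp-cong σ (λ k → factors (s k)) ⟩
            Eq.interp σ (λ k → restricted (s k) [ (λ x → π (support (s k) x)) ])
              ≈⟨ Eq.interp-cong σ (λ k → []-congʳ (restricted (s k)) (λ x →
                   trans (π-[] _ _) (reflexive (≡.cong π (proj₂ (r k) x))))) ⟨
            Eq.interp σ (λ k → restricted (s k) [ (λ x → π (proj₁ (r k) x) [ (λ y → π (j y)) ]) ])
              ≈⟨ Eq.interp-cong σ (λ k → []-assoc (restricted (s k)) _ _) ⟨
            Eq.interp σ (λ k → t k [ (λ y → π (j y)) ])
              ≈⟨ To.hom (ext-hom (F.str I) (λ y → π (j y))) σ t ⟨
            Eq.interp σ t [ (λ y → π (j y)) ] ∎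
        }
        where
        open SetoidReasoning (F.free I)
        open Setoid (F.free I) using (reflexive)
        open Inverse (proj₂ (fin σ)) using (to; from; strictlyInverseʳ)
        merged = mergeFamilies (proj₁ (fin σ)) (λ k → size (s (from k))) (λ k → support (s (from k)))
        N = proj₁ merged
        j = proj₁ (proj₂ merged)
        r : ∀ k → Σ[ r ∈ (Fin (size (s k)) → Fin N) ] (∀ x → j (r x) ≡ support (s k) x)
        -- The lists were merged in the order given by `from`; the position `to k` belongs to `k`
        -- because `from (to k)` equals `k`.
        r k = ≡.subst (λ k → Σ[ r ∈ (Fin (size (s k)) → Fin N) ] (∀ x → j (r x) ≡ support (s k) x))
                (strictlyInverseʳ k) (proj₂ (proj₂ merged) (to k))
        t : Arity σ → Op (Fin N)
        t k = restricted (s k) [ (λ x → π (proj₁ (r k) x)) ]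

    -- Only the operations are compared, so that the choice of a support is immaterial and the
    -- inclusion into the free object is injective.
    supportedSetoid : Set → Setoid 0ℓ 0ℓ
    supportedSetoid I = On.setoid {B = FinitarilySupported I} (F.free I) operation

    supportedModel : ∀ I → EqModel 𝓔 (supportedSetoid I)
    supportedModel I = record
      { algebra   = supportedAlgebra
      ; satisfies = λ E ρ → trans (evaluate-operation (lhs E) ρ)
          (trans (Eq.satisfies E _) (sym (evaluate-operation (rhs E) ρ)))
      }
      where
      supportedAlgebra : Algebra signature (supportedSetoid I)
      supportedAlgebra = record { interp = applySupported ; interp-cong = λ σ p → Eq.interp-cong σ p }
      evaluate-operation : ∀ {V} (t : Term signature V) ρ →
        operation (Algebra.evaluate supportedAlgebra t ρ) ≈ Eq.evaluate t (λ v → operation (ρ v))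
      evaluate-operation = evaluate-hom supportedAlgebra Eq.algebra
        (record { to = operation ; cong = λ p → p }) (λ _ _ → refl)

    -- The finitarily supported operations form a submodel of the free model that
    -- contains the generators, hence the free model retracts onto it.
    finitary : Theory.IsFinitary theory
    finitary {I} t = size s , support s , restricted s , trans t≈s (factors s)
      where
      open ConcreteIsomorphism iso
      From-str = ConcreteFunctor.str (Isomorphism.from iso) (supportedModel I)
      generator : I → FinitarilySupported I
      generator i = record
        { operation = π i ; size = 1 ; support = λ _ → i ; restricted = π zero
        ; factors = sym (π-[] zero _) }
      retraction : Func (F.free I) (supportedSetoid I)
      retraction = ext From-str generator
      s = retraction ⟨$⟩ t
      inclusion : Func (supportedSetoid I) (F.free I)
      inclusion = record { to = operation ; cong = λ p → p }
      t≈s : t ≈ operation s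
      t≈s = trans (ext-unique (F.str I) π idₛ id-hom (λ _ → refl) t)
        (sym (ext-unique (F.str I) π (inclusion ∘ₛ retraction)
          (∘-hom (hom-into (λ _ _ → refl)) (ext-hom From-str generator))
          (ext-η From-str generator) t))
        where
        hom-into : IsEqModelHom 𝓔 (supportedModel I) (To.str (F.str I)) inclusion →
                   IsHom From-str (F.str I) inclusion
        hom-into p = IsHom-resp (λ _ → refl)
          (∘-hom {g = idₛ} {f = inclusion} (proj₁ (Isomorphism.isoˡ iso (F.str I)))
            (ConcreteFunctor.hom (Isomorphism.from iso) p))

-- Varieties as models of the theory of their free models

module TheoryOfVariety (𝓔 : EquationalTheory) (freeObject : ∀ I → FreeObject (EqModels 𝓔) I) where
  open TheoryOfFreeObjects freeObject public
  open EquationalTheory 𝓔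
  private module F I = FreeObject (freeObject I)
  open Theory theory using (Op; π; _[_]; refl; sym; _≈_)

  generic : ∀ σ → Op (Arity σ)
  generic σ = EqModel.interp (F.str (Arity σ)) σ π

  interp≈generic : ∀ σ {V} (t : Arity σ → Op V) → EqModel.interp (F.str V) σ t ≈ generic σ [ t ]
  interp≈generic σ {V} t = Setoid.sym (F.free V) (Setoid.trans (F.free V)
    (ext-hom (F.str V) t σ π) (EqModel.interp-cong (F.str V) σ (ext-η (F.str V) t)))

  module _ {X : Setoid 0ℓ 0ℓ} (a : Model theory X) where
    open Model a
    private module X = Setoid X

    fromModelAlgebra : Algebra signature X
    fromModelAlgebra = record
      { interp      = λ σ → ⟦ generic σ ⟧
      ; interp-cong = λ σ → ⟦⟧-cong refl
      }

    ⟦⟧-func : ∀ {V} → (V → X.Carrier) → Func (F.free V) X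
    ⟦⟧-func ρ = record { to = λ t → ⟦ t ⟧ ρ ; cong = λ p → ⟦⟧-cong p (λ _ → X.refl) }

    ⟦⟧-hom : ∀ {V} (ρ : V → X.Carrier) σ t →
      ⟦ EqModel.interp (F.str V) σ t ⟧ ρ X.≈ ⟦ generic σ ⟧ (λ i → ⟦ t i ⟧ ρ)
    ⟦⟧-hom ρ σ t = X.trans (⟦⟧-cong (interp≈generic σ t) (λ _ → X.refl)) (⟦[]⟧ _ t ρ)

    evaluate-generic : ∀ {V} (t : Term signature V) ρ →
      ⟦ EqModel.evaluate (F.str V) t π ⟧ ρ X.≈ Algebra.evaluate fromModelAlgebra t ρ
    evaluate-generic {V} t ρ = X.trans
      (evaluate-hom (EqModel.algebra (F.str V)) fromModelAlgebra (⟦⟧-func ρ) (⟦⟧-hom ρ) t π)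
      (evaluate-cong fromModelAlgebra t (λ v → ⟦π⟧ v ρ))

    fromModel : EqModel 𝓔 X
    fromModel = record
      { algebra   = fromModelAlgebra
      ; satisfies = λ E ρ → X.trans (X.sym (evaluate-generic (lhs E) ρ))
          (X.trans (⟦⟧-cong (EqModel.satisfies (F.str _) E π) (λ _ → X.refl))
            (evaluate-generic (rhs E) ρ))
      }

  -- In one direction, interpreting `σ` amounts to substituting into `generic σ`. In the other, t ↦
  -- ⟦ t ⟧ x is a homomorphism out of the free model with the prescribed values on generators, hence
  -- is the extension of `x`.
  equivalence : Isomorphism Conc (EqModels 𝓔) (theory -Mod)
  equivalence = record
    { to   = comparison
    ; from = record { str = fromModel ; hom = λ p σ → p (generic σ) }
    ; isoˡ = λ {X} b →
        let p = λ σ x → Setoid.trans X (ext-hom b x σ π) (EqModel.interp-cong b σ (ext-η b x))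
        in p , (λ σ x → Setoid.sym X (p σ x))
    ; isoʳ = λ {X} a →
        let p = λ {I} (t : Op I) x → ext-unique (fromModel a) x (⟦⟧-func a x) (⟦⟧-hom a x)
                  (λ i → Model.⟦π⟧ a i x) t
        in (λ t x → Setoid.sym X (p t x)) , p
    }

-- Theories with cartesian closed categories of models

module CartesianClosedTheory (𝕋 : Theory)
  (cc : CartesianClosed (ConcreteCategory.category (𝕋 -Mod))) where
  open Theory 𝕋
  open Category (ConcreteCategory.category (𝕋 -Mod)) using (Obj; _⇒_; _⊚_) renaming (id to idₘ)
  private module CC = CartesianClosed cc

  infixl 9 _$_

  ∣_∣ : Obj → Set
  ∣ X , _ ∣ = Setoid.Carrier X

  -- Homs are repackaged as records, so that their objects can be inferred.
  record Map (A B : Obj) : Set₁ where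
    field
      func : Func (proj₁ A) (proj₁ B)
      hom  : IsModelHom 𝕋 (proj₂ A) (proj₂ B) func

  open Map

  _$_ : ∀ {A B} → Map A B → ∣ A ∣ → ∣ B ∣
  f $ x = func f ⟨$⟩ x

  morphism : ∀ {A B} → Map A B → A ⇒ B
  morphism f = func f , hom f

  asMap : ∀ A B → A ⇒ B → Map A B
  asMap _ _ (f , p) = record { func = f ; hom = p }

  -- A homomorphism A × B → C.
  record Map₂ (A B C : Obj) : Set₁ where
    private
      module A = Setoid (proj₁ A)
      module B = Setoid (proj₁ B)
      module C = Setoid (proj₁ C)
    field
      fun₂  : ∣ A ∣ → ∣ B ∣ → ∣ C ∣
      cong₂ : ∀ {x x′ y y′} → x A.≈ x′ → y B.≈ y′ → fun₂ x y C.≈ fun₂ x′ y′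
      hom₂  : ∀ {I} (t : Op I) x y → fun₂ (Model.⟦_⟧ (proj₂ A) t x) (Model.⟦_⟧ (proj₂ B) t y) C.≈
                Model.⟦_⟧ (proj₂ C) t (λ i → fun₂ (x i) (y i))

  open Map₂

  module _ {A B C D : Obj} where
    private module D = Setoid (proj₁ D)

    _∘₂_ : Map C D → Map₂ A B C → Map₂ A B D
    g ∘₂ k = record
      { fun₂  = λ x y → g $ fun₂ k x y
      ; cong₂ = λ p q → Func.cong (func g) (cong₂ k p q)
      ; hom₂  = λ t x y → D.trans (Func.cong (func g) (hom₂ k t x y)) (hom g t _) }

    _∘₂⟨1,_⟩ : Map₂ A C D → Map₂ A B C → Map₂ A B D
    l ∘₂⟨1, k ⟩ = record
      { fun₂  = λ x y → fun₂ l x (fun₂ k x y)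
      ; cong₂ = λ p q → cong₂ l p (cong₂ k p q)
      ; hom₂  = λ t x y → D.trans (cong₂ l (Setoid.refl (proj₁ A)) (hom₂ k t x y)) (hom₂ l t _ _) }

    _∘₂⟨_,1⟩ : Map₂ C B D → Map A C → Map₂ A B D
    l ∘₂⟨ f ,1⟩ = record
      { fun₂  = λ x y → fun₂ l (f $ x) y
      ; cong₂ = λ p q → cong₂ l (Func.cong (func f) p) q
      ; hom₂  = λ t x y → D.trans (cong₂ l (hom f t x) (Setoid.refl (proj₁ B))) (hom₂ l t _ _) }

  _∘₁_ : ∀ {A B C} → Map B C → Map A B → Map A C
  _∘₁_ {A} {B} {C} f g = asMap A C (_⊚_ {A} {B} {C} (morphism f) (morphism g))

  id₁ : ∀ {A} → Map A A
  id₁ {A} = asMap A A (idₘ {A})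

  _∘₁⟨1,_⟩ : ∀ {A B C} → Map₂ A B C → Map A B → Map A C
  _∘₁⟨1,_⟩ {A} {C = C} k f = record
    { func = record
      { to   = λ x → fun₂ k x (f $ x)
      ; cong = λ p → cong₂ k p (Func.cong (func f) p) }
    ; hom  = λ t x → Setoid.trans (proj₁ C)
        (cong₂ k (Setoid.refl (proj₁ A)) (hom f t x)) (hom₂ k t _ _) }

  _∘snd : ∀ {A B C} → Map B C → Map₂ A B C
  f ∘snd = record
    { fun₂ = λ _ y → f $ y ; cong₂ = λ _ q → Func.cong (func f) q ; hom₂ = λ t _ y → hom f t y }

  module _ {A B : Obj} where
    private
      module A = Setoid (proj₁ A)
      module B = Setoid (proj₁ B)
      module A⊗B = Setoid (proj₁ (A CC.⊗ B))
      A×B : Obj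
      A×B = _ , Mod-product 𝕋 (proj₂ A) (proj₂ B)
      fst : A×B ⇒ A
      fst = record { to = proj₁ ; cong = proj₁ } , λ _ _ → A.refl
      snd : A×B ⇒ B
      snd = record { to = proj₂ ; cong = proj₂ } , λ _ _ → B.refl

    -- The product of the given cartesian closed structure is known only by its universal property;
    -- this comparison from the product of setoids gives access to its elements as pairs.
    pairing : A×B ⇒ (A CC.⊗ B)
    pairing = CC.⟨_,_⟩ {A} {B} {A×B} fst snd

    π₁ : Map (A CC.⊗ B) A
    π₁ = asMap _ A (CC.π₁ {A} {B})

    π₂ : Map (A CC.⊗ B) B
    π₂ = asMap _ B (CC.π₂ {A} {B})

    pair : Map₂ A B (A CC.⊗ B)
    pair = record
      { fun₂  = λ x y → proj₁ pairing ⟨$⟩ (x , y)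
      ; cong₂ = λ p q → Func.cong (proj₁ pairing) (p , q)
      ; hom₂  = λ t x y → proj₂ pairing t (λ i → x i , y i) }

    π₁-pair : ∀ x y → π₁ $ fun₂ pair x y A.≈ x
    π₁-pair x y = CC.project₁ {f = fst} {snd} (x , y)

    π₂-pair : ∀ x y → π₂ $ fun₂ pair x y B.≈ y
    π₂-pair x y = CC.project₂ {f = fst} {snd} (x , y)

    pair-η : ∀ z → z A⊗B.≈ fun₂ pair (π₁ $ z) (π₂ $ z)
    pair-η z = A⊗B.trans
      (CC.⟨⟩-unique {A} {B} {A CC.⊗ B} {CC.π₁} {CC.π₂} {idₘ {A CC.⊗ B}}
        (λ _ → A.refl) (λ _ → B.refl) z)
      (A⊗B.sym (CC.⟨⟩-unique {A} {B} {A CC.⊗ B} {CC.π₁} {CC.π₂}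
        {record { to = λ w → fun₂ pair (π₁ $ w) (π₂ $ w)
                ; cong = λ p → cong₂ pair (Func.cong (func π₁) p) (Func.cong (func π₂) p) }
        , λ t x → A⊗B.trans (cong₂ pair (hom π₁ t x) (hom π₂ t x)) (hom₂ pair t _ _) }
        (λ w → π₁-pair _ _) (λ w → π₂-pair _ _) z))

  module _ {X Y : Obj} where
    private
      module X = Setoid (proj₁ X)
      module Y = Setoid (proj₁ Y)
      module E = Setoid (proj₁ (Y CC.^ X))

    eval : Map ((Y CC.^ X) CC.⊗ X) Y
    eval = asMap _ Y (CC.eval {X} {Y})

    ev : Map₂ (Y CC.^ X) X Y
    ev = eval ∘₂ pair

    module _ {Z : Obj} where
      first : Map Z (Y CC.^ X) → (Z CC.⊗ X) ⇒ (Y CC.^ X)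
      first g = _⊚_ {Z CC.⊗ X} {Z} {Y CC.^ X} (morphism g) (CC.π₁ {Z} {X})

      uncurried : Map Z (Y CC.^ X) → (Z CC.⊗ X) ⇒ Y
      uncurried g = _⊚_ {Z CC.⊗ X} {(Y CC.^ X) CC.⊗ X} {Y}
        CC.eval (CC.⟨_,_⟩ {Y CC.^ X} {X} {Z CC.⊗ X} (first g) CC.π₂)

      uncurried-ev : (g : Map Z (Y CC.^ X)) → ∀ z →
        proj₁ (uncurried g) ⟨$⟩ z Y.≈ fun₂ ev (g $ (π₁ $ z)) (π₂ $ z)
      uncurried-ev g z = Func.cong (func eval)
        (Setoid.trans (proj₁ ((Y CC.^ X) CC.⊗ X)) (pair-η _)
          (cong₂ pair (CC.project₁ {f = first g} {CC.π₂ {Z} {X}} z)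
                      (CC.project₂ {f = first g} {CC.π₂ {Z} {X}} z)))

      tensored : Map₂ Z X Y → (Z CC.⊗ X) ⇒ Y
      tensored k = record
        { to   = λ z → fun₂ k (π₁ $ z) (π₂ $ z)
        ; cong = λ p → cong₂ k (Func.cong (func π₁) p) (Func.cong (func π₂) p) }
        , λ t z → Y.trans (cong₂ k (hom π₁ t z) (hom π₂ t z)) (hom₂ k t _ _)

      cur : Map₂ Z X Y → Map Z (Y CC.^ X)
      cur k = asMap _ _ (CC.curry {X} {Y} {Z} (tensored k))

      cur-β : (k : Map₂ Z X Y) → ∀ z x → fun₂ ev (cur k $ z) x Y.≈ fun₂ k z x
      cur-β k z x = begin
        fun₂ ev (cur k $ z) x
          ≈⟨ cong₂ ev (Func.cong (func (cur k)) p₁) p₂ ⟨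
        fun₂ ev (cur k $ (π₁ $ w)) (π₂ $ w)
          ≈⟨ uncurried-ev (cur k) w ⟨
        proj₁ (uncurried (cur k)) ⟨$⟩ w
          ≈⟨ CC.β {f = tensored k} w ⟩
        fun₂ k (π₁ $ w) (π₂ $ w)
          ≈⟨ cong₂ k p₁ p₂ ⟩
        fun₂ k z x ∎
        where
        open SetoidReasoning (proj₁ Y)
        w = fun₂ (pair {Z} {X}) z x
        p₁ = π₁-pair {Z} {X} z x
        p₂ = π₂-pair {Z} {X} z x

      cur-unique : (g g′ : Map Z (Y CC.^ X)) →
        (∀ z x → fun₂ ev (g $ z) x Y.≈ fun₂ ev (g′ $ z) x) → func g ≗ₛ func g′
      cur-unique g g′ p z = E.trans
        (CC.curry-unique {f = uncurried g′} {morphism g}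
          (λ w → Y.trans (uncurried-ev g w) (Y.trans (p _ _) (Y.sym (uncurried-ev g′ w)))) z)
        (E.sym (CC.curry-unique {f = uncurried g′} {morphism g′} (λ _ → Y.refl) z))

  F : Set → Obj
  F I = ops I , freeModel 𝕋 I

  module _ {I : Set} {A : Obj} where
    private module A = Setoid (proj₁ A)

    bind : (I → ∣ A ∣) → Map (F I) A
    bind x = let (f , p , _) = FreeObject.extend (Mod-freeObject 𝕋 I) (proj₂ A) x in asMap _ _ (f , p)

    bind-π : ∀ x i → bind x $ π i A.≈ x i
    bind-π x = proj₁ (proj₂ (proj₂ (FreeObject.extend (Mod-freeObject 𝕋 I) (proj₂ A) x)))

    free-unique : (g g′ : Map (F I) A) → (∀ i → g $ π i A.≈ g′ $ π i) → func g ≗ₛ func g′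
    free-unique g g′ q t = A.trans (u (func g) (hom g) q t)
      (A.sym (u (func g′) (hom g′) (λ _ → A.refl) t))
      where
      u = proj₂ (proj₂ (proj₂ (FreeObject.extend (Mod-freeObject 𝕋 I) (proj₂ A) (λ i → g′ $ π i))))

  1·_ : ∀ {I} (t : Op I) → π zero · t ≈ t
  1· t = π-[] zero _

  ·1 : (m : Op (Fin 1)) → m · π zero ≈ m
  ·1 m = trans ([]-congʳ m (λ { zero → refl })) ([]-π m)

  ·π-[] : ∀ {I J} (n : Op (Fin 1)) i (x : I → Op J) → (n · π i) [ x ] ≈ n · x i
  ·π-[] n i x = trans ([]-assoc n _ x) ([]-congʳ n (λ _ → π-[] i x))

  -- Since X × (-) preserves coproducts and F(I) is the coproduct of I copies of
  -- F(1), the model F(I) × X is the coproduct of I copies of F(1) × X.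
  module _ {I : Set} {X Y : Obj} where
    private
      module X = Setoid (proj₁ X)
      module Y = Setoid (proj₁ Y)
      E = Y CC.^ X
      module E = Setoid (proj₁ E)

      transpose : Map X Y → Map (F (Fin 1)) E
      transpose f = cur (f ∘snd)

      transposes : (I → Map X Y) → I → E.Carrier
      transposes f i = transpose (f i) $ π zero

    copair : (I → Map X Y) → Map₂ (F I) X Y
    copair f = ev ∘₂⟨ bind (transposes f) ,1⟩

    -- The coproduct inclusion of index `i` is m ↦ m · π i. The extension of the transposes is a
    -- homomorphism, so it sends this element to the transpose of `f i` at `m`.
    copair-ι : ∀ f i m x → fun₂ (copair f) (m · π i) x Y.≈ f i $ x
    copair-ι f i m x = Y.trans (cong₂ ev p X.refl) (cur-β (f i ∘snd) m x)
      where
      p : bind {A = E} (transposes f) $ (m · π i) E.≈ transpose (f i) $ m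
      p = E.trans (hom (bind {A = E} (transposes f)) m (λ _ → π i))
        (E.trans (Model.⟦⟧-cong (proj₂ E) (refl {x = m}) (λ _ → bind-π {A = E} (transposes f) i))
          (E.trans (E.sym (hom (transpose (f i)) m (λ _ → π zero)))
            (Func.cong (func (transpose (f i))) (·1 m))))

    -- Transposed to homomorphisms F(I) → Y^X, the claim concerns generators only. Each `π i` is the
    -- image of the generator of F(1) under `ι i`, and on F(1) the transposes are compared by
    -- transposing back to `p`.
    copair-unique : (k k′ : Map₂ (F I) X Y) →
      (∀ i m x → fun₂ k (m · π i) x Y.≈ fun₂ k′ (m · π i) x) →
      ∀ t x → fun₂ k t x Y.≈ fun₂ k′ t x
    copair-unique k k′ p t x = Y.trans (Y.sym (cur-β k t x))
      (Y.trans (cong₂ ev (free-unique (cur k) (cur k′) q t) X.refl) (cur-β k′ t x))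
      where
      ι : I → Map (F (Fin 1)) (F I)
      ι i = bind (λ _ → π i)
      q : ∀ i → cur k $ π i E.≈ cur k′ $ π i
      q i = E.trans (Func.cong (func (cur k)) (sym (1· π i)))
        (E.trans
          (cur-unique (cur k ∘₁ ι i) (cur k′ ∘₁ ι i)
            (λ m x → Y.trans (cur-β k _ x) (Y.trans (p i m x) (Y.sym (cur-β k′ _ x)))) (π zero))
          (Func.cong (func (cur k′)) (1· π i)))

  module _ {I : Set} where
    Φ : Map₂ (F I) (F (Fin 1)) (F I)
    Φ = copair (λ i → bind (λ _ → π i))

    Φ-ι : ∀ i m n → fun₂ Φ (m · π i) n ≈ n · π i
    Φ-ι = copair-ι {X = F (Fin 1)} {F I} (λ i → bind (λ _ → π i))

    -- For t = h(λ i. m(x_i)) the homomorphism Φ sends (t , n) to h(λ i. n(x_i)),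
    -- because n = h(λ i. n); so evaluating at n = x recovers h.
    hyperaffinePart : Op I → Op I
    hyperaffinePart t = fun₂ Φ t (π zero)

    unaryPart : Op I → Op (Fin 1)
    unaryPart t = t [ (λ _ → π zero) ]

    Φ-act : ∀ t n → fun₂ Φ t n ≈ hyperaffinePart t [ (λ i → n · π i) ]
    Φ-act t n = trans (cong₂ Φ refl (sym (1· n)))
      -- With `n` fixed, this is the case k = x of Φ(t , k(n)) = Φ(t , k)(λ i. n(x_i)), whose sides
      -- are homomorphisms in (t , k).
      (copair-unique (Φ ∘₂⟨1, bind (λ _ → n) ∘snd ⟩) (bind (λ i → n · π i) ∘₂ Φ)
        (λ i m k → trans (Φ-ι i m (k · n)) (trans ([]-assoc k _ _)
          (sym (trans ([]-congˡ (Φ-ι i m k)) (·π-[] k i _)))))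
        t (π zero))

    Φ-affine : ∀ t n → fun₂ Φ t n [ (λ _ → π zero) ] ≈ n
    Φ-affine = copair-unique (bind (λ _ → π zero) ∘₂ Φ) (id₁ ∘snd)
      (λ i m k → trans ([]-congˡ (Φ-ι i m k)) (trans (·π-[] k i _) (·1 k)))

    -- The map t ↦ Φ(t , t(λ i. x)) is an endomorphism of F(I) fixing the generators, hence the
    -- identity. With `Φ-act` this is the decomposition of `t`.
    Φ-unaryPart : ∀ t → fun₂ Φ t (unaryPart t) ≈ t
    Φ-unaryPart = free-unique (Φ ∘₁⟨1, bind (λ _ → π zero) ⟩) id₁
      (λ i → trans (cong₂ Φ (sym (1· π i)) (π-[] i _))
        (trans (Φ-ι i (π zero) (π zero)) (1· π i)))

    -- Ψ sends (h(λ i. m(x_i)) , s) to h(λ i. s(λ j. x_ij)).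
    Ψ : Map₂ (F I) (F I) (F (I × I))
    Ψ = copair (λ i → bind (λ j → π (i , j)))

    Ψ-ι : ∀ i m s → fun₂ Ψ (m · π i) s ≈ s [ (λ j → π (i , j)) ]
    Ψ-ι = copair-ι {X = F I} {F (I × I)} (λ i → bind (λ j → π (i , j)))

    -- At t = m(x_i) and n = k both sides are k(x_ii): Φ forgets `m` and puts `k` at index `i`, and
    -- Ψ uses that same `i` for both indices.
    Ψ-diagonal : ∀ t n → fun₂ Ψ t (fun₂ Φ t n) ≈ fun₂ Φ t n [ (λ i → π (i , i)) ]
    Ψ-diagonal = copair-unique (Ψ ∘₂⟨1, Φ ⟩) (bind (λ i → π (i , i)) ∘₂ Φ)
      (λ i m k → trans (Ψ-ι i m _) (trans ([]-congˡ (Φ-ι i m k)) (trans (·π-[] k i _)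
        (sym (trans ([]-congˡ (Φ-ι i m k)) (·π-[] k i _))))))

    Ψ-act : ∀ s t n → fun₂ Ψ t (n · s) ≈ fun₂ Φ t n [ (λ i → s [ (λ j → π (i , j)) ]) ]
    Ψ-act s = copair-unique (Ψ ∘₂⟨1, bind (λ _ → s) ∘snd ⟩)
      (bind (λ i → s [ (λ j → π (i , j)) ]) ∘₂ Φ)
      (λ i m k → trans (Ψ-ι i m _) (trans ([]-assoc k _ _)
        (sym (trans ([]-congˡ (Φ-ι i m k)) (·π-[] k i _)))))

    decomposition : (t : Op I) → Decomposition t
    decomposition t = record
      { h           = hyperaffinePart t
      ; hyperaffine = Φ-affine t (π zero) ,
          -- The homomorphism Ψ at (t , `hyperaffinePart t`) is computed twice, as a nested
          -- substitution by `Ψ-act` and as a diagonal one by `Ψ-diagonal`.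
          trans (sym (Ψ-act (hyperaffinePart t) t (π zero)))
            (trans (cong₂ Ψ refl (1· _)) (Ψ-diagonal t (π zero)))
      ; m           = unaryPart t
      ; equation    = trans (sym (Φ-unaryPart t)) (Φ-act t (unaryPart t))
      }

  isHyperaffineUnary : IsHyperaffineUnary
  isHyperaffineUnary t = decomposition t , λ d → let open Decomposition d in
      sym (begin
        fun₂ Φ t (π zero)
          -- Writing the second argument as `h` of a constant family lets the homomorphism Φ move
          -- inside `h`.
          ≈⟨ cong₂ Φ equation (sym (affine-eq (proj₁ hyperaffine) (π zero))) ⟩
        fun₂ Φ (h [ (λ i → m · π i) ]) (h [ (λ _ → π zero) ])
          ≈⟨ hom₂ Φ h (λ i → m · π i) (λ _ → π zero) ⟩
        h [ (λ i → fun₂ Φ (m · π i) (π zero)) ]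
          ≈⟨ []-congʳ h (λ i → trans (Φ-ι i m (π zero)) (1· π i)) ⟩
        h [ π ]
          ≈⟨ []-π h ⟩
        h ∎)
    , sym (trans ([]-congˡ equation) (trans ([]-assoc h _ _)
        (trans ([]-congʳ h (λ i → trans (·π-[] m i _) (·1 m)))
          (affine-eq (proj₁ hyperaffine) m))))
    where open SetoidReasoning (ops _)

-- Hyperaffine–unary theories and matched pairs

module Decompositions (𝕋 : Theory) (hau : Theory.IsHyperaffineUnary 𝕋) where
  open Theory 𝕋
  open Down 𝕋 hau
  private module SubTheory = HyperaffineTheory hyperaffineSubtheory proj₂

  H : Set → Set
  H I = Theory.Op hyperaffineSubtheory I

  inclusion : TheoryHom hyperaffineSubtheory 𝕋
  inclusion = record
    { map = proj₁ ; map-cong = λ p → p ; map-π = λ _ → refl ; map-[] = λ _ _ → refl }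

  module _ {I : Set} where
    hyperaffinePart : Op I → H I
    hyperaffinePart t = Decomposition.h d , Decomposition.hyperaffine d
      where d = proj₁ (hau t)

    unaryPart : Op I → Op (Fin 1)
    unaryPart t = Decomposition.m (proj₁ (hau t))

    compose : H I → Op (Fin 1) → Op I
    compose (h , _) m = h [ (λ i → m · π i) ]

    compose-parts : ∀ t → t ≈ compose (hyperaffinePart t) (unaryPart t)
    compose-parts t = Decomposition.equation (proj₁ (hau t))

    parts-unique : ∀ {t} (h : H I) m → t ≈ compose h m →
                   (proj₁ (hyperaffinePart t) ≈ proj₁ h) × (unaryPart t ≈ m)
    parts-unique {t} (h , hyp) m p = sym (proj₁ q) , sym (proj₂ q)
      where q = proj₂ (hau t) (record { h = h ; hyperaffine = hyp ; m = m ; equation = p })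

    parts-cong : ∀ {t t′} → t ≈ t′ →
      (proj₁ (hyperaffinePart t) ≈ proj₁ (hyperaffinePart t′)) × (unaryPart t ≈ unaryPart t′)
    parts-cong {t} {t′} p = parts-unique (hyperaffinePart t′) (unaryPart t′)
      (trans p (compose-parts t′))

    parts-hyperaffine : (h : H I) →
      (proj₁ (hyperaffinePart (proj₁ h)) ≈ proj₁ h) × (unaryPart (proj₁ h) ≈ π zero)
    parts-hyperaffine (h , hyp) = parts-unique (h , hyp) (π zero)
      (sym (trans ([]-congʳ h (λ i → π-[] zero _)) ([]-π h)))

  -- Moving `m` past each `k i` leaves a unary operation m · n i that still depends on `i`, whereas
  -- a decomposition has a single unary part.
  compose-[] : ∀ {I J} (h : H I) m (k : I → H J) (n : I → Op (Fin 1)) →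
    compose h m [ (λ i → compose (k i) (n i)) ] ≈
    compose (Theory._[_] hyperaffineSubtheory h (λ i → m ⋆ proj₁ (k i) , ⋆-hyperaffine m (proj₁ (k i))))
            (proj₁ h [ (λ i → m · n i) ])
  compose-[] {_} {J} (h , hyp) m k n = begin
    h [ (λ i → m · π i) ] [ (λ i → compose (k i) (n i)) ]
      ≈⟨ []-assoc h _ _ ⟩
    h [ (λ i → (m · π i) [ (λ i → compose (k i) (n i)) ]) ]
      ≈⟨ []-congʳ h (λ i → trans (·-[] m (π i) _) ([]-congʳ m (λ _ → π-[] i _))) ⟩
    h [ (λ i → m · compose (k i) (n i)) ]
      ≈⟨ []-congʳ h (λ i → ⋆-eq m (proj₂ (k i)) _) ⟩
    h [ (λ i → (m ⋆ proj₁ (k i)) [ (λ j → m · (n i · π j)) ]) ]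
      -- Absorption is read backwards: a second copy of `h` gathers the m · n i into one unary
      -- operation independent of the outer `i`.
      ≈⟨ SubTheory.InModel.⟦⟧-absorb (reindex inclusion (freeModel 𝕋 J)) (h , hyp)
           (λ i → m ⋆ proj₁ (k i) , ⋆-hyperaffine m (proj₁ (k i))) (λ _ j i → m · (n i · π j)) ⟨
    h [ (λ i → (m ⋆ proj₁ (k i)) [ (λ j → h [ (λ i → m · (n i · π j)) ]) ]) ]
      ≈⟨ []-congʳ h (λ i → []-congʳ (m ⋆ proj₁ (k i)) (λ j →
           trans ([]-assoc h _ _) ([]-congʳ h (λ i → ·-[] m (n i) _)))) ⟨
    h [ (λ i → (m ⋆ proj₁ (k i)) [ (λ j → (h [ (λ i → m · n i) ]) · π j) ]) ]
      ≈⟨ []-assoc h _ _ ⟨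
    h [ (λ i → m ⋆ proj₁ (k i)) ] [ (λ j → (h [ (λ i → m · n i) ]) · π j) ] ∎
    where open SetoidReasoning (ops J)

  parts-[] : ∀ {I J} (t : Op I) (u : I → Op J) →
    (proj₁ (hyperaffinePart (t [ u ])) ≈
      proj₁ (hyperaffinePart t) [ (λ i → unaryPart t ⋆ proj₁ (hyperaffinePart (u i))) ])
    × (unaryPart (t [ u ]) ≈ proj₁ (hyperaffinePart t) [ (λ i → unaryPart t · unaryPart (u i)) ])
  parts-[] t u = parts-unique
    (Theory._[_] hyperaffineSubtheory (hyperaffinePart t)
      (λ i → unaryPart t ⋆ proj₁ (hyperaffinePart (u i)) , ⋆-hyperaffine _ _)) _ (trans
    ([]-cong (compose-parts t) (λ i → compose-parts (u i)))
    (compose-[] (hyperaffinePart t) (unaryPart t)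
      (λ i → hyperaffinePart (u i)) (λ i → unaryPart (u i))))

  parts-unary : (m : Op (Fin 1)) →
    (proj₁ (hyperaffinePart m) ≈ π zero) × (unaryPart m ≈ m)
  parts-unary m = parts-unique (π zero , π-hyperaffine zero) m
    (sym (trans (π-[] zero _) (·-identityʳ m)))

  -- The operation `u` through which `t` factors need not be hyperaffine, so its hyperaffine part is
  -- used; uniqueness of decompositions shows that `t` still factors through it.
  subtheory-finitary : IsFinitary → Theory.IsFinitary hyperaffineSubtheory
  subtheory-finitary fin (t , hyp) = n , i , hyperaffinePart u ,
    trans (sym (proj₁ (parts-hyperaffine (t , hyp)))) (proj₁ (parts-unique h[i] m t≈))
    where
    n = proj₁ (fin t)
    i = proj₁ (proj₂ (fin t))
    u = proj₁ (proj₂ (proj₂ (fin t)))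
    h = proj₁ (hyperaffinePart u)
    m = unaryPart u
    h[i] : H _
    h[i] = Theory._[_] hyperaffineSubtheory (hyperaffinePart u) (λ k → π (i k) , π-hyperaffine (i k))
    t≈ : t ≈ compose h[i] m
    t≈ = begin
      t
        ≈⟨ proj₂ (proj₂ (proj₂ (fin t))) ⟩
      u [ (λ k → π (i k)) ]
        ≈⟨ []-congˡ (compose-parts u) ⟩
      h [ (λ k → m · π k) ] [ (λ k → π (i k)) ]
        ≈⟨ []-assoc h _ _ ⟩
      h [ (λ k → (m · π k) [ (λ k → π (i k)) ]) ]
        ≈⟨ []-congʳ h (λ k → trans (·-[] m (π k) _) ([]-congʳ m (λ _ → π-[] k _))) ⟩
      h [ (λ k → m · π (i k)) ]
        ≈⟨ []-congʳ h (λ k → π-[] (i k) _) ⟨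
      h [ (λ k → π (i k) [ (λ j → m · π j) ]) ]
        ≈⟨ []-assoc h _ _ ⟨
      h [ (λ k → π (i k)) ] [ (λ j → m · π j) ] ∎
      where open SetoidReasoning (ops _)

  toPairModel : ∀ {X} → Model 𝕋 X → PairModel matchedPair X
  toPairModel {X} a = record
    { model  = reindex inclusion a
    ; _•_    = λ m x → ⟦ m ⟧ (λ _ → x)
    ; •-cong = λ p q → ⟦⟧-cong p (λ _ → q)
    ; ε-•    = λ x → ⟦π⟧ zero _
    ; ∙-•    = λ m n x → ⟦[]⟧ m _ _
    ; ▷-•    = λ (h , _) m x → ⟦[]⟧ h m _
    ; •-⟦⟧   = λ n (h , hyp) x → X.trans (X.sym (⟦[]⟧ n _ x))
        (X.trans (⟦⟧-cong (⋆-spec n hyp) (λ _ → X.refl))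
          (X.trans (⟦[]⟧ (n ⋆ h) _ x) (⟦⟧-cong refl (λ i →
            X.trans (⟦[]⟧ n _ x) (⟦⟧-cong refl (λ _ → ⟦π⟧ i x))))))
    }
    where
    open Model a
    module X = Setoid X

  -- The law for substitution is `parts-[]` followed by the absorption of `compose-[]`, now carried
  -- out in the model.
  fromPairModel : ∀ {X} → PairModel matchedPair X → Model 𝕋 X
  fromPairModel {X} a = record
    { ⟦_⟧     = λ t x → ⟦ hyperaffinePart t ⟧ (λ i → unaryPart t • x i)
    ; ⟦⟧-cong = λ p q → ⟦⟧-cong (proj₁ (parts-cong p)) (λ i → •-cong (proj₂ (parts-cong p)) (q i))
    ; ⟦π⟧     = λ i x → X.trans
        (⟦⟧-cong (proj₁ (parts-hyperaffine (π i , π-hyperaffine i)))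
          (λ j → X.trans (•-cong (proj₂ (parts-hyperaffine (π i , π-hyperaffine i))) X.refl) (ε-• _)))
        (⟦π⟧ i x)
    ; ⟦[]⟧    = λ {I} {J} t u x →
        let h = hyperaffinePart t
            m = unaryPart t
            k = λ i → hyperaffinePart (u i)
            n = λ i → unaryPart (u i)
            mk = λ i → m ⋆ proj₁ (k i) , ⋆-hyperaffine m (proj₁ (k i))
        in begin
          ⟦ hyperaffinePart (t [ u ]) ⟧ (λ j → unaryPart (t [ u ]) • x j)
            ≈⟨ ⟦⟧-cong {t′ = Theory._[_] hyperaffineSubtheory h mk} (proj₁ (parts-[] t u))
                 (λ j → •-cong (proj₂ (parts-[] t u)) X.refl) ⟩
          ⟦ Theory._[_] hyperaffineSubtheory h mk ⟧ (λ j → (proj₁ h [ (λ i → m · n i) ]) • x j)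
            ≈⟨ ⟦[]⟧ h mk _ ⟩
          ⟦ h ⟧ (λ i → ⟦ mk i ⟧ (λ j → (proj₁ h [ (λ i → m · n i) ]) • x j))
            ≈⟨ ⟦⟧-cong {t = h} refl (λ i → ⟦⟧-cong {t = mk i} refl (λ j → ▷-• h _ (x j))) ⟩
          ⟦ h ⟧ (λ i → ⟦ mk i ⟧ (λ j → ⟦ h ⟧ (λ i → (m · n i) • x j)))
            ≈⟨ SubTheory.InModel.⟦⟧-absorb model h mk (λ _ j i → (m · n i) • x j) ⟩
          ⟦ h ⟧ (λ i → ⟦ mk i ⟧ (λ j → (m · n i) • x j))
            ≈⟨ ⟦⟧-cong {t = h} refl (λ i → ⟦⟧-cong {t = mk i} refl (λ j → ∙-• m (n i) (x j))) ⟩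
          ⟦ h ⟧ (λ i → ⟦ mk i ⟧ (λ j → m • (n i • x j)))
            ≈⟨ ⟦⟧-cong {t = h} refl (λ i → •-⟦⟧ m (k i) _) ⟨
          ⟦ h ⟧ (λ i → m • ⟦ k i ⟧ (λ j → n i • x j)) ∎
    }
    where
    open PairModel a
    module X = Setoid X
    open SetoidReasoning X

  ⟦⟧-parts : ∀ {X} (a : Model 𝕋 X) {I} (t : Op I) x → let open Model a in
    Setoid._≈_ X (⟦ t ⟧ x) (⟦ proj₁ (hyperaffinePart t) ⟧ (λ i → ⟦ unaryPart t ⟧ (λ _ → x i)))
  ⟦⟧-parts {X} a t x = X.trans (⟦⟧-cong (compose-parts t) (λ _ → X.refl))
      (X.trans (⟦[]⟧ (proj₁ (hyperaffinePart t)) _ x) (⟦⟧-cong refl (λ i →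
        X.trans (⟦[]⟧ (unaryPart t) _ x) (⟦⟧-cong refl (λ _ → ⟦π⟧ i x)))))
    where
    open Model a
    module X = Setoid X

  module _ {X : Setoid 0ℓ 0ℓ} (a : PairModel matchedPair X) where
    open PairModel a
    private module X = Setoid X

    ⟦⟧-fromPairModel : ∀ {I} (h : H I) x → Model.⟦_⟧ (fromPairModel a) (proj₁ h) x X.≈ ⟦ h ⟧ x
    ⟦⟧-fromPairModel h x = ⟦⟧-cong {t = hyperaffinePart (proj₁ h)} {h} (proj₁ (parts-hyperaffine h))
      (λ i → X.trans (•-cong (proj₂ (parts-hyperaffine h)) X.refl) (ε-• (x i)))

    •-fromPairModel : ∀ m x → Model.⟦_⟧ (fromPairModel a) m (λ _ → x) X.≈ m • x
    •-fromPairModel m x = X.trans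
      (SubTheory.InModel.⟦⟧-const model (hyperaffinePart m) (unaryPart m • x))
      (•-cong (proj₂ (parts-unary m)) X.refl)

  toPairMod : ConcreteFunctor (𝕋 -Mod) (matchedPair -PairMod)
  toPairMod = record
    { str = toPairModel
    ; hom = λ p → (λ h → p (proj₁ h)) , (λ m x → p m (λ _ → x)) }

  fromPairMod : ConcreteFunctor (matchedPair -PairMod) (𝕋 -Mod)
  fromPairMod = record
    { str = fromPairModel
    ; hom = λ {_} {Y} {_} {b} {f} (p , q) t x → Setoid.trans Y
        (p (hyperaffinePart t) _)
        (PairModel.⟦⟧-cong b {t = hyperaffinePart t} {hyperaffinePart t} refl
          (λ i → q (unaryPart t) (x i)))
    }

  fromPairMod-toPairMod : ∀ {X} (a : Model 𝕋 X) →
    ConcreteCategory._≈ₛₜᵣ_ (𝕋 -Mod) (fromPairModel (toPairModel a)) a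
  fromPairMod-toPairMod {X} a = (λ t x → Setoid.sym X (⟦⟧-parts a t x)) , ⟦⟧-parts a

  toPairMod-fromPairMod : ∀ {X} (a : PairModel matchedPair X) →
    ConcreteCategory._≈ₛₜᵣ_ (matchedPair -PairMod) (toPairModel (fromPairModel a)) a
  toPairMod-fromPairMod {X} a =
      (⟦⟧-fromPairModel a , •-fromPairModel a)
    , ((λ h x → Setoid.sym X (⟦⟧-fromPairModel a h x)) , (λ m x → Setoid.sym X (•-fromPairModel a m x)))

  Mod≅PairMod : Isomorphism Conc (𝕋 -Mod) (matchedPair -PairMod)
  Mod≅PairMod = record
    { to   = toPairMod
    ; from = fromPairMod
    ; isoˡ = fromPairMod-toPairMod
    ; isoʳ = toPairMod-fromPairMod
    }

module DownHom (𝕊 : Theory) (hauₛ : Theory.IsHyperaffineUnary 𝕊)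
               (𝕋 : Theory) (hauₜ : Theory.IsHyperaffineUnary 𝕋) where
  private
    module S = Theory 𝕊
    module T = Theory 𝕋
    module DS = Decompositions 𝕊 hauₛ
    module DT = Decompositions 𝕋 hauₜ

  -- Decompositions are preserved, so `φ` is determined by its restrictions to hyperaffine and to
  -- unary operations; hence ↓ is faithful.
  map-parts : (φ : TheoryHom 𝕊 𝕋) → let open TheoryHom φ in ∀ {I} (s : S.Op I) →
    map s T.≈ DT.compose (map (proj₁ (DS.hyperaffinePart s)) , map-hyperaffine φ (proj₂ (DS.hyperaffinePart s)))
                         (map (DS.unaryPart s))
  map-parts φ s = T.trans (map-cong (DS.compose-parts s))
    (T.trans (map-[] _ _) (T.[]-congʳ (map (proj₁ (DS.hyperaffinePart s))) (λ i →
      T.trans (map-[] _ _) (T.[]-congʳ (map (DS.unaryPart s)) (λ _ → map-π i)))))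
    where open TheoryHom φ

  module _ (g : MatchedPairHom (Down.matchedPair 𝕊 hauₛ) (Down.matchedPair 𝕋 hauₜ)) where
    open MatchedPairHom g

    mapParts : ∀ {I} → DS.H I → S.Op (Fin 1) → T.Op I
    mapParts h m = DT.compose (map h) (f m)

    map-hyperaffinePart : ∀ {I} (h : DS.H I) →
      mapParts (DS.hyperaffinePart (proj₁ h)) (DS.unaryPart (proj₁ h)) T.≈ proj₁ (map h)
    map-hyperaffinePart h = T.trans
      (T.[]-cong (map-cong (proj₁ (DS.parts-hyperaffine h)))
        (λ i → T.trans (T.[]-congˡ (T.trans (f-cong (proj₂ (DS.parts-hyperaffine h))) ε-homo))
          (T.π-[] zero _)))
      (T.[]-π _)

    preimage : TheoryHom 𝕊 𝕋
    preimage = record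
      { map      = λ s → mapParts (DS.hyperaffinePart s) (DS.unaryPart s)
      ; map-cong = λ p → T.[]-cong (map-cong (proj₁ (DS.parts-cong p)))
          (λ i → T.[]-congˡ (f-cong (proj₂ (DS.parts-cong p))))
      ; map-π    = λ i → T.trans
          (map-hyperaffinePart (S.π i , Down.π-hyperaffine 𝕊 hauₛ i)) (map-π i)
      -- The parts of `s [ u ]` are computed in 𝕊, carried over by `map-^*` and `f-▷`, and
      -- reassembled by `compose-[]` in 𝕋.
      ; map-[]   = λ s u → T.trans
          (T.[]-cong
            (T.trans (map-cong (proj₁ (DS.parts-[] s u)))
              (T.trans (map-[] (DS.hyperaffinePart s) _)
                (T.[]-congʳ (proj₁ (map (DS.hyperaffinePart s)))
                  (λ i → map-^* (DS.unaryPart s) (DS.hyperaffinePart (u i))))))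
            (λ j → T.[]-congˡ
              (T.trans (f-cong (proj₂ (DS.parts-[] s u)))
                (T.trans (f-▷ (DS.hyperaffinePart s) _)
                  (T.[]-congʳ (proj₁ (map (DS.hyperaffinePart s)))
                    (λ i → ∙-homo (DS.unaryPart s) (DS.unaryPart (u i))))))))
          (T.sym (DT.compose-[] (map (DS.hyperaffinePart s)) (f (DS.unaryPart s))
            (λ i → map (DS.hyperaffinePart (u i))) (λ i → f (DS.unaryPart (u i)))))
      }

    F-preimage : Category._≈_ MatchedPairs (downHom preimage hauₛ hauₜ) g
    F-preimage = map-hyperaffinePart , λ m → T.trans
      (T.[]-cong (T.trans (map-cong (proj₁ (DS.parts-unary m))) (map-π zero))
        (λ i → T.[]-congˡ (f-cong (proj₂ (DS.parts-unary m)))))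
      (T.trans (T.π-[] zero _) (Down.·-identityʳ 𝕋 hauₜ (f m)))

↓-fullyFaithful : IsFullyFaithful ↓
↓-fullyFaithful = record
  { preimage   = λ {(𝕊 , p)} {(𝕋 , q)} → DownHom.preimage 𝕊 (hyperaffineUnary p) 𝕋 (hyperaffineUnary q)
  ; F-preimage = λ {(𝕊 , p)} {(𝕋 , q)} → DownHom.F-preimage 𝕊 (hyperaffineUnary p) 𝕋 (hyperaffineUnary q)
  ; faithful   = λ {(𝕊 , p)} {(𝕋 , q)} {φ} {ψ} (r , r′) s →
      let open DownHom 𝕊 (hyperaffineUnary p) 𝕋 (hyperaffineUnary q)
          open Decompositions 𝕊 (hyperaffineUnary p)
          open Theory 𝕋
      in trans (map-parts φ s) (trans
           ([]-cong (r (hyperaffinePart s)) (λ i → []-congˡ (r′ (unaryPart s))))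
           (sym (map-parts ψ s)))
  }
  where open IsHAffUn

-- The theory with T(I) = H(I) × M, where (h , m) stands for h(λ i. m(x_i)).
module Up (P : MatchedPair) where
  open MatchedPair P
  open Pair P hiding (isHyperaffineUnary)
  private
    module H = Theory H
    module M = Monoid M
    module MM = InModel monoidModel

  ▷-const : ∀ {I} (h : Op I) m → h ▷ (λ _ → m) ≈ₘ m
  ▷-const = MM.⟦⟧-const

  theory : Theory
  theory = record
    { ops      = λ I → ×-setoid (H.ops I) M.setoid
    ; π        = λ i → π i , ε
    ; _[_]     = λ (h , m) u →
        h [ (λ i → m ^* proj₁ (u i)) ] , h ▷ (λ i → m ∙ proj₂ (u i))
    ; []-cong  = λ (p , q) r →
          H.[]-cong p (λ i → ^*-cong q (proj₁ (r i)))
        , ▷-cong p (λ i → M.∙-cong q (proj₂ (r i)))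
    ; []-π     = λ (h , m) →
          H.trans (H.[]-congʳ h (λ i → ^*-π m i)) (H.[]-π h)
        , M.trans (▷-cong H.refl (λ _ → M.identityʳ m)) (▷-const h m)
    ; π-[]     = λ i u →
          H.trans (H.π-[] i _) (^*-ε _)
        , M.trans (π-▷ i _) (M.identityˡ _)
    ; []-assoc = λ {_} {J} {K} (h , m) u v →
        let k = λ i → proj₁ (u i)
            n = λ i → proj₂ (u i)
            l = λ j → proj₁ (v j)
            p = λ j → proj₂ (v j)
        in
          (let open SetoidReasoning (H.ops K) in begin
            h [ (λ i → m ^* k i) ] [ (λ j → (h ▷ (λ i → m ∙ n i)) ^* l j) ]
              ≈⟨ H.[]-assoc h _ _ ⟩
            h [ (λ i → (m ^* k i) [ (λ j → (h ▷ (λ i → m ∙ n i)) ^* l j) ]) ]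
              ≈⟨ H.[]-congʳ h (λ i → H.[]-congʳ (m ^* k i) (λ j → ▷-^* h _ (l j))) ⟩
            h [ (λ i → (m ^* k i) [ (λ j → h [ (λ i → (m ∙ n i) ^* l j) ]) ]) ]
              -- The copy of `h` brought in by the unary part of the first substitution merges with
              -- the outer one.
              ≈⟨ InModel.⟦⟧-absorb (freeModel H K) h (λ i → m ^* k i) (λ _ j i → (m ∙ n i) ^* l j) ⟩
            h [ (λ i → (m ^* k i) [ (λ j → (m ∙ n i) ^* l j) ]) ]
              ≈⟨ H.[]-congʳ h (λ i → H.[]-congʳ (m ^* k i) (λ j → ^*-∙ m (n i) (l j))) ⟨
            h [ (λ i → (m ^* k i) [ (λ j → m ^* (n i ^* l j)) ]) ]
              ≈⟨ H.[]-congʳ h (λ i → ^*-[] m (k i) _) ⟨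
            h [ (λ i → m ^* (k i [ (λ j → n i ^* l j) ])) ] ∎)
        , (let open SetoidReasoning M.setoid in begin
            (h [ (λ i → m ^* k i) ]) ▷ (λ j → (h ▷ (λ i → m ∙ n i)) ∙ p j)
              ≈⟨ []-▷ h _ _ ⟩
            h ▷ (λ i → (m ^* k i) ▷ (λ j → (h ▷ (λ i → m ∙ n i)) ∙ p j))
              ≈⟨ ▷-cong H.refl (λ i → ▷-cong H.refl (λ j → ▷-∙ʳ h _ (p j))) ⟩
            h ▷ (λ i → (m ^* k i) ▷ (λ j → h ▷ (λ i → (m ∙ n i) ∙ p j)))
              ≈⟨ MM.⟦⟧-absorb h (λ i → m ^* k i) (λ _ j i → (m ∙ n i) ∙ p j) ⟩
            h ▷ (λ i → (m ^* k i) ▷ (λ j → (m ∙ n i) ∙ p j))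
              ≈⟨ ▷-cong H.refl (λ i → ▷-cong H.refl (λ j → M.assoc m (n i) (p j))) ⟩
            h ▷ (λ i → (m ^* k i) ▷ (λ j → m ∙ (n i ∙ p j)))
              ≈⟨ ▷-cong H.refl (λ i → ▷-∙ˡ m (k i) _) ⟨
            h ▷ (λ i → m ∙ (k i ▷ (λ j → n i ∙ p j))) ∎)
    }

  private module T = Theory theory

  ,ε-[] : ∀ {I J} (h : Op I) (u : I → T.Op J) →
          (h , ε) T.[ u ] T.≈ (h [ (λ i → proj₁ (u i)) ] , h ▷ (λ i → proj₂ (u i)))
  ,ε-[] h u = H.[]-congʳ h (λ i → ^*-ε _) , ▷-cong H.refl (λ i → M.identityˡ _)

  ,ε-rename : ∀ {I J} (h : Op I) (v : I → J) →
              (h , ε) T.[ (λ i → T.π (v i)) ] T.≈ (h [ (λ i → π (v i)) ] , ε)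
  ,ε-rename h v = T.trans (,ε-[] h _) (H.refl , ▷-const h ε)

  ,ε-hyperaffine : ∀ {I} (h : Op I) → T.IsHyperaffine (h , ε)
  ,ε-hyperaffine h = T.trans (,ε-rename h _) (proj₁ (H-hyperaffine h) , M.refl)
    , T.trans (T.[]-congʳ (h , ε) (λ i → ,ε-rename h _))
        (T.trans (,ε-[] h _)
          (T.trans (proj₂ (H-hyperaffine h) , ▷-const h ε) (T.sym (,ε-rename h _))))

  -- In the monoid component, the affine law reads h ▷ (λ _ → m ∙ ε) = ε, and its left side is `m`.
  hyperaffine⇒ε : ∀ {I} {t : T.Op I} → T.IsHyperaffine t → proj₂ t ≈ₘ ε
  hyperaffine⇒ε {t = h , m} ((_ , p) , _) = M.trans (M.sym
    (M.trans (▷-cong H.refl (λ _ → M.identityʳ m)) (▷-const h m))) p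

  ·-π : ∀ {I} (t : T.Op (Fin 1)) (i : I) → t T.· T.π i T.≈ (π i , proj₂ t)
  ·-π (u , n) i =
      H.trans (H.[]-cong (unary-trivial u) (λ _ → ^*-π n i)) (H.π-[] zero _)
    , M.trans (▷-cong H.refl (λ _ → M.identityʳ n)) (▷-const u n)

  compose-≈ : ∀ {I} (h : Op I) (t : T.Op (Fin 1)) →
              (h , ε) T.[ (λ i → t T.· T.π i) ] T.≈ (h , proj₂ t)
  compose-≈ h t = T.trans (,ε-[] h _)
    ( H.trans (H.[]-congʳ h (λ i → proj₁ (·-π t i))) (H.[]-π h)
    , M.trans (▷-cong H.refl (λ i → proj₂ (·-π t i))) (▷-const h _))

  isHyperaffineUnary : T.IsHyperaffineUnary
  isHyperaffineUnary (h , m) =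
      record
        -- By `unary-trivial`, `π zero` is the only possible first component of a unary operation.
        { h = h , ε ; hyperaffine = ,ε-hyperaffine h ; m = π zero , m
        ; equation = T.sym (compose-≈ h (π zero , m)) }
    , λ d → let module D = T.Decomposition d
                ε′ = hyperaffine⇒ε D.hyperaffine
                p = T.trans D.equation (T.trans
                      (T.[]-congˡ {t = D.h} {proj₁ D.h , ε} (H.refl , ε′))
                      (compose-≈ (proj₁ D.h) D.m))
            in (H.sym (proj₁ p) , ε′) , (unary-trivial _ , M.sym (proj₂ p))

  nonDegenerate : H.NonDegenerate → T.NonDegenerate
  nonDegenerate nd p = nd (proj₁ p)

  isHAffUn : H.NonDegenerate → IsHAffUn theory
  isHAffUn nd = record
    { hyperaffineUnary = isHyperaffineUnary ; nonDegenerate = nonDegenerate nd }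

  finitary : H.IsFinitary → T.IsFinitary
  finitary fin (h , m) =
    let (n , i , u , p) = fin h in
    n , i , (u , m) ,
      ( H.trans p (H.sym (H.[]-congʳ u (λ k → ^*-π m (i k))))
      , M.sym (M.trans (▷-cong H.refl (λ _ → M.identityʳ m)) (▷-const u m)))

  -- The type is spelled exactly as it is used in ↓-essentiallySurjective, because
  -- Agda would otherwise unfold the matched pair to compare the two spellings.
  down≅ : (p : IsHAffUn theory) (nd : IsNonDegeneratePair P) →
          Isomorphism [HAff∣Un] (Functor.F₀ ↓ (theory , p)) (P , nd)
  down≅ hau nd = record
    { to   = record
      { φ       = record
        { map      = λ ((h , _) , _) → h
        ; map-cong = proj₁
        ; map-π    = λ _ → H.refl
        ; map-[]   = λ (h , hyp) u → H.[]-congʳ (proj₁ h) (λ i →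
            H.trans (^*-cong (hyperaffine⇒ε hyp) H.refl) (^*-ε _))
        }
      ; f       = proj₂
      ; f-isHom = record
        { isMagmaHomomorphism = record
          { isRelHomomorphism = record { cong = proj₂ }
          ; homo = λ (u , m) (v , n) → ▷-const u (m ∙ n) }
        ; ε-homo = M.refl }
      ; map-^*  = λ (u , m) (h , hyp) → proj₁ (⋆-,ε hyp)
      ; f-▷     = λ (h , hyp) n → ▷-cong H.refl (λ i →
          M.trans (M.∙-cong (hyperaffine⇒ε hyp) M.refl) (M.identityˡ _))
      }
    ; from = record
      { φ       = record
        { map      = λ h → (h , ε) , ,ε-hyperaffine h
        ; map-cong = λ p → p , M.refl
        ; map-π    = λ _ → T.refl
        ; map-[]   = λ h u → T.sym (T.trans (,ε-[] h _) (H.refl , ▷-const h ε))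
        }
      ; f       = λ m → π zero , m
      ; f-isHom = record
        { isMagmaHomomorphism = record
          { isRelHomomorphism = record { cong = λ p → H.refl , p }
          ; homo = λ m n → H.sym (unary-trivial _) , M.sym (▷-const (π zero) (m ∙ n)) }
        ; ε-homo = T.refl }
      ; map-^*  = λ m h → T.sym (⋆-,ε (,ε-hyperaffine h))
      ; f-▷     = λ h n → T.sym (T.trans (,ε-[] h _) (unary-trivial _ , M.refl))
      }
    ; isoˡ = (λ ((h , _) , hyp) → H.refl , M.sym (hyperaffine⇒ε hyp))
           , (λ (u , m) → H.sym (unary-trivial u) , M.refl)
    ; isoʳ = (λ _ → H.refl) , (λ _ → M.refl)
    }
    where
    module D = Down theory (IsHAffUn.hyperaffineUnary hau)
    -- Computed as pairs, the two sides of the equation characterizing `t D.⋆ h` are both (m ^* h ,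
    -- m).
    ⋆-,ε : ∀ {I} {t : T.Op (Fin 1)} {h : T.Op I} → T.IsHyperaffine h →
           t D.⋆ h T.≈ (proj₂ t ^* proj₁ h , ε)
    ⋆-,ε {t = u , m} {h , n} hyp = D.⋆-unique hyp (,ε-hyperaffine _) (T.trans
      ( H.trans (H.[]-congˡ (unary-trivial u)) (H.π-[] zero _)
      , M.trans (▷-cong H.refl (λ _ → M.trans (M.∙-cong M.refl (hyperaffine⇒ε hyp)) (M.identityʳ m)))
          (▷-const u m))
      (T.sym (compose-≈ (m ^* h) (u , m))))

↓-essentiallySurjective : IsEssentiallySurjective ↓
↓-essentiallySurjective (P , nd) = (Up.theory P , hau) , Up.down≅ P hau nd
  where
  hau = Up.isHAffUn P nd

-- The triangle of equivalences

Mod-nonDegenerate : ∀ 𝕋 → Theory.NonDegenerate 𝕋 → IsNonDegenerateVariety (𝕋 -Mod)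
Mod-nonDegenerate 𝕋 nd = _ , freeModel 𝕋 (Fin 2) , Theory.π 𝕋 zero , Theory.π 𝕋 (suc zero) , nd

Mod≅PairMod∘↓ : ∀ 𝕋 →
  Isomorphism Conc (proj₁ 𝕋 -Mod) (proj₁ (Functor.F₀ ↓ 𝕋) -PairMod)
Mod≅PairMod∘↓ (𝕋 , p) = Decompositions.Mod≅PairMod 𝕋 (IsHAffUn.hyperaffineUnary p)

-- Abstract, as are the other proofs on which the functors of the triangle depend,
-- because unfolding them makes the comparison of those functors very slow.
abstract
  modCC : ∀ 𝕋 → IsHAffUn 𝕋 → IsCCVariety (𝕋 -Mod)
  modCC 𝕋 p = record
    { isVariety       = Mod-variety 𝕋
    ; nonDegenerate   = Mod-nonDegenerate 𝕋 (IsHAffUn.nonDegenerate p)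
    ; cartesianClosed = ConcreteIsomorphism.cartesianClosed (≅-sym Conc (Mod≅PairMod∘↓ (𝕋 , p)))
        (PairMod-cartesianClosed _)
    }

-- Presentations and free models are constructed for theories, exponentials for matched pairs; this
-- comparison gives the models of `P` what was constructed for theories.
UpMod≅PairMod : ∀ P (nd : IsNonDegeneratePair P) → Isomorphism Conc (Up.theory P -Mod) (P -PairMod)
UpMod≅PairMod P nd = ≅-trans Conc (Mod≅PairMod∘↓ (Up.theory P , Up.isHAffUn P nd))
  (≅-op (F-≅ PairMod (≅-underlying (Up.down≅ P (Up.isHAffUn P nd) nd))))

abstract
  pairCC : ∀ P → IsNonDegeneratePair P → IsCCVariety (P -PairMod)
  pairCC P nd = ConcreteIsomorphism.ccVariety (UpMod≅PairMod P nd)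
    (modCC (Up.theory P) (Up.isHAffUn P nd))

mod : Functor HAffUn (op ccVar)
mod = HAffUn-Mod modCC

pairMod : Functor [HAff∣Un] (op ccVar)
pairMod = [HAff∣Un]-Mod pairCC

pairMod∘↓≅mod : NaturalIsomorphism (pairMod ∘F ↓) mod
pairMod∘↓≅mod = record
  { component = λ 𝕋 → op-≅ (≅-full (≅-sym Conc (Mod≅PairMod∘↓ 𝕋)))
  -- The components are oriented along `toPairMod`, which merely restricts operations, so both
  -- routes yield the same operations on the nose.
  ; natural   = λ φ {X} _ → let open Setoid X in
      ((λ _ _ → refl) , (λ _ _ → refl)) , ((λ _ _ → refl) , (λ _ _ → refl))
  }

mod-fullyFaithful : IsFullyFaithful mod
mod-fullyFaithful = restrict-fullyFaithful modCC Mod-fullyFaithful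

module TheoryOfCCVariety {C : ConcreteCategory} (cc : IsCCVariety C) where
  private module CC = IsCCVariety cc
  open IsVariety CC.isVariety using (free; presentation) renaming (theory to 𝓔)
  open TheoryOfVariety 𝓔 free public

  C≅Mod : Isomorphism Conc C (theory -Mod)
  C≅Mod = ≅-trans Conc presentation equivalence

  isHAffUn : IsHAffUn theory
  isHAffUn = record
    { hyperaffineUnary = CartesianClosedTheory.isHyperaffineUnary theory
        (ConcreteIsomorphism.cartesianClosed C≅Mod CC.cartesianClosed)
    ; nonDegenerate    = nonDegenerate
        (ConcreteIsomorphism.nonDegenerateVariety presentation CC.nonDegenerate)
    }

  -- The finitary presentation is related only through `C` to the presentation that defines
  -- `theory`, so the two isomorphisms are composed.
  isFinitary : IsFinitaryVariety C → Theory.IsFinitary theory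
  isFinitary (𝓔′ , fin , iso) = finitary fin (≅-trans Conc (≅-sym Conc presentation) iso)

mod-essentiallySurjective : IsEssentiallySurjective mod
mod-essentiallySurjective (C , cc) = (theory , isHAffUn) , op-≅ (≅-full (≅-sym Conc C≅Mod))
  where open TheoryOfCCVariety cc

pairMod-fullyFaithful : IsFullyFaithful pairMod
pairMod-fullyFaithful = cancel-fullyFaithful {F = ↓} {pairMod} {mod} pairMod∘↓≅mod
  ↓-fullyFaithful ↓-essentiallySurjective mod-fullyFaithful

pairMod-essentiallySurjective : IsEssentiallySurjective pairMod
pairMod-essentiallySurjective = cancel-essentiallySurjective {F = ↓} {pairMod} {mod} pairMod∘↓≅mod mod-essentiallySurjective

abstract
  ↓-fin : ∀ 𝕋 → Theory.IsFinitary (proj₁ 𝕋) → IsFinitaryPair (proj₁ (Functor.F₀ ↓ 𝕋))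
  ↓-fin (𝕋 , p) = Decompositions.subtheory-finitary 𝕋 (IsHAffUn.hyperaffineUnary p)

abstract
  modFin : ∀ 𝕋 → Theory.IsFinitary (proj₁ 𝕋) → IsFinitaryVariety (proj₁ (Functor.F₀ mod 𝕋))
  modFin (𝕋 , _) = Mod-finitaryVariety 𝕋

abstract
  pairFin : ∀ P → IsFinitaryPair (proj₁ P) → IsFinitaryVariety (proj₁ (Functor.F₀ pairMod P))
  pairFin (P , nd) fin = ConcreteIsomorphism.finitaryVariety (UpMod≅PairMod P nd)
    (Mod-finitaryVariety (Up.theory P) (Up.finitary P fin))

-- The finitary triangle

↓ω : Functor HAffUnω [HAffω∣Un]
↓ω = restrict ↓ ↓-fin

modω : Functor HAffUnω (op ccVarω)
modω = restrict mod modFin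

pairModω : Functor [HAffω∣Un] (op ccVarω)
pairModω = restrict pairMod pairFin

pairModω∘↓ω≅modω : NaturalIsomorphism (pairModω ∘F ↓ω) modω
pairModω∘↓ω≅modω = restrict-natural {F = ↓} {pairMod} {mod}
  {λ 𝕋 → Theory.IsFinitary (proj₁ 𝕋)} {λ P → IsFinitaryPair (proj₁ P)} {λ C → IsFinitaryVariety (proj₁ C)}
  ↓-fin pairFin modFin pairMod∘↓≅mod

↓ω-fullyFaithful : IsFullyFaithful ↓ω
↓ω-fullyFaithful = restrict-fullyFaithful {F = ↓} ↓-fin ↓-fullyFaithful

↓ω-essentiallySurjective : IsEssentiallySurjective ↓ω
↓ω-essentiallySurjective =
  restrict-essentiallySurjective {F = ↓} ↓-fin ↓-essentiallySurjective (λ (P , _) → Up.finitary P)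

modω-fullyFaithful : IsFullyFaithful modω
modω-fullyFaithful = restrict-fullyFaithful {F = mod} modFin mod-fullyFaithful

modω-essentiallySurjective : IsEssentiallySurjective modω
modω-essentiallySurjective = restrict-essentiallySurjective {F = mod} modFin mod-essentiallySurjective
  (λ (_ , cc) → TheoryOfCCVariety.isFinitary cc)

theorem6p9 :
  Σ[ modCC  ∈ (∀ 𝕋 → IsHAffUn 𝕋 → IsCCVariety (𝕋 -Mod)) ]
  Σ[ pairCC ∈ (∀ P → IsNonDegeneratePair P → IsCCVariety (P -PairMod)) ]
  let mod : Functor HAffUn (op ccVar)
      mod = HAffUn-Mod modCC
      pairMod : Functor [HAff∣Un] (op ccVar)
      pairMod = [HAff∣Un]-Mod pairCC
  in IsEquivalenceOfCategories ↓
   × IsEquivalenceOfCategories mod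
   × IsEquivalenceOfCategories pairMod
   × NaturalIsomorphism (pairMod ∘F ↓) mod
   × (Σ[ ↓-fin ∈ (∀ 𝕋 → Theory.IsFinitary (proj₁ 𝕋) → IsFinitaryPair (proj₁ (Functor.F₀ ↓ 𝕋))) ]
      Σ[ modFin ∈ (∀ 𝕋 → Theory.IsFinitary (proj₁ 𝕋) → IsFinitaryVariety (proj₁ (Functor.F₀ mod 𝕋))) ]
      Σ[ pairFin ∈ (∀ P → IsFinitaryPair (proj₁ P) → IsFinitaryVariety (proj₁ (Functor.F₀ pairMod P))) ]
      let ↓ω : Functor HAffUnω [HAffω∣Un]
          ↓ω = restrict ↓ ↓-fin
          modω : Functor HAffUnω (op ccVarω)
          modω = restrict mod modFin
          pairModω : Functor [HAffω∣Un] (op ccVarω)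
          pairModω = restrict pairMod pairFin
      in IsEquivalenceOfCategories ↓ω
       × IsEquivalenceOfCategories modω
       × IsEquivalenceOfCategories pairModω
       × NaturalIsomorphism (pairModω ∘F ↓ω) modω)
theorem6p9 = modCC , pairCC
  , isEquivalence ↓ ↓-fullyFaithful ↓-essentiallySurjective
  , isEquivalence mod mod-fullyFaithful mod-essentiallySurjective
  , isEquivalence pairMod pairMod-fullyFaithful pairMod-essentiallySurjective
  , pairMod∘↓≅mod
  , ↓-fin , modFin , pairFin
  , isEquivalence ↓ω ↓ω-fullyFaithful ↓ω-essentiallySurjective
  , isEquivalence modω modω-fullyFaithful modω-essentiallySurjective
  , isEquivalence pairModω
      (cancel-fullyFaithful {F = ↓ω} {pairModω} {modω} pairModω∘↓ω≅modω
        ↓ω-fullyFaithful ↓ω-essentiallySurjective modω-fullyFaithful)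
      (cancel-essentiallySurjective {F = ↓ω} {pairModω} {modω} pairModω∘↓ω≅modω modω-essentiallySurjective)
  , pairModω∘↓ω≅modω
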